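{- There are non-deterministic $\mathsf{MSO}$-transductions $\tau_1,\tau_2,\tau_3,\tau_4$ such that: (1) given any (directed) graph $G$ as input, $\tau_1$ outputs the modular decomposition $(T,F)$ of $G$; (2) given any (directed) cograph $G$, $\tau_2$ outputs the cotree $(T,\lambda)$ of $G$; (3) given any (directed) graph $G$, $\tau_3$ outputs a split decomposition $(T,F)$ of $G$; (4) given any (undirected) graph $G$, $\tau_4$ outputs a bi-join decomposition $(T,F)$ of $G$. Here "$\tau_i$ outputs a decomposition of $G$" means that $\tau_i(G)$ is non-empty and every structure in $\tau_i(G)$ models, up to isomorphism, a decomposition of $G$ of the named kind.
   Context: All structures are finite; graphs are finite, loopless, with non-empty vertex set, modelled with universe $V(G)$ and one binary relation $\mathsf{edge}$ (symmetric for undirected graphs). $\mathsf{MSO}$ is monadic second-order logic without counting predicates; set quantification is over sets of vertices (elements). Transductions. A transduction from vocabulary $\Sigma$ to $\Gamma$ is a set $\tau$ of pairs ($\Sigma$-structure, $\Gamma$-structure); $\tau(\mathbb A)=\{\mathbb B:(\mathbb A,\mathbb B)\in\tau\}$. An $\mathsf{MSO}$-transduction is a composition of finitely many atomic transductions of the kinds: (Colouring) for some $k$, add $k$ new unary relations, every possible interpretation giving an output; (Copying) for some $k$, add $k$ disjoint copies of the universe, keep the old relations and predicates on the original elements, and add binary relations $\mathsf{copy}_i(x,y)$, $0\le i\le k$, saying that $x$ is the $i$-th copy of the original element $y$ (with $\mathsf{copy}_0(x,y)$ meaning $x=y$ is original); (Filtering) for an $\mathsf{MSO}$-sentence $\chi$,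 output the input unchanged if it satisfies $\chi$ and output nothing otherwise; (Interpretation) given $\mathsf{MSO}$-formulas $\phi(x)$ and $\psi_Q$ for $Q\in\Gamma$ (with as many free variables as the arity of $Q$, set variables if $Q$ is a predicate on sets), output the $\Gamma$-structure whose universe is the set of elements satisfying $\phi$ and in which each $Q\in\Gamma$ is interpreted as the set of tuples (over the new universe) satisfying $\psi_Q$. Non-deterministic means that colourings are allowed. Modular decomposition. A module of $G$ is a non-empty $M\subseteq V(G)$ such that for all $v\notin M$ and $u,u'\in M$: $(v,u)\in E(G)$ iff $(v,u')\in E(G)$, and $(u,v)\in E(G)$ iff $(u',v)\in E(G)$. A module is strong if it crosses no other module (two sets cross if they intersect and neither contains the other). The modular tree $T$ is the rooted tree whose nodes are the strong modules, with descendant relation given by inclusion. The modular decomposition is $(T,F)$, where $F$ is the set of ordered pairs $(s,s')$ of distinct siblings of $T$ such that there is an edge of $G$ from a vertex of the module $s$ to a vertex of the module $s'$ (equivalently, all such edges exist). It is modelled with universe $V(T)$, the descendant relation and the binary relation $F$. Cotree. A (directed) cograph is a graph obtained from single-vertex graphs by repeated disjoint union (parallel), series composition (disjoint union plus all edges in both directions between the parts) and, in the directed case, order composition (disjoint union of $G_1,G_2$ plus all edges from $G_1$ to $G_2$). Equivalently, for each inner node $t$ of the modular tree $T$, $F$ restricted to the children of $t$ is empty, or complete in both directions, or a strict linear order. The cotree $(T,\lambda)$ is the modular tree with each inner node labelled parallel, series or order accordingly, the children of order nodes being equipped with that linear order; it is modelled with universe $V(T)$, the descendant relation, unary relations for labels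 and a binary relation for the orders. Trees of bipartitions. Bipartitions $\{X,Y\}$, $\{X',Y'\}$ of $V(G)$ (into non-empty parts) cross if $X\cap X'$, $X\cap Y'$, $Y\cap X'$, $Y\cap Y'$ are all non-empty. For a family of bipartitions containing all $\{\{v\},V(G)\setminus\{v\}\}$, its strong members are those crossing no other member; there is a unique unrooted tree $T$ with leaf set $V(G)$ and all inner nodes of degree at least $3$ whose edges correspond bijectively to the strong members via the bipartition of the leaves obtained by deleting the edge. We call it the tree of strong members. For an inner node $t$ and an edge $e$ at $t$, let $C_t(e)$ be the set of leaves separated from $t$ by $e$. Split decomposition. A split of $G$ is a bipartition $\{X,Y\}$ of $V(G)$ into non-empty parts such that $E(G)\cap(X\times Y)=X_1\times Y_1$ and $E(G)\cap(Y\times X)=Y_2\times X_2$ for some $X_1,X_2\subseteq X$ and $Y_1,Y_2\subseteq Y$ (possibly empty). A split decomposition of $G$ is $(T,F)$ where $T$ is the tree of strong splits, and $F$ records at each inner node $t$ the quotient graph: for neighbours $x\ne y$ of $t$ in $T$, $(t,x,y)\in F$ iff $G$ has an edge from $C_t(tx)$ to $C_t(ty)$. It is modelled with universe $V(T)$, the edge relation of $T$ and the ternary relation $F$. Bi-join decomposition. A bi-join of an undirected graph $G$ is a bipartition $\{X,Y\}$ of $V(G)$ into non-empty parts for which there are $X'\subseteq X$, $Y'\subseteq Y$ such that the edges between $X$ and $Y$ are exactly all pairs between $X'$ and $Y'$ and all pairs between $X\setminus X'$ and $Y\setminus Y'$. A bi-join decomposition of $G$ is $(T,F)$ where $T$ is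 the tree of strong bi-joins, together with, for each edge $e$ of $T$ with bi-join $\{X,Y\}$ and a choice of $X'\subseteq X$, $Y'\subseteq Y$ such that the edges of $G$ between $X$ and $Y$ are exactly all pairs between $X'$ and $Y'$ and all pairs between $X\setminus X'$ and $Y\setminus Y'$, four auxiliary vertices, one for each of $X',X\setminus X',Y',Y\setminus Y'$ (considered incident with $e$), and $F$ is the symmetric binary relation consisting of: for each edge $e$, the pairs joining the auxiliary vertices of $X'$ and $Y'$ and those of $X\setminus X'$ and $Y\setminus Y'$; for each inner node $t$ and distinct edges $e,f$ at $t$, the pairs joining the auxiliary vertex of a non-empty class $A\subseteq C_t(e)$ of $e$ and that of a non-empty class $B\subseteq C_t(f)$ of $f$ when all vertices of $A$ are adjacent in $G$ to all vertices of $B$; and for each leaf $v$, the pair joining $v$ and the auxiliary vertex (of the edge at $v$) of the class $\{v\}$. It is modelled with universe the nodes of $T$ and the auxiliary vertices, the edge relation of $T$, the relation $F$, and a binary incidence relation relating each auxiliary vertex of $e$ on the side $X$ to the endpoint of $e$ lying on the side $X$. -}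

module Defs where

open import Data.Bool.Base using (Bool; true; false; T)
open import Data.Fin.Base using (Fin; zero; suc; fromℕ; inject₁; splitAt)
open import Data.Fin.Properties using (any?) renaming (_≟_ to _≟ᶠ_)
open import Data.Fin.Subset
  using (Subset; _∈_; _∉_; _⊆_; _⊂_; _∩_; _∪_; _─_; ∣_∣; Nonempty; ⊤; ⊥)
open import Data.Fin.Subset.Properties using (_∈?_)
open import Data.List.Base using (List; []; _∷_; map; _++_; allFin)
open import Data.List.Membership.Propositional renaming (_∈_ to _∈ˡ_) using ()
open import Data.List.Membership.Propositional.Properties
  using (∈-++⁺ˡ; ∈-++⁺ʳ; ∈-map⁺; ∈-allFin)
open import Data.List.Relation.Unary.Any using (here; there)
open import Data.Nat.Base using (ℕ; suc; _+_; _≤_; _<_; NonZero)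
open import Data.Product.Base using (∃; ∃-syntax; _×_; _,_)
open import Data.Sum.Base using (_⊎_; inj₁; inj₂; [_,_]′)
open import Data.Vec.Base as Vec using (Vec; []; _∷_; lookup; tabulate)
open import Function.Base using (const)
open import Function.Bundles using (_⇔_; _↔_; Inverse)
open import Function.Definitions using (Injective)
open import Level using (0ℓ)
open import Relation.Binary.Core using (REL)
open import Relation.Binary.Construct.Closure.ReflexiveTransitive using (Star; ε; _◅_)
open import Relation.Binary.PropositionalEquality using (_≡_; _≢_; refl)
open import Relation.Nullary.Decidable using (does; _×-dec_)
open import Relation.Nullary.Negation using (¬_)

------------------------------------------------------------------------
-- Vocabularies and finite structures

-- A symbol is either a relation on elements or a predicate on sets.
data Sort : Set where
  element set : Sort

record Vocabulary : Set₁ where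
  field
    Symbol   : Set
    symbols  : List Symbol
    complete : ∀ Q → Q ∈ˡ symbols
    sort     : Symbol → Sort
    arity    : Symbol → ℕ

open Vocabulary

Object : ℕ → Sort → Set
Object n element = Fin n
Object n set     = Subset n

-- The universe is Fin size.  Relations are Bool-valued, so that satisfaction
-- of MSO-formulas has its classical meaning.
record Structure (𝒱 : Vocabulary) : Set where
  field
    size : ℕ
    rel  : (Q : Symbol 𝒱) → Vec (Object size (sort 𝒱 Q)) (arity 𝒱 Q) → Bool

open Structure

Universe : ∀ {𝒱} → Structure 𝒱 → Set
Universe 𝔸 = Fin (size 𝔸)

extend : Vocabulary → (k a : ℕ) → Vocabulary
extend 𝒱 k a = record
  { Symbol   = Symbol 𝒱 ⊎ Fin k
  ; symbols  = map inj₁ (symbols 𝒱) ++ map inj₂ (allFin k)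
  ; complete = λ where
      (inj₁ Q) → ∈-++⁺ˡ (∈-map⁺ inj₁ (complete 𝒱 Q))
      (inj₂ i) → ∈-++⁺ʳ (map inj₁ (symbols 𝒱)) (∈-map⁺ inj₂ (∈-allFin i))
  ; sort     = [ sort 𝒱 , const element ]′
  ; arity    = [ arity 𝒱 , const a ]′
  }

------------------------------------------------------------------------
-- Monadic second-order logic

Variable : (e s : ℕ) → Sort → Set
Variable e s element = Fin e
Variable e s set     = Fin s

-- Formula 𝒱 e s: formulas with e free element variables and s free set
-- variables (de Bruijn indices, one index space for each sort).
data Formula (𝒱 : Vocabulary) : (e s : ℕ) → Set where
  atom      : ∀ {e s} (Q : Symbol 𝒱) →
              Vec (Variable e s (sort 𝒱 Q)) (arity 𝒱 Q) → Formula 𝒱 e s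
  _≐_       : ∀ {e s} → Fin e → Fin e → Formula 𝒱 e s
  _∊_       : ∀ {e s} → Fin e → Fin s → Formula 𝒱 e s
  ¬′_       : ∀ {e s} → Formula 𝒱 e s → Formula 𝒱 e s
  _∧′_ _∨′_ : ∀ {e s} → Formula 𝒱 e s → Formula 𝒱 e s → Formula 𝒱 e s
  ∃₁ ∀₁     : ∀ {e s} → Formula 𝒱 (suc e) s → Formula 𝒱 e s
  ∃₂ ∀₂     : ∀ {e s} → Formula 𝒱 e (suc s) → Formula 𝒱 e s

Sentence : Vocabulary → Set
Sentence 𝒱 = Formula 𝒱 0 0

value : ∀ {n e s} → Vec (Fin n) e → Vec (Subset n) s →
        ∀ κ → Variable e s κ → Object n κ
value ρ σ element x = lookup ρ x
value ρ σ set     X = lookup σ X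

Sat : ∀ {𝒱 e s} (𝔸 : Structure 𝒱) →
      Vec (Universe 𝔸) e → Vec (Subset (size 𝔸)) s → Formula 𝒱 e s → Set
Sat {𝒱} 𝔸 ρ σ (atom Q xs) = T (rel 𝔸 Q (Vec.map (value ρ σ (sort 𝒱 Q)) xs))
Sat 𝔸 ρ σ (x ≐ y)  = lookup ρ x ≡ lookup ρ y
Sat 𝔸 ρ σ (x ∊ X)  = lookup ρ x ∈ lookup σ X
Sat 𝔸 ρ σ (¬′ φ)   = ¬ Sat 𝔸 ρ σ φ
Sat 𝔸 ρ σ (φ ∧′ ψ) = Sat 𝔸 ρ σ φ × Sat 𝔸 ρ σ ψ
Sat 𝔸 ρ σ (φ ∨′ ψ) = Sat 𝔸 ρ σ φ ⊎ Sat 𝔸 ρ σ ψ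
Sat 𝔸 ρ σ (∃₁ φ)   = ∃[ x ] Sat 𝔸 (x ∷ ρ) σ φ
Sat 𝔸 ρ σ (∀₁ φ)   = ∀ x → Sat 𝔸 (x ∷ ρ) σ φ
Sat 𝔸 ρ σ (∃₂ φ)   = ∃[ X ] Sat 𝔸 ρ (X ∷ σ) φ
Sat 𝔸 ρ σ (∀₂ φ)   = ∀ X → Sat 𝔸 ρ (X ∷ σ) φ

-- A formula whose k free variables all have sort κ.
FormulaOn : Vocabulary → Sort → ℕ → Set
FormulaOn 𝒱 element k = Formula 𝒱 k 0
FormulaOn 𝒱 set     k = Formula 𝒱 0 k

SatOn : ∀ {𝒱} (𝔸 : Structure 𝒱) κ {k} →
        FormulaOn 𝒱 κ k → Vec (Object (size 𝔸) κ) k → Set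
SatOn 𝔸 element φ xs = Sat 𝔸 xs [] φ
SatOn 𝔸 set     φ Xs = Sat 𝔸 [] Xs φ

------------------------------------------------------------------------
-- MSO-transductions

Transduction : Vocabulary → Vocabulary → Set₁
Transduction 𝒱 𝒲 = REL (Structure 𝒱) (Structure 𝒲) 0ℓ

image : ∀ {m n} → (Fin m → Fin n) → Subset m → Subset n
image f X = tabulate λ y → does (any? λ x → (x ∈? X) ×-dec (f x ≟ᶠ y))

transport : ∀ {m n} → (Fin m → Fin n) → ∀ κ → Object m κ → Object n κ
transport f element = f
transport f set     = image f

colour : ∀ {𝒱} k (𝔸 : Structure 𝒱) → (Fin k → Subset (size 𝔸)) →
         Structure (extend 𝒱 k 1)
colour k 𝔸 c = record
  { size = size 𝔸
  ; rel  = λ where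
      (inj₁ Q) xs       → rel 𝔸 Q xs
      (inj₂ i) (x ∷ []) → lookup (c i) x
  }

Colouring : ∀ {𝒱} k → Transduction 𝒱 (extend 𝒱 k 1)
Colouring k 𝔸 𝔹 = ∃[ c ] 𝔹 ≡ colour k 𝔸 c

-- Outputs of copying and of interpretation are taken up to isomorphism.
record Copying {𝒱} k (𝔸 : Structure 𝒱) (𝔹 : Structure (extend 𝒱 (suc k) 2)) : Set where
  field
    copies : (Fin (suc k) × Universe 𝔸) ↔ Universe 𝔹

  copy : Fin (suc k) → Universe 𝔸 → Universe 𝔹
  copy i x = Inverse.to copies (i , x)

  field
    rel-old  : ∀ Q ys → T (rel 𝔹 (inj₁ Q) ys) ⇔
               (∃[ xs ] ys ≡ Vec.map (transport (copy zero) (sort 𝒱 Q)) xs × T (rel 𝔸 Q xs))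
    rel-copy : ∀ i y z → T (rel 𝔹 (inj₂ i) (y ∷ z ∷ [])) ⇔
               (∃[ x ] y ≡ copy i x × z ≡ copy zero x)

Filtering : ∀ {𝒱} → Sentence 𝒱 → Transduction 𝒱 𝒱
Filtering χ 𝔸 𝔹 = 𝔹 ≡ 𝔸 × Sat 𝔸 [] [] χ

record Interpretation {𝒱 𝒲} (φ : Formula 𝒱 1 0)
         (ψ : ∀ Q → FormulaOn 𝒱 (sort 𝒲 Q) (arity 𝒲 Q))
         (𝔸 : Structure 𝒱) (𝔹 : Structure 𝒲) : Set where
  field
    ι           : Universe 𝔹 → Universe 𝔸
    ι-injective : Injective _≡_ _≡_ ι
    ι-image     : ∀ x → Sat 𝔸 (x ∷ []) [] φ ⇔ (∃[ y ] ι y ≡ x)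
    rel-new     : ∀ Q ys → T (rel 𝔹 Q ys) ⇔
                  SatOn 𝔸 (sort 𝒲 Q) (ψ Q) (Vec.map (transport ι (sort 𝒲 Q)) ys)

data AtomicTransduction : Vocabulary → Vocabulary → Set₁ where
  colouring      : ∀ {𝒱} k → AtomicTransduction 𝒱 (extend 𝒱 k 1)
  copying        : ∀ {𝒱} k → AtomicTransduction 𝒱 (extend 𝒱 (suc k) 2)
  filtering      : ∀ {𝒱} → Sentence 𝒱 → AtomicTransduction 𝒱 𝒱
  interpretation : ∀ {𝒱 𝒲} → Formula 𝒱 1 0 →
                   (∀ Q → FormulaOn 𝒱 (sort 𝒲 Q) (arity 𝒲 Q)) → AtomicTransduction 𝒱 𝒲

⟦_⟧ₐ : ∀ {𝒱 𝒲} → AtomicTransduction 𝒱 𝒲 → Transduction 𝒱 𝒲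
⟦ colouring k ⟧ₐ        = Colouring k
⟦ copying k ⟧ₐ          = Copying k
⟦ filtering χ ⟧ₐ        = Filtering χ
⟦ interpretation φ ψ ⟧ₐ = Interpretation φ ψ

MSOTransduction : Vocabulary → Vocabulary → Set₁
MSOTransduction = Star AtomicTransduction

⟦_⟧ : ∀ {𝒱 𝒲} → MSOTransduction 𝒱 𝒲 → Transduction 𝒱 𝒲
⟦ ε ⟧     𝔸 𝔹 = 𝔸 ≡ 𝔹
⟦ t ◅ τ ⟧ 𝔸 ℂ = ∃[ 𝔹 ] ⟦ t ⟧ₐ 𝔸 𝔹 × ⟦ τ ⟧ 𝔹 ℂ

Outputs : ∀ {𝒱 𝒲} → MSOTransduction 𝒱 𝒲 → Structure 𝒱 → (Structure 𝒲 → Set) → Set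
Outputs τ 𝔸 Good = (∃[ 𝔹 ] ⟦ τ ⟧ 𝔸 𝔹) × (∀ 𝔹 → ⟦ τ ⟧ 𝔸 𝔹 → Good 𝔹)

------------------------------------------------------------------------
-- Graphs

record Graph : Set where
  field
    order    : ℕ
    nonempty : NonZero order
    edge     : Fin order → Fin order → Bool
    loopless : ∀ v → ¬ T (edge v v)

open Graph

V : Graph → Set
V G = Fin (order G)

Vertices : Graph → Set
Vertices G = Subset (order G)

Edge : (G : Graph) → V G → V G → Set
Edge G u v = T (edge G u v)

Undirected : Graph → Set
Undirected G = ∀ u v → Edge G u v → Edge G v u

data GraphSymbol : Set where
  edgeˢ : GraphSymbol

GraphVocabulary : Vocabulary
GraphVocabulary = record
  { Symbol   = GraphSymbol
  ; symbols  = edgeˢ ∷ []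
  ; complete = λ { edgeˢ → here refl }
  ; sort     = λ _ → element
  ; arity    = λ _ → 2
  }

⌜_⌝ : Graph → Structure GraphVocabulary
⌜ G ⌝ = record
  { size = order G
  ; rel  = λ { edgeˢ (u ∷ v ∷ []) → edge G u v }
  }

------------------------------------------------------------------------
-- Modular decomposition

module _ (G : Graph) where

  IsModule : Vertices G → Set
  IsModule M = Nonempty M ×
    (∀ {v u u′} → v ∉ M → u ∈ M → u′ ∈ M →
       (Edge G v u ⇔ Edge G v u′) × (Edge G u v ⇔ Edge G u′ v))

  Cross : Vertices G → Vertices G → Set
  Cross M N = Nonempty (M ∩ N) × ¬ M ⊆ N × ¬ N ⊆ M

  IsStrongModule : Vertices G → Set
  IsStrongModule M = IsModule M × (∀ N → IsModule N → ¬ Cross M N)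

  record ModularTree (m : ℕ) : Set where
    field
      module-of  : Fin m → Vertices G
      strong     : ∀ t → IsStrongModule (module-of t)
      injective  : Injective _≡_ _≡_ module-of
      surjective : ∀ M → IsStrongModule M → ∃[ t ] module-of t ≡ M

    Descendant : Fin m → Fin m → Set
    Descendant s t = module-of s ⊆ module-of t

    Child : Fin m → Fin m → Set
    Child s t = module-of s ⊂ module-of t ×
      (∀ r → ¬ (module-of s ⊂ module-of r × module-of r ⊂ module-of t))

    Inner : Fin m → Set
    Inner t = ∃[ s ] Child s t

    Siblings : Fin m → Fin m → Set
    Siblings s s′ = s ≢ s′ × ∃[ t ] (Child s t × Child s′ t)

    F : Fin m → Fin m → Set
    F s s′ = Siblings s s′ ×
      ∃[ u ] ∃[ v ] (u ∈ module-of s × v ∈ module-of s′ × Edge G u v)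

data ModularSymbol : Set where
  descˢ Fˢ : ModularSymbol

ModularVocabulary : Vocabulary
ModularVocabulary = record
  { Symbol   = ModularSymbol
  ; symbols  = descˢ ∷ Fˢ ∷ []
  ; complete = λ { descˢ → here refl ; Fˢ → there (here refl) }
  ; sort     = λ _ → element
  ; arity    = λ _ → 2
  }

-- The field module-of of the tree is the isomorphism from 𝔹 to the
-- decomposition whose nodes are the strong modules themselves.
record IsModularDecomposition (G : Graph) (𝔹 : Structure ModularVocabulary) : Set where
  field
    tree : ModularTree G (size 𝔹)
  module D = ModularTree tree
  field
    rel-desc : ∀ s t → T (rel 𝔹 descˢ (s ∷ t ∷ [])) ⇔ D.Descendant s t
    rel-F    : ∀ s t → T (rel 𝔹 Fˢ (s ∷ t ∷ [])) ⇔ D.F s t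

------------------------------------------------------------------------
-- Cographs and cotrees

-- G and H side by side, with all edges from G to H when fwd holds and all
-- edges from H to G when bwd holds.
compose : (fwd bwd : Bool) → Graph → Graph → Graph
compose fwd bwd G H = record
  { order    = order G + order H
  ; nonempty = +-nonZero (order G) (nonempty G)
  ; edge     = λ u v → e (splitAt (order G) u) (splitAt (order G) v)
  ; loopless = λ v → irr (splitAt (order G) v)
  }
  where
  +-nonZero : ∀ m {n} → NonZero m → NonZero (m + n)
  +-nonZero (suc m) _ = _

  e : V G ⊎ V H → V G ⊎ V H → Bool
  e (inj₁ u) (inj₁ v) = edge G u v
  e (inj₂ u) (inj₂ v) = edge H u v
  e (inj₁ u) (inj₂ v) = fwd
  e (inj₂ u) (inj₁ v) = bwd

  irr : ∀ x → ¬ T (e x x)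
  irr (inj₁ u) = loopless G u
  irr (inj₂ v) = loopless H v

record _≅_ (G H : Graph) : Set where
  field
    bijection : V G ↔ V H
    edges     : ∀ u v → edge G u v ≡ edge H (Inverse.to bijection u) (Inverse.to bijection v)

data IsCograph : Graph → Set where
  single   : ∀ {G} → order G ≡ 1 → IsCograph G
  parallel : ∀ {G H} → IsCograph G → IsCograph H → IsCograph (compose false false G H)
  series   : ∀ {G H} → IsCograph G → IsCograph H → IsCograph (compose true true G H)
  ordered  : ∀ {G H} → IsCograph G → IsCograph H → IsCograph (compose true false G H)
  iso      : ∀ {G H} → G ≅ H → IsCograph G → IsCograph H

module CotreeLabels {G : Graph} {m : ℕ} (tree : ModularTree G m) where
  open ModularTree tree

  IsParallel : Fin m → Set
  IsParallel t = Inner t × (∀ s s′ → Child s t → Child s′ t → ¬ F s s′)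

  IsSeries : Fin m → Set
  IsSeries t = Inner t × (∀ s s′ → Child s t → Child s′ t → s ≢ s′ → F s s′)

  -- F restricted to the children of t is a strict linear order;
  -- irreflexivity is part of the definition of F.
  IsOrder : Fin m → Set
  IsOrder t = Inner t
    × (∀ s s′ → Child s t → Child s′ t → s ≢ s′ → F s s′ ⊎ F s′ s)
    × (∀ s s′ → Child s t → Child s′ t → F s s′ → ¬ F s′ s)
    × (∀ s s′ s″ → Child s t → Child s′ t → Child s″ t → F s s′ → F s′ s″ → F s s″)

  Precedes : Fin m → Fin m → Set
  Precedes s s′ = ∃[ t ] (IsOrder t × Child s t × Child s′ t × F s s′)

data CotreeSymbol : Set where
  descˢ parallelˢ seriesˢ orderˢ precedesˢ : CotreeSymbol

cotreeArity : CotreeSymbol → ℕ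
cotreeArity descˢ     = 2
cotreeArity parallelˢ = 1
cotreeArity seriesˢ   = 1
cotreeArity orderˢ    = 1
cotreeArity precedesˢ = 2

CotreeVocabulary : Vocabulary
CotreeVocabulary = record
  { Symbol   = CotreeSymbol
  ; symbols  = descˢ ∷ parallelˢ ∷ seriesˢ ∷ orderˢ ∷ precedesˢ ∷ []
  ; complete = λ where
      descˢ     → here refl
      parallelˢ → there (here refl)
      seriesˢ   → there (there (here refl))
      orderˢ    → there (there (there (here refl)))
      precedesˢ → there (there (there (there (here refl))))
  ; sort     = λ _ → element
  ; arity    = cotreeArity
  }

record IsCotree (G : Graph) (𝔹 : Structure CotreeVocabulary) : Set where
  field
    tree : ModularTree G (size 𝔹)
  module D = ModularTree tree
  module L = CotreeLabels tree
  field
    rel-desc     : ∀ s t → T (rel 𝔹 descˢ (s ∷ t ∷ [])) ⇔ D.Descendant s t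
    rel-parallel : ∀ t → T (rel 𝔹 parallelˢ (t ∷ [])) ⇔ L.IsParallel t
    rel-series   : ∀ t → T (rel 𝔹 seriesˢ (t ∷ [])) ⇔ L.IsSeries t
    rel-order    : ∀ t → T (rel 𝔹 orderˢ (t ∷ [])) ⇔ L.IsOrder t
    rel-precedes : ∀ s t → T (rel 𝔹 precedesˢ (s ∷ t ∷ [])) ⇔ L.Precedes s t

------------------------------------------------------------------------
-- Trees of bipartitions

IsBipartition : ∀ {n} → Subset n → Subset n → Set
IsBipartition X Y = Nonempty X × Nonempty Y × X ∪ Y ≡ ⊤ × X ∩ Y ≡ ⊥

CrossBip : ∀ {n} (X Y X′ Y′ : Subset n) → Set
CrossBip X Y X′ Y′ =
  Nonempty (X ∩ X′) × Nonempty (X ∩ Y′) × Nonempty (Y ∩ X′) × Nonempty (Y ∩ Y′)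

-- A family of bipartitions {X,Y} is given as a symmetric relation between X and Y.
Family : ℕ → Set₁
Family n = Subset n → Subset n → Set

Strong : ∀ {n} → Family n → Family n
Strong 𝓕 X Y = 𝓕 X Y × (∀ X′ Y′ → 𝓕 X′ Y′ → ¬ CrossBip X Y X′ Y′)

degree : (G : Graph) → V G → ℕ
degree G t = ∣ tabulate (edge G t) ∣

record Cycle (G : Graph) : Set where
  field
    {k}       : ℕ
    vertex    : Fin (3 + k) → V G
    injective : Injective _≡_ _≡_ vertex
    step      : ∀ i → Edge G (vertex (inject₁ i)) (vertex (suc i))
    close     : Edge G (vertex (fromℕ (2 + k))) (vertex zero)

record IsTree (G : Graph) : Set where
  field
    undirected : Undirected G
    connected  : ∀ s t → Star (Edge G) s t
    acyclic    : ¬ Cycle G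

DeleteEdge : (G : Graph) (s t : V G) → V G → V G → Set
DeleteEdge G s t x y = Edge G x y × ¬ (x ≡ s × y ≡ t) × ¬ (x ≡ t × y ≡ s)

record TreeOfStrongMembers {n} (𝓕 : Family n) : Set where
  field
    tree   : Graph
    isTree : IsTree tree
    leaf   : Fin n → V tree

  Inner : V tree → Set
  Inner t = 1 < degree tree t

  -- v lies on the side of s once the edge st is deleted; for an edge t x,
  -- Side x t is the set of leaves separated from t by that edge.
  Side : (s t : V tree) → Fin n → Set
  Side s t v = Star (DeleteEdge tree s t) s (leaf v)

  Displays : (s t : V tree) → Subset n → Subset n → Set
  Displays s t X Y = ∀ v → (v ∈ X ⇔ Side s t v) × (v ∈ Y ⇔ Side t s v)

  -- The last three fields give the bijection between the edges and the strong
  -- members, stated for oriented edges (s , t) and ordered pairs (X , Y).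
  field
    leaf-injective : Injective _≡_ _≡_ leaf
    leaf-image     : ∀ t → (¬ Inner t) ⇔ (∃[ v ] leaf v ≡ t)
    inner-degree   : ∀ t → Inner t → 3 ≤ degree tree t
    edge→member    : ∀ {s t} → Edge tree s t → ∃[ X ] ∃[ Y ] (Strong 𝓕 X Y × Displays s t X Y)
    member→edge    : ∀ {X Y} → Strong 𝓕 X Y → ∃[ s ] ∃[ t ] (Edge tree s t × Displays s t X Y)
    edge-unique    : ∀ {s t s′ t′ X Y} → Edge tree s t → Edge tree s′ t′ →
                     Displays s t X Y → Displays s′ t′ X Y → s ≡ s′ × t ≡ t′

------------------------------------------------------------------------
-- Split decomposition

IsSplit : (G : Graph) → Family (order G)
IsSplit G X Y = IsBipartition X Y
  × (∃[ X₁ ] ∃[ Y₁ ] (X₁ ⊆ X × Y₁ ⊆ Y ×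
       (∀ {x y} → x ∈ X → y ∈ Y → Edge G x y ⇔ (x ∈ X₁ × y ∈ Y₁))))
  × (∃[ X₂ ] ∃[ Y₂ ] (X₂ ⊆ X × Y₂ ⊆ Y ×
       (∀ {x y} → x ∈ X → y ∈ Y → Edge G y x ⇔ (y ∈ Y₂ × x ∈ X₂))))

data SplitSymbol : Set where
  edgeᵀˢ Fˢ : SplitSymbol

splitArity : SplitSymbol → ℕ
splitArity edgeᵀˢ = 2
splitArity Fˢ     = 3

SplitVocabulary : Vocabulary
SplitVocabulary = record
  { Symbol   = SplitSymbol
  ; symbols  = edgeᵀˢ ∷ Fˢ ∷ []
  ; complete = λ { edgeᵀˢ → here refl ; Fˢ → there (here refl) }
  ; sort     = λ _ → element
  ; arity    = splitArity
  }

record IsSplitDecomposition (G : Graph) (𝔹 : Structure SplitVocabulary) : Set where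
  field
    splitTree : TreeOfStrongMembers (IsSplit G)
  open TreeOfStrongMembers splitTree

  Quotient : (t x y : V tree) → Set
  Quotient t x y = Inner t × Edge tree t x × Edge tree t y × x ≢ y ×
    ∃[ u ] ∃[ v ] (Side x t u × Side y t v × Edge G u v)

  field
    isomorphism : Universe 𝔹 ↔ V tree
  open Inverse isomorphism using (to)
  field
    rel-edge : ∀ s t → T (rel 𝔹 edgeᵀˢ (s ∷ t ∷ [])) ⇔ Edge tree (to s) (to t)
    rel-F    : ∀ t x y → T (rel 𝔹 Fˢ (t ∷ x ∷ y ∷ [])) ⇔ Quotient (to t) (to x) (to y)

------------------------------------------------------------------------
-- Bi-join decomposition

record BiJoinHalves (G : Graph) (X Y X′ Y′ : Vertices G) : Set where
  field
    X′⊆X  : X′ ⊆ X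
    Y′⊆Y  : Y′ ⊆ Y
    edges : ∀ {x y} → x ∈ X → y ∈ Y →
            Edge G x y ⇔ ((x ∈ X′ × y ∈ Y′) ⊎ (x ∈ X ─ X′ × y ∈ Y ─ Y′))

IsBiJoin : (G : Graph) → Family (order G)
IsBiJoin G X Y = IsBipartition X Y × ∃[ X′ ] ∃[ Y′ ] BiJoinHalves G X Y X′ Y′

record BiJoinDecomposition (G : Graph) : Set where
  field
    biJoinTree : TreeOfStrongMembers (IsBiJoin G)
  open TreeOfStrongMembers biJoinTree public

  -- For an edge st displaying (X , Y), half s t is X′ and half t s is Y′
  -- (the value on non-edges is irrelevant).
  field
    half   : (s t : V tree) → Vertices G
    halves : ∀ {s t X Y} → Edge tree s t → Displays s t X Y →
             BiJoinHalves G X Y (half s t) (half t s)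

  -- For an edge st displaying (X , Y): X′ for true and X ∖ X′ for false.
  Class : (s t : V tree) → Bool → V G → Set
  Class s t true  v = v ∈ half s t
  Class s t false v = Side s t v × v ∉ half s t

  -- aux s t _ b is the auxiliary vertex of Class s t b, on the side of s of the edge st.
  data Vertex : Set where
    node : V tree → Vertex
    aux  : (s t : V tree) → Edge tree s t → Bool → Vertex

  data TreeEdge : Vertex → Vertex → Set where
    treeEdge : ∀ {s t} → Edge tree s t → TreeEdge (node s) (node t)

  -- Each kind of pair is symmetric; for `around` this uses that G is undirected.
  data F : Vertex → Vertex → Set where
    across  : ∀ {s t} (p : Edge tree s t) (q : Edge tree t s) b →
              F (aux s t p b) (aux t s q b)
    around  : ∀ {t x y} (p : Edge tree x t) (q : Edge tree y t) b c →
              Inner t → x ≢ y →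
              ∃ (Class x t b) → ∃ (Class y t c) →
              (∀ {u v} → Class x t b u → Class y t c v → Edge G u v) →
              F (aux x t p b) (aux y t q c)
    at-leaf : ∀ {v t} (p : Edge tree (leaf v) t) b →
              (∀ u → Class (leaf v) t b u ⇔ u ≡ v) →
              F (node (leaf v)) (aux (leaf v) t p b)
    leaf-at : ∀ {v t} (p : Edge tree (leaf v) t) b →
              (∀ u → Class (leaf v) t b u ⇔ u ≡ v) →
              F (aux (leaf v) t p b) (node (leaf v))

  data Incident : Vertex → Vertex → Set where
    incident : ∀ {s t} (p : Edge tree s t) b → Incident (aux s t p b) (node s)

data BiJoinSymbol : Set where
  edgeᵀˢ Fˢ incidenceˢ : BiJoinSymbol

BiJoinVocabulary : Vocabulary
BiJoinVocabulary = record
  { Symbol   = BiJoinSymbol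
  ; symbols  = edgeᵀˢ ∷ Fˢ ∷ incidenceˢ ∷ []
  ; complete = λ where
      edgeᵀˢ     → here refl
      Fˢ         → there (here refl)
      incidenceˢ → there (there (here refl))
  ; sort     = λ _ → element
  ; arity    = λ _ → 2
  }

record IsBiJoinDecomposition (G : Graph) (𝔹 : Structure BiJoinVocabulary) : Set where
  field
    decomposition : BiJoinDecomposition G
  module D = BiJoinDecomposition decomposition
  field
    isomorphism : Universe 𝔹 ↔ D.Vertex
  open Inverse isomorphism using (to)
  field
    rel-edge      : ∀ x y → T (rel 𝔹 edgeᵀˢ (x ∷ y ∷ [])) ⇔ D.TreeEdge (to x) (to y)
    rel-F         : ∀ x y → T (rel 𝔹 Fˢ (x ∷ y ∷ [])) ⇔ D.F (to x) (to y)
    rel-incidence : ∀ x y → T (rel 𝔹 incidenceˢ (x ∷ y ∷ [])) ⇔ D.Incident (to x) (to y)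

{-# OPTIONS --safe #-}
-- The four decompositions are trees of laminar families of vertex sets: of the
-- strong modules, or of the sides avoiding a guessed root vertex of the strong
-- splits or bi-joins.  All relations of the outputs are MSO-definable in terms
-- of the members of the family, so the problem is to represent each member
-- that is not a singleton by a vertex, boundedly often, without counting.
--
-- Depth parity is definable: the proper ancestors X of x have disjoint
-- non-empty parts X ∖ Y, where Y is the child of X containing x, so sets of
-- ancestors of x are coded by sets of vertices.  Hence a colour C defines the
-- values at all nodes of an alternating formula (conjunctions at even depth,
-- disjunctions at odd depth) whose true leaves are those in C: quantify over
-- winning strategies.  Two colours can be chosen such that every inner node
-- has children with different pairs of values.  Then from an inner node X with
-- pair a there is a path down to a leaf that avoids the pair a below X; X is
-- represented by this leaf x, and is recovered from x as the least inner node
-- with pair a that contains x.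

module Submission where

open import Defs
open import Data.Bool.Base using (Bool; true; false; T; not)
open import Data.Bool.Properties using (T?; T-≡; T-irrelevant; ¬-not) renaming (_≟_ to _≟ᵇ_)
open import Data.Empty using (⊥-elim)
open import Data.Fin.Base using (Fin; zero; suc; fromℕ; inject₁; splitAt; combine; remQuot; _↑ˡ_; _↑ʳ_)
open import Data.Fin.Patterns
open import Data.Fin.Properties
  using (any?; all?; remQuot-combine; combine-remQuot; suc-injective) renaming (_≟_ to _≟ᶠ_)
open import Data.Fin.Subset
  using (Subset; _∈_; _∉_; _⊆_; _⊂_; _∩_; _─_; ∁; ⁅_⁆; ∣_∣; Nonempty; ⊤; ⊥)
open import Data.Fin.Subset.Properties
  using (_∈?_; anySubset?; _⊆?_; _⊂?_; ∈⊤; ∉⊥; ⊆-antisym; ⊂-irref; ⊂-asymmetric; x∈⁅x⁆; x∈⁅y⁆⇒x≡y; x∈p∩q⁺; x∈p∩q⁻;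
         x∈p∪q⁺; x∈p∪q⁻; x∈∁p⇒x∉p; x∉p⇒x∈∁p; nonempty?;
         x∈p∧x∉q⇒x∈p─q; p⊆q⇒∣p∣≤∣q∣; ∣⁅x⁆∣≡1; x∈p⇒∣p-x∣<∣p∣; x∈p∧x≢y⇒x∈p-y)
open import Data.Nat.Base using (ℕ; zero; suc; _+_; _*_; _≤_; _<_; z≤n; s≤s; NonZero)
open import Data.Fin.Subset.Induction using (⊂-wellFounded; ⊃-wellFounded)
open import Data.List.Base using (List)
open import Data.List.Membership.Propositional renaming (_∈_ to _∈ˡ_) using ()
import Data.Nat.Properties as ℕₚ
import Data.Unit
import Data.Empty
open import Data.Product.Base using (Σ-syntax; ∃; ∃-syntax; _×_; _,_; proj₁; proj₂)
open import Data.Product.Function.NonDependent.Propositional using (_×-⇔_)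
open import Data.Product.Properties using (≡-dec)
open import Data.Sum.Base using (_⊎_; inj₁; inj₂; [_,_]′; map₁)
open import Data.Sum.Function.Propositional using (_⊎-⇔_)
open import Data.Vec.Base as Vec using (Vec; []; _∷_; lookup; tabulate; _++_)
open import Data.Vec.Properties
  using (lookup-map; lookup∘tabulate; tabulate∘lookup; lookup⇒[]=; []=⇒lookup; lookup-++ˡ; lookup-++ʳ; map-∘)
open import Function.Base using (id; _∘_; case_of_; flip)
open import Function.Bundles using (_⇔_; _↔_; mk⇔; mk↔ₛ′; Inverse; Equivalence)
import Function.Properties.Equivalence as ⇔
open import Function.Definitions using (Injective)
open import Induction.WellFounded using (Acc; acc)
open import Relation.Binary.Construct.Closure.ReflexiveTransitive using (Star; ε; _◅_; _◅◅_; reverse)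
open import Relation.Binary.PropositionalEquality
  using (_≡_; _≢_; refl; sym; trans; cong; cong₂; subst; subst₂)
open import Relation.Nullary.Decidable using (Dec; yes; no; does; _×-dec_; _⊎-dec_; ¬?)
import Relation.Nullary.Decidable as Dec
open import Relation.Nullary.Negation using (¬_; contradiction)

open Vocabulary
open Structure
open Graph
open Equivalence using (to; from)

T-does : ∀ {A : Set} (a? : Dec A) → T (does a?) ⇔ A
T-does (yes a) = mk⇔ (λ _ → a) _
T-does (no ¬a) = mk⇔ (λ ()) ¬a

∈⇔T : ∀ {n} {x : Fin n} {p : Subset n} → x ∈ p ⇔ T (lookup p x)
∈⇔T {x = x} {p} = mk⇔ (λ x∈p → from T-≡ ([]=⇒lookup x∈p)) (λ t → lookup⇒[]= x p (to T-≡ t))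

⟪_⟫ : ∀ {n} {P : Fin n → Set} → (∀ x → Dec (P x)) → Subset n
⟪ P? ⟫ = tabulate λ x → does (P? x)

∈⟪⟫ : ∀ {n} {P : Fin n → Set} (P? : ∀ x → Dec (P x)) {x} → x ∈ ⟪ P? ⟫ ⇔ P x
∈⟪⟫ P? {x} = mk⇔
  (λ x∈ → to (T-does (P? x)) (subst T (lookup∘tabulate _ x) (to ∈⇔T x∈)))
  (λ p → from ∈⇔T (subst T (sym (lookup∘tabulate _ x)) (from (T-does (P? x)) p)))

allSubset? : ∀ {n} {P : Subset n → Set} → (∀ X → Dec (P X)) → Dec (∀ X → P X)
allSubset? P? with anySubset? (λ X → ¬? (P? X))
... | yes (X , ¬p) = no (λ p → ¬p (p X))
... | no ¬∃        = yes (λ X → Dec.decidable-stable (P? X) (λ ¬p → ¬∃ (X , ¬p)))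

lookup-extensional : ∀ {n} {A : Set} {xs ys : Vec A n} → (∀ i → lookup xs i ≡ lookup ys i) → xs ≡ ys
lookup-extensional {xs = []}     {[]}     e = refl
lookup-extensional {xs = x ∷ xs} {y ∷ ys} e = cong₂ _∷_ (e zero) (lookup-extensional (e ∘ suc))

Sat? : ∀ {𝒱 e s} (𝔸 : Structure 𝒱) (ρ : Vec (Universe 𝔸) e) (σ : Vec (Subset (size 𝔸)) s) φ →
       Dec (Sat 𝔸 ρ σ φ)
Sat? 𝔸 ρ σ (atom Q xs) = T? _
Sat? 𝔸 ρ σ (x ≐ y)     = lookup ρ x ≟ᶠ lookup ρ y
Sat? 𝔸 ρ σ (x ∊ X)     = lookup ρ x ∈? lookup σ X
Sat? 𝔸 ρ σ (¬′ φ)      = ¬? (Sat? 𝔸 ρ σ φ)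
Sat? 𝔸 ρ σ (φ ∧′ ψ)    = Sat? 𝔸 ρ σ φ ×-dec Sat? 𝔸 ρ σ ψ
Sat? 𝔸 ρ σ (φ ∨′ ψ)    = Sat? 𝔸 ρ σ φ ⊎-dec Sat? 𝔸 ρ σ ψ
Sat? 𝔸 ρ σ (∃₁ φ)      = any? λ x → Sat? 𝔸 (x ∷ ρ) σ φ
Sat? 𝔸 ρ σ (∀₁ φ)      = all? λ x → Sat? 𝔸 (x ∷ ρ) σ φ
Sat? 𝔸 ρ σ (∃₂ φ)      = anySubset? λ X → Sat? 𝔸 ρ (X ∷ σ) φ
Sat? 𝔸 ρ σ (∀₂ φ)      = allSubset? λ X → Sat? 𝔸 ρ (X ∷ σ) φ

-- MSO-definable predicates on graphs

Pred : ℕ → ℕ → Set₁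
Pred e s = (G : Graph) → Vec (V G) e → Vec (Vertices G) s → Set

-- The formula is bundled with its correctness on every graph, so that the combinators below build
-- both at once.
record Definable {e s} (P : Pred e s) : Set where
  constructor _by_
  field
    formula : Formula GraphVocabulary e s
    defines : ∀ G ρ σ → Sat ⌜ G ⌝ ρ σ formula ⇔ P G ρ σ

open Definable public

-- Supplies the case distinctions on families that are specified only logically.
decide : ∀ {e s} {P : Pred e s} → Definable P → ∀ G ρ σ → Dec (P G ρ σ)
decide d G ρ σ = Dec.map (defines d G ρ σ) (Sat? ⌜ G ⌝ ρ σ (formula d))

infix 0 _⇔ᵈ_

module _ {e s} {P Q : Pred e s} where

  infixr 2 _×ᵈ_
  infixr 1 _⊎ᵈ_
  infixr 0 _→ᵈ_

  mapᵈ : Definable P → (∀ G ρ σ → P G ρ σ ⇔ Q G ρ σ) → Definable Q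
  mapᵈ (φ by p) P⇔Q = φ by λ G ρ σ → ⇔.trans (p G ρ σ) (P⇔Q G ρ σ)

  _×ᵈ_ : Definable P → Definable Q → Definable (λ G ρ σ → P G ρ σ × Q G ρ σ)
  (φ by p) ×ᵈ (ψ by q) = (φ ∧′ ψ) by λ G ρ σ → p G ρ σ ×-⇔ q G ρ σ

  _⊎ᵈ_ : Definable P → Definable Q → Definable (λ G ρ σ → P G ρ σ ⊎ Q G ρ σ)
  (φ by p) ⊎ᵈ (ψ by q) = (φ ∨′ ψ) by λ G ρ σ → p G ρ σ ⊎-⇔ q G ρ σ

  _→ᵈ_ : Definable P → Definable Q → Definable (λ G ρ σ → P G ρ σ → Q G ρ σ)
  (φ by p) →ᵈ (ψ by q) = ((¬′ φ) ∨′ ψ) by λ G ρ σ → mk⇔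
    [ (λ ¬x x → ⊥-elim (¬x (from (p G ρ σ) x))) , (λ y _ → to (q G ρ σ) y) ]′
    -- Implication may be rendered as a disjunction because satisfaction is decidable in finite
    -- structures.
    (λ f → case Sat? ⌜ G ⌝ ρ σ φ of λ where
      (yes x) → inj₂ (from (q G ρ σ) (f (to (p G ρ σ) x)))
      (no ¬x) → inj₁ ¬x)

¬ᵈ_ : ∀ {e s} {P : Pred e s} → Definable P → Definable (λ G ρ σ → ¬ P G ρ σ)
¬ᵈ (φ by p) = (¬′ φ) by λ G ρ σ → mk⇔ (_∘ from (p G ρ σ)) (_∘ to (p G ρ σ))

_⇔ᵈ_ : ∀ {e s} {P Q : Pred e s} → Definable P → Definable Q → Definable (λ G ρ σ → P G ρ σ ⇔ Q G ρ σ)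
p ⇔ᵈ q = mapᵈ ((p →ᵈ q) ×ᵈ (q →ᵈ p)) λ _ _ _ → mk⇔ (λ (f , g) → mk⇔ f g) (λ e → to e , from e)

∃ᵈ : ∀ {e s} {P : Pred (suc e) s} → Definable P → Definable (λ G ρ σ → ∃ λ x → P G (x ∷ ρ) σ)
∃ᵈ (φ by p) = ∃₁ φ by λ G ρ σ → mk⇔ (λ (x , q) → x , to (p G _ _) q) (λ (x , q) → x , from (p G _ _) q)

∀ᵈ : ∀ {e s} {P : Pred (suc e) s} → Definable P → Definable (λ G ρ σ → ∀ x → P G (x ∷ ρ) σ)
∀ᵈ (φ by p) = ∀₁ φ by λ G ρ σ → mk⇔ (λ q x → to (p G _ _) (q x)) (λ q x → from (p G _ _) (q x))

∃ˢ : ∀ {e s} {P : Pred e (suc s)} → Definable P → Definable (λ G ρ σ → ∃ λ X → P G ρ (X ∷ σ))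
∃ˢ (φ by p) = ∃₂ φ by λ G ρ σ → mk⇔ (λ (x , q) → x , to (p G _ _) q) (λ (x , q) → x , from (p G _ _) q)

∀ˢ : ∀ {e s} {P : Pred e (suc s)} → Definable P → Definable (λ G ρ σ → ∀ X → P G ρ (X ∷ σ))
∀ˢ (φ by p) = ∀₂ φ by λ G ρ σ → mk⇔ (λ q x → to (p G _ _) (q x)) (λ q x → from (p G _ _) (q x))

∀ᵇ : ∀ {e s} {P : Bool → Pred e s} → (∀ b → Definable (P b)) → Definable (λ G ρ σ → ∀ b → P b G ρ σ)
∀ᵇ d = mapᵈ (d false ×ᵈ d true) λ _ _ _ →
  mk⇔ (λ { (p , q) false → p ; (p , q) true → q }) (λ p → p false , p true)

module _ {e s : ℕ} where

  infix 4 _≐ᵈ_ _∊ᵈ_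

  _≐ᵈ_ : (x y : Fin e) → Definable {s = s} (λ G ρ σ → lookup ρ x ≡ lookup ρ y)
  x ≐ᵈ y = (x ≐ y) by λ _ _ _ → ⇔.refl

  _∊ᵈ_ : (x : Fin e) (X : Fin s) → Definable (λ G ρ σ → lookup ρ x ∈ lookup σ X)
  x ∊ᵈ X = (x ∊ X) by λ _ _ _ → ⇔.refl

  edgeᵈ : (x y : Fin e) → Definable {s = s} (λ G ρ σ → Edge G (lookup ρ x) (lookup ρ y))
  edgeᵈ x y = atom edgeˢ (x ∷ y ∷ []) by λ _ _ _ → ⇔.refl

module _ {e s : ℕ} where

  infix 4 _⊆ᵈ_

  _⊆ᵈ_ : (X Y : Fin s) → Definable {e} (λ G ρ σ → lookup σ X ⊆ lookup σ Y)
  X ⊆ᵈ Y = mapᵈ (∀ᵈ ((0F ∊ᵈ X) →ᵈ (0F ∊ᵈ Y))) λ _ _ _ → mk⇔ (λ f {x} → f x) (λ f x → f {x})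

  trueᵈ : Definable {e} {s} (λ _ _ _ → Data.Unit.⊤)
  trueᵈ = (∀₁ (0F ≐ 0F)) by λ _ _ _ → mk⇔ _ (λ _ _ → refl)

⊆×⊇⇔≡ : ∀ {n} {X Y : Subset n} → (X ⊆ Y × Y ⊆ X) ⇔ X ≡ Y
⊆×⊇⇔≡ = mk⇔ (λ (p , q) → ⊆-antisym p q) λ { refl → (λ x∈ → x∈) , λ x∈ → x∈ }

module _ {e s : ℕ} where

  infix 4 _⊂ᵈ_ _≡ᵈ_

  _⊂ᵈ_ : (X Y : Fin s) → Definable {e} (λ G ρ σ → lookup σ X ⊂ lookup σ Y)
  X ⊂ᵈ Y = (X ⊆ᵈ Y) ×ᵈ ∃ᵈ ((0F ∊ᵈ Y) ×ᵈ ¬ᵈ (0F ∊ᵈ X))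

  _≡ᵈ_ : (X Y : Fin s) → Definable {e} (λ G ρ σ → lookup σ X ≡ lookup σ Y)
  X ≡ᵈ Y = mapᵈ ((X ⊆ᵈ Y) ×ᵈ (Y ⊆ᵈ X)) λ _ _ _ → ⊆×⊇⇔≡

-- Enumeration of definable subsets and finite connectives

enumerate : ∀ {n} {P : Fin n → Set} → (∀ x → Dec (P x)) →
            ∃[ m ] Σ[ ι ∈ (Fin m → Fin n) ] Injective _≡_ _≡_ ι × (∀ x → P x ⇔ (∃[ y ] ι y ≡ x))
enumerate {zero} P? = 0 , (λ ()) , (λ { {()} }) , λ ()
enumerate {suc n} {P} P? with enumerate (P? ∘ suc) | P? zero
... | m , ι , inj , im | yes p = suc m , ι′ , inj′ , im′
  where
  ι′ : Fin (suc m) → Fin (suc n)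
  ι′ zero    = zero
  ι′ (suc y) = suc (ι y)
  inj′ : Injective _≡_ _≡_ ι′
  inj′ {zero}  {zero}  _  = refl
  inj′ {suc y} {suc z} eq = cong suc (inj (suc-injective eq))
  im′ : ∀ x → P x ⇔ (∃[ y ] ι′ y ≡ x)
  im′ zero    = mk⇔ (λ _ → zero , refl) (λ _ → p)
  im′ (suc x) = mk⇔ (λ q → let y , eq = to (im x) q in suc y , cong suc eq)
                    (λ { (zero , ()) ; (suc y , eq) → from (im x) (y , suc-injective eq) })
... | m , ι , inj , im | no ¬p = m , suc ∘ ι , (λ eq → inj (suc-injective eq)) , im′
  where
  im′ : ∀ x → P x ⇔ (∃[ y ] suc (ι y) ≡ x)
  im′ zero    = mk⇔ (λ p → contradiction p ¬p) (λ ())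
  im′ (suc x) = mk⇔ (λ q → let y , eq = to (im x) q in y , cong suc eq)
                    (λ { (y , eq) → from (im x) (y , suc-injective eq) })

module _ {𝒱 : Vocabulary} where

  ⋁ : ∀ {n e s} → (Fin (suc n) → Formula 𝒱 e s) → Formula 𝒱 e s
  ⋁ {zero}  φ = φ zero
  ⋁ {suc n} φ = φ zero ∨′ ⋁ (φ ∘ suc)

  ⋀ : ∀ {n e s} → (Fin n → Formula 𝒱 e s) → Formula 𝒱 e s
  ⋀ {zero}  φ = ∀₁ (0F ≐ 0F)
  ⋀ {suc n} φ = φ zero ∧′ ⋀ (φ ∘ suc)

  ⋁ᵛ : ∀ {k e s} a → (Vec (Fin (suc k)) a → Formula 𝒱 e s) → Formula 𝒱 e s
  ⋁ᵛ zero    φ = φ []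
  ⋁ᵛ (suc a) φ = ⋁ λ i → ⋁ᵛ a λ is → φ (i ∷ is)

  ∃₂* : ∀ {e} s → Formula 𝒱 e s → Formula 𝒱 e 0
  ∃₂* zero    φ = φ
  ∃₂* (suc s) φ = ∃₂* s (∃₂ φ)

  module _ (𝔸 : Structure 𝒱) where

    Sat-⋁ : ∀ {n e s ρ σ} (φ : Fin (suc n) → Formula 𝒱 e s) →
            Sat 𝔸 ρ σ (⋁ φ) ⇔ (∃[ i ] Sat 𝔸 ρ σ (φ i))
    Sat-⋁ {zero}  φ = mk⇔ (λ p → zero , p) λ { (zero , p) → p }
    Sat-⋁ {suc n} φ = mk⇔
      [ (λ p → zero , p) , (λ p → let i , q = to (Sat-⋁ (φ ∘ suc)) p in suc i , q) ]′
      λ { (zero , p) → inj₁ p ; (suc i , p) → inj₂ (from (Sat-⋁ (φ ∘ suc)) (i , p)) }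

    Sat-⋀ : ∀ {n e s ρ σ} (φ : Fin n → Formula 𝒱 e s) →
            Sat 𝔸 ρ σ (⋀ φ) ⇔ (∀ i → Sat 𝔸 ρ σ (φ i))
    Sat-⋀ {zero}  φ = mk⇔ (λ _ ()) (λ _ _ → refl)
    Sat-⋀ {suc n} φ = mk⇔
      (λ { (p , q) zero → p ; (p , q) (suc i) → to (Sat-⋀ (φ ∘ suc)) q i })
      (λ p → p zero , from (Sat-⋀ (φ ∘ suc)) (p ∘ suc))

    Sat-⋁ᵛ : ∀ {k e s ρ σ} a (φ : Vec (Fin (suc k)) a → Formula 𝒱 e s) →
             Sat 𝔸 ρ σ (⋁ᵛ a φ) ⇔ (∃[ is ] Sat 𝔸 ρ σ (φ is))
    Sat-⋁ᵛ zero    φ = mk⇔ (λ p → [] , p) λ { ([] , p) → p }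
    Sat-⋁ᵛ (suc a) φ = mk⇔
      (λ p → let i , q = to (Sat-⋁ _) p ; is , r = to (Sat-⋁ᵛ a _) q in i ∷ is , r)
      λ { (i ∷ is , p) → from (Sat-⋁ _) (i , from (Sat-⋁ᵛ a _) (is , p)) }

    Sat-∃₂* : ∀ {e ρ} s (φ : Formula 𝒱 e s) → Sat 𝔸 ρ [] (∃₂* s φ) ⇔ (∃[ σ ] Sat 𝔸 ρ σ φ)
    Sat-∃₂* zero    φ = mk⇔ (λ p → [] , p) λ { ([] , p) → p }
    Sat-∃₂* (suc s) φ = mk⇔
      (λ p → let σ , X , q = to (Sat-∃₂* s (∃₂ φ)) p in X ∷ σ , q)
      λ { (X ∷ σ , p) → from (Sat-∃₂* s (∃₂ φ)) (σ , X , p) }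

-- A transduction that guesses p sets of vertices satisfying χ and outputs
-- the pairs (i , x) for which x represents some vertex set X at index i,
-- with relations that are defined in terms of those vertex sets.

module Guess
  {Sym : Set} (syms : List Sym) (comp : ∀ Q → Q ∈ˡ syms) (ar : Sym → ℕ) (p k : ℕ)
  (χ : Formula GraphVocabulary 0 p)
  (represents : Fin (suc k) → Formula GraphVocabulary 1 (suc p))
  (relation : ∀ Q → Vec (Fin (suc k)) (ar Q) → Formula GraphVocabulary 0 (ar Q + p))
  where

  𝒲 : Vocabulary
  𝒲 = record { Symbol = Sym ; symbols = syms ; complete = comp ; sort = λ _ → element ; arity = ar }

  𝒱 : Vocabulary
  𝒱 = extend (extend GraphVocabulary p 1) (suc k) 2

  up : ∀ {s s′} → (Fin s → Fin s′ ⊎ Fin p) → Fin (suc s) → Fin (suc s′) ⊎ Fin p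
  up env zero    = inj₁ zero
  up env (suc X) = map₁ suc (env X)

  lift : ∀ {e e′} → (Fin e → Fin e′) → Fin (suc e) → Fin (suc e′)
  lift η zero    = zero
  lift η (suc x) = suc (η x)

  -- `copy` with index 0 relates only an original element to itself, so its diagonal isolates the
  -- originals.
  original : ∀ {e s} → Formula 𝒱 (suc e) s
  original = atom (inj₂ zero) (zero ∷ zero ∷ [])

  member : ∀ {e s′} → Fin e → Fin s′ ⊎ Fin p → Formula 𝒱 e s′
  member x (inj₁ X) = x ∊ X
  member x (inj₂ i) = atom (inj₁ (inj₂ i)) (x ∷ [])

  -- Element quantifiers are relativised to the original elements, and set
  -- variables are replaced by set variables or by colours.
  translate : ∀ {e s e′ s′} → (Fin e → Fin e′) → (Fin s → Fin s′ ⊎ Fin p) →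
              Formula GraphVocabulary e s → Formula 𝒱 e′ s′
  translate η env (atom edgeˢ (x ∷ y ∷ [])) = atom (inj₁ (inj₁ edgeˢ)) (η x ∷ η y ∷ [])
  translate η env (x ≐ y)  = η x ≐ η y
  translate η env (x ∊ X)  = member (η x) (env X)
  translate η env (¬′ φ)   = ¬′ translate η env φ
  translate η env (φ ∧′ ψ) = translate η env φ ∧′ translate η env ψ
  translate η env (φ ∨′ ψ) = translate η env φ ∨′ translate η env ψ
  translate η env (∃₁ φ)   = ∃₁ (original ∧′ translate (lift η) env φ)
  translate η env (∀₁ φ)   = ∀₁ ((¬′ original) ∨′ translate (lift η) env φ)
  translate η env (∃₂ φ)   = ∃₂ (translate η (up env) φ)
  translate η env (∀₂ φ)   = ∀₂ (translate η (up env) φ)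

  -- Set variable 0 of a `represents` formula is the represented set; the others are the guessed
  -- colours.
  repEnv : ∀ {s} → Fin s → Fin (suc p) → Fin s ⊎ Fin p
  repEnv X zero    = inj₁ X
  repEnv X (suc i) = inj₂ i

  node : ∀ {e s} → Fin e → Fin (suc k) → Fin s → Formula 𝒱 e s
  node y i X = ∃₁ (atom (inj₂ i) (suc y ∷ zero ∷ []) ∧′ translate (λ _ → zero) (repEnv X) (represents i))

  φ : Formula 𝒱 1 0
  φ = ⋁ λ i → ∃₂ (node zero i zero)

  ψᵢ : ∀ Q → Vec (Fin (suc k)) (ar Q) → Formula 𝒱 (ar Q) (ar Q)
  ψᵢ Q is = ⋀ (λ j → node j (lookup is j) j) ∧′ translate (λ ()) (splitAt (ar Q)) (relation Q is)

  -- The index of an argument is visible only through the `copy` relations, so all index vectors are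
  -- tried, each with its own formula `relation Q is`.
  ψ : ∀ Q → Formula 𝒱 (ar Q) 0
  ψ Q = ⋁ᵛ (ar Q) λ is → ∃₂* (ar Q) (ψᵢ Q is)

  τ : MSOTransduction GraphVocabulary 𝒲
  τ = colouring p ◅ copying k ◅ filtering (translate (λ ()) inj₂ χ) ◅ interpretation φ ψ ◅ ε

  -- What is left of an output once copying and interpretation are undone. That a set is determined
  -- by its representative is not claimed here; it depends on the choice of `represents`.
  record Output (G : Graph) (c : Vec (Vertices G) p) (𝔹 : Structure 𝒲) : Set where
    field
      index  : Universe 𝔹 → Fin (suc k)
      vertex : Universe 𝔹 → V G

    Represents : Universe 𝔹 → Vertices G → Set
    Represents y X = Sat ⌜ G ⌝ (vertex y ∷ []) (X ∷ c) (represents (index y))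

    field
      unique : ∀ {y z} → index y ≡ index z → vertex y ≡ vertex z → y ≡ z
      covers : ∀ {i x X} → Sat ⌜ G ⌝ (x ∷ []) (X ∷ c) (represents i) →
               ∃[ y ] index y ≡ i × vertex y ≡ x
      valid  : ∀ y → ∃ (Represents y)
      rels   : ∀ Q ys → T (rel 𝔹 Q ys) ⇔
               (∃[ Xs ] (∀ j → Represents (lookup ys j) (lookup Xs j))
                 × Sat ⌜ G ⌝ [] (Xs ++ c) (relation Q (Vec.map index ys)))

  module _ (G : Graph) (c : Fin p → Vertices G)
           {ℂ : Structure 𝒱} (K : Copying k (colour p ⌜ G ⌝ c) ℂ) where

    open Copying K

    C : Vec (Vertices G) p
    C = tabulate c

    o : V G → Universe ℂ
    o = copy zero

    copy-injective : ∀ {i j x y} → copy i x ≡ copy j y → i ≡ j × x ≡ y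
    copy-injective {i} {j} {x} {y} eq
      with refl ← trans (sym (Inverse.strictlyInverseʳ copies (i , x)))
                    (trans (cong (Inverse.from copies) eq) (Inverse.strictlyInverseʳ copies (j , y)))
      = refl , refl

    is-original : ∀ y → T (rel ℂ (inj₂ zero) (y ∷ y ∷ [])) ⇔ (∃[ x ] y ≡ o x)
    is-original y = mk⇔ (λ t → let x , eq , _ = to (rel-copy zero y y) t in x , eq)
                        (λ (x , eq) → from (rel-copy zero y y) (x , eq , eq))

    o⁻ : Subset (size ℂ) → Vertices G
    o⁻ Z = ⟪ (λ x → o x ∈? Z) ⟫

    o⁺ : Vertices G → Subset (size ℂ)
    o⁺ X = ⟪ (λ y → any? λ x → (y ≟ᶠ o x) ×-dec (x ∈? X)) ⟫

    ∈o⁻ : ∀ {x Z} → x ∈ o⁻ Z ⇔ o x ∈ Z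
    ∈o⁻ = ∈⟪⟫ (λ x → o x ∈? _)

    o∈o⁺ : ∀ {x X} → o x ∈ o⁺ X ⇔ x ∈ X
    o∈o⁺ {x} {X} = ⇔.trans (∈⟪⟫ (λ y → any? λ x → (y ≟ᶠ o x) ×-dec (x ∈? X))) (mk⇔
      (λ (x′ , eq , x′∈X) → subst (_∈ X) (sym (proj₂ (copy-injective eq))) x′∈X)
      (λ x∈X → x , refl , x∈X))

    o⁻o⁺ : ∀ X → o⁻ (o⁺ X) ≡ X
    o⁻o⁺ X = ⊆-antisym (λ x∈ → to o∈o⁺ (to ∈o⁻ x∈)) (λ x∈ → from ∈o⁻ (from o∈o⁺ x∈))

    Member : ∀ {s′} → Vec (Subset (size ℂ)) s′ → V G → Fin s′ ⊎ Fin p → Set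
    Member σ′ x (inj₁ X) = o x ∈ lookup σ′ X
    Member σ′ x (inj₂ i) = x ∈ c i

    Member-up : ∀ {s′} {σ′ : Vec (Subset (size ℂ)) s′} {Z x} r →
                Member σ′ x r ⇔ Member (Z ∷ σ′) x (map₁ suc r)
    Member-up (inj₁ X) = ⇔.refl
    Member-up (inj₂ i) = ⇔.refl

    Sat-member : ∀ {e s′} {ρ′ : Vec _ e} {σ′ : Vec _ s′} {y x} r → lookup ρ′ y ≡ o x →
                 Sat ℂ ρ′ σ′ (member y r) ⇔ Member σ′ x r
    Sat-member {σ′ = σ′} (inj₁ X) eq = mk⇔ (subst (_∈ lookup σ′ X) eq) (subst (_∈ lookup σ′ X) (sym eq))
    Sat-member {x = x} (inj₂ i) eq rewrite eq = ⇔.trans (rel-old (inj₂ i) _) (mk⇔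
      (λ { (x′ ∷ [] , eq′ , t) → from ∈⇔T (subst (T ∘ lookup (c i)) (sym (proj₂ (copy-injective (cong Vec.head eq′)))) t) })
      (λ x∈ → x ∷ [] , refl , to ∈⇔T x∈))

    -- Element variables always hold originals, so set variables need to agree with vertex sets on
    -- originals only. Set quantifiers can therefore stay unrelativised: `o⁻` and `o⁺` pass between
    -- subsets of the copied universe and vertex sets.
    Sat-translate : ∀ {e s e′ s′ ρ σ ρ′ σ′} (η : Fin e → Fin e′) (env : Fin s → Fin s′ ⊎ Fin p) →
      (∀ x → lookup ρ′ (η x) ≡ o (lookup ρ x)) →
      (∀ X x → x ∈ lookup σ X ⇔ Member σ′ x (env X)) →
      ∀ φ → Sat ℂ ρ′ σ′ (translate η env φ) ⇔ Sat ⌜ G ⌝ ρ σ φ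
    Sat-translate {ρ = ρ} η env eρ eσ (atom edgeˢ (x ∷ y ∷ [])) rewrite eρ x | eρ y =
      ⇔.trans (rel-old (inj₁ edgeˢ) _) (mk⇔
        (λ { (u ∷ v ∷ [] , eq , t) →
             subst₂ (λ u v → T (edge G u v))
               (sym (proj₂ (copy-injective (cong Vec.head eq))))
               (sym (proj₂ (copy-injective (cong (Vec.head ∘ Vec.tail) eq)))) t })
        (λ t → lookup ρ x ∷ lookup ρ y ∷ [] , refl , t))
    Sat-translate η env eρ eσ (x ≐ y) = mk⇔
      (λ eq → proj₂ (copy-injective (trans (sym (eρ x)) (trans eq (eρ y)))))
      (λ eq → trans (eρ x) (trans (cong o eq) (sym (eρ y))))
    Sat-translate η env eρ eσ (x ∊ X) = ⇔.trans (Sat-member (env X) (eρ x)) (⇔.sym (eσ X _))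
    Sat-translate η env eρ eσ (¬′ φ) = let e = Sat-translate η env eρ eσ φ in
      mk⇔ (_∘ from e) (_∘ to e)
    Sat-translate η env eρ eσ (φ ∧′ ψ) = Sat-translate η env eρ eσ φ ×-⇔ Sat-translate η env eρ eσ ψ
    Sat-translate η env eρ eσ (φ ∨′ ψ) = Sat-translate η env eρ eσ φ ⊎-⇔ Sat-translate η env eρ eσ ψ
    Sat-translate {σ = σ} η env eρ eσ (∃₁ φ) = mk⇔
      (λ (y , orig , q) → let x , eq = to (is-original y) orig in
        x , to (Sat-translate (lift η) env (λ { zero → eq ; (suc z) → eρ z }) eσ φ) q)
      (λ (x , q) → o x , from (is-original (o x)) (x , refl) ,
        from (Sat-translate (lift η) env (λ { zero → refl ; (suc z) → eρ z }) eσ φ) q)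
    Sat-translate {σ = σ} η env eρ eσ (∀₁ φ) = mk⇔
      (λ q x → [ (λ ¬orig → ⊥-elim (¬orig (from (is-original (o x)) (x , refl)))) ,
                 to (Sat-translate (lift η) env (λ { zero → refl ; (suc z) → eρ z }) eσ φ) ]′ (q (o x)))
      (λ q y → case T? (rel ℂ (inj₂ zero) (y ∷ y ∷ [])) of λ where
        (yes t) → let x , eq = to (is-original y) t in
          inj₂ (from (Sat-translate (lift η) env (λ { zero → eq ; (suc z) → eρ z }) eσ φ) (q x))
        (no ¬t) → inj₁ ¬t)
    Sat-translate η env eρ eσ (∃₂ φ) = mk⇔
      (λ (Z , q) → o⁻ Z , to (Sat-translate η (up env) eρ
        (λ { zero x → ∈o⁻ ; (suc X) x → ⇔.trans (eσ X x) (Member-up (env X)) }) φ) q)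
      (λ (X , q) → o⁺ X , from (Sat-translate η (up env) eρ
        (λ { zero x → ⇔.sym o∈o⁺ ; (suc X) x → ⇔.trans (eσ X x) (Member-up (env X)) }) φ) q)
    Sat-translate η env eρ eσ (∀₂ φ) = mk⇔
      (λ q X → to (Sat-translate η (up env) eρ
        (λ { zero x → ⇔.sym o∈o⁺ ; (suc X) x → ⇔.trans (eσ X x) (Member-up (env X)) }) φ) (q (o⁺ X)))
      (λ q Z → from (Sat-translate η (up env) eρ
        (λ { zero x → ∈o⁻ ; (suc X) x → ⇔.trans (eσ X x) (Member-up (env X)) }) φ) (q (o⁻ Z)))

    C⇔c : ∀ i x → x ∈ lookup C i ⇔ x ∈ c i
    C⇔c i x = mk⇔ (subst (x ∈_) (lookup∘tabulate c i)) (subst (x ∈_) (sym (lookup∘tabulate c i)))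

    Sat-node : ∀ {e s} {ρ : Vec _ e} {σ : Vec _ s} y i X → Sat ℂ ρ σ (node y i X) ⇔
      (∃[ x ] lookup ρ y ≡ copy i x × Sat ⌜ G ⌝ (x ∷ []) (o⁻ (lookup σ X) ∷ C) (represents i))
    Sat-node {ρ = ρ} {σ} y i X = mk⇔
      (λ (z , t , q) → let x , eq , eq′ = to (rel-copy i _ z) t in
        x , eq , to (e eq′) q)
      (λ (x , eq , q) → o x , from (rel-copy i _ (o x)) (x , eq , refl) , from (e refl) q)
      where
      e : ∀ {x z} → z ≡ o x → Sat ℂ (z ∷ ρ) σ (translate (λ _ → zero) (repEnv X) (represents i)) ⇔
          Sat ⌜ G ⌝ (x ∷ []) (o⁻ (lookup σ X) ∷ C) (represents i)
      e eq = Sat-translate _ (repEnv X) (λ { zero → eq })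
        (λ { zero x → ∈o⁻ ; (suc j) x → C⇔c j x }) (represents i)

    Sat-χ : Sat ℂ [] [] (translate (λ ()) inj₂ χ) ⇔ Sat ⌜ G ⌝ [] C χ
    Sat-χ = Sat-translate (λ ()) inj₂ (λ ()) C⇔c χ

    Sat-ψ : ∀ Q ys → Sat ℂ ys [] (ψ Q) ⇔
      (∃[ is ] ∃[ Xs ] (∀ j → ∃[ x ] lookup ys j ≡ copy (lookup is j) x
          × Sat ⌜ G ⌝ (x ∷ []) (lookup Xs j ∷ C) (represents (lookup is j)))
        × Sat ⌜ G ⌝ [] (Xs ++ C) (relation Q is))
    Sat-ψ Q ys = mk⇔
      (λ t → let is , u = to (Sat-⋁ᵛ ℂ (ar Q) (λ is → ∃₂* (ar Q) (ψᵢ Q is))) t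
                 Zs , v , w = to (Sat-∃₂* ℂ (ar Q) (ψᵢ Q is)) u in
        is , Vec.map o⁻ Zs ,
        (λ j → let x , eq , q = to (Sat-node j (lookup is j) j) (to (Sat-⋀ ℂ (λ j → node j (lookup is j) j)) v j) in
          x , eq , subst (λ X → Sat ⌜ G ⌝ (x ∷ []) (X ∷ C) (represents (lookup is j))) (sym (lookup-map j o⁻ Zs)) q) ,
        to (Sat-translate (λ ()) (splitAt (ar Q)) (λ ()) (env Zs (Vec.map o⁻ Zs) λ j x →
          subst (λ X → x ∈ X ⇔ (o x ∈ lookup Zs j)) (sym (lookup-map j o⁻ Zs)) ∈o⁻) (relation Q is)) w)
      (λ (is , Xs , v , w) → from (Sat-⋁ᵛ ℂ (ar Q) (λ is → ∃₂* (ar Q) (ψᵢ Q is))) (is , from (Sat-∃₂* ℂ (ar Q) (ψᵢ Q is))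
        (Vec.map o⁺ Xs ,
         from (Sat-⋀ ℂ (λ j → node j (lookup is j) j)) (λ j → let x , eq , q = v j in
           from (Sat-node j (lookup is j) j) (x , eq ,
             subst (λ X → Sat ⌜ G ⌝ (x ∷ []) (X ∷ C) (represents (lookup is j)))
               (sym (trans (cong o⁻ (lookup-map j o⁺ Xs)) (o⁻o⁺ (lookup Xs j)))) q)) ,
         from (Sat-translate (λ ()) (splitAt (ar Q)) (λ ()) (env (Vec.map o⁺ Xs) Xs λ j x →
           subst (λ Z → _ ⇔ o x ∈ Z) (sym (lookup-map j o⁺ Xs)) (⇔.sym o∈o⁺)) (relation Q is)) w)))
      where
      env : ∀ {a} (Zs : Vec (Subset (size ℂ)) a) (Xs : Vec (Vertices G) a) →
            (∀ j x → x ∈ lookup Xs j ⇔ o x ∈ lookup Zs j) →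
            ∀ X x → x ∈ lookup (Xs ++ C) X ⇔ Member Zs x (splitAt a X)
      env {zero}  []       []       e X       x = C⇔c X x
      env {suc a} (Z ∷ Zs) (Y ∷ Xs) e zero    x = e zero x
      env {suc a} (Z ∷ Zs) (Y ∷ Xs) e (suc X) x =
        ⇔.trans (env Zs Xs (e ∘ suc) X x) (Member-up (splitAt a X))

    output : ∀ {𝔹} → Interpretation φ ψ ℂ 𝔹 → Output G C 𝔹
    output {𝔹} I = record
      { index  = index
      ; vertex = vertex
      ; unique = λ {y} {z} eq eq′ → ι-injective (trans (sym (copy-ι y)) (trans (cong₂ copy eq eq′) (copy-ι z)))
      ; covers = λ {i} {x} {X} q →
          let y , eq = to (ι-image (copy i x)) (from (Sat-⋁ ℂ (λ i → ∃₂ (node zero i zero))) (i , o⁺ X ,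
                from (Sat-node zero i zero) (x , refl , subst (λ X → Sat ⌜ G ⌝ (x ∷ []) (X ∷ C) (represents i)) (sym (o⁻o⁺ X)) q)))
              eq₁ , eq₂ = copy-injective (trans (copy-ι y) eq)
          in y , eq₁ , eq₂
      ; valid  = λ y →
          let i , Z , q = to (Sat-⋁ ℂ (λ i → ∃₂ (node zero i zero))) (from (ι-image (ι y)) (y , refl))
              x , eq , r = to (Sat-node zero i zero) q
              eq₁ , eq₂ = copy-injective (trans (copy-ι y) eq)
          in o⁻ Z , subst₂ (λ i x → Sat ⌜ G ⌝ (x ∷ []) (o⁻ Z ∷ C) (represents i)) (sym eq₁) (sym eq₂) r
      ; rels   = λ Q ys → ⇔.trans (rel-new Q ys) (⇔.trans (Sat-ψ Q (Vec.map ι ys)) (mk⇔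
          (λ (is , Xs , v , w) →
            let e : ∀ j → lookup is j ≡ lookup (Vec.map index ys) j
                e j = let x , eq , q = v j in
                  trans (sym (proj₁ (copy-injective (trans (copy-ι (lookup ys j)) (trans (sym (lookup-map j ι ys)) eq)))))
                        (sym (lookup-map j index ys))
            in Xs ,
              (λ j → let x , eq , q = v j
                         eq₁ , eq₂ = copy-injective (trans (copy-ι (lookup ys j)) (trans (sym (lookup-map j ι ys)) eq))
                     in subst₂ (λ i x → Sat ⌜ G ⌝ (x ∷ []) (lookup Xs j ∷ C) (represents i)) (sym eq₁) (sym eq₂) q) ,
              subst (λ is → Sat ⌜ G ⌝ [] (Xs ++ C) (relation Q is)) (lookup-extensional e) w)
          (λ (Xs , v , w) → Vec.map index ys , Xs ,
            (λ j → vertex (lookup ys j) ,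
              trans (lookup-map j ι ys) (trans (sym (copy-ι (lookup ys j))) (cong (λ i → copy i (vertex (lookup ys j))) (sym (lookup-map j index ys)))) ,
              subst (λ i → Sat ⌜ G ⌝ (vertex (lookup ys j) ∷ []) (lookup Xs j ∷ C) (represents i)) (sym (lookup-map j index ys)) (v j)) ,
            w)))
      }
      where
      open Interpretation I
      index : Universe 𝔹 → Fin (suc k)
      index y = proj₁ (Inverse.from copies (ι y))
      vertex : Universe 𝔹 → V G
      vertex y = proj₂ (Inverse.from copies (ι y))
      copy-ι : ∀ y → copy (index y) (vertex y) ≡ ι y
      copy-ι y = Inverse.strictlyInverseˡ copies (ι y)

  outputs : ∀ {G 𝔹} → ⟦ τ ⟧ ⌜ G ⌝ 𝔹 → ∃[ c ] (Sat ⌜ G ⌝ [] c χ × Output G c 𝔹)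
  outputs {G} (_ , (c , refl) , ℂ , K , .ℂ , (refl , q) , _ , I , refl) =
    tabulate c , to (Sat-χ G c K) q , output G c K I

  -- Copying is a relation up to isomorphism, so one concrete result has to be exhibited before any
  -- output exists.
  copied : ∀ G (c : Fin p → Vertices G) → ∃ (Copying k (colour p ⌜ G ⌝ c))
  copied G c = ℂ , record
    { copies   = copies
    ; rel-old  = λ where
        (inj₁ edgeˢ) (y ∷ z ∷ []) → ⇔.trans (T-does (edge? y z)) (mk⇔
          (λ (u , v , eq , eq′ , t) → u ∷ v ∷ [] , cong₂ (λ a b → a ∷ b ∷ []) eq eq′ , t)
          (λ { (u ∷ v ∷ [] , refl , t) → u , v , refl , refl , t }))
        (inj₂ i) (y ∷ []) → ⇔.trans (T-does (colour? i y)) (mk⇔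
          (λ (x , eq , t) → x ∷ [] , cong (_∷ []) eq , t)
          (λ { (x ∷ [] , refl , t) → x , refl , t }))
    ; rel-copy = λ i y z → T-does (copy? i y z)
    }
    where
    n = order G
    copies : (Fin (suc k) × V G) ↔ Fin (suc k * n)
    copies = mk↔ₛ′ (λ (i , x) → combine i x) (remQuot n) (combine-remQuot {suc k} n) (λ (i , x) → remQuot-combine i x)
    cp : Fin (suc k) → V G → Fin (suc k * n)
    cp i x = combine i x
    edge? : ∀ y z → Dec (∃[ u ] ∃[ v ] y ≡ cp zero u × z ≡ cp zero v × Edge G u v)
    edge? y z = any? λ u → any? λ v → (y ≟ᶠ cp zero u) ×-dec (z ≟ᶠ cp zero v) ×-dec T? (edge G u v)
    colour? : ∀ i y → Dec (∃[ x ] y ≡ cp zero x × T (lookup (c i) x))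
    colour? i y = any? λ x → (y ≟ᶠ cp zero x) ×-dec T? (lookup (c i) x)
    copy? : ∀ i y z → Dec (∃[ x ] y ≡ cp i x × z ≡ cp zero x)
    copy? i y z = any? λ x → (y ≟ᶠ cp i x) ×-dec (z ≟ᶠ cp zero x)
    ℂ : Structure 𝒱
    ℂ = record
      { size = suc k * n
      ; rel  = λ where
          (inj₁ (inj₁ edgeˢ)) (y ∷ z ∷ []) → does (edge? y z)
          (inj₁ (inj₂ i)) (y ∷ [])         → does (colour? i y)
          (inj₂ i) (y ∷ z ∷ [])            → does (copy? i y z)
      }

  interpreted : ∀ ℂ → ∃ (Interpretation {𝒲 = 𝒲} φ ψ ℂ)
  interpreted ℂ =
    let m , ι , inj , im = enumerate (λ x → Sat? ℂ (x ∷ []) [] φ) in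
    record { size = m ; rel = λ Q ys → does (Sat? ℂ (Vec.map ι ys) [] (ψ Q)) } , record
      { ι           = ι
      ; ι-injective = inj
      ; ι-image     = im
      ; rel-new     = λ Q ys → T-does (Sat? ℂ (Vec.map ι ys) [] (ψ Q))
      }

  succeeds : ∀ G c → Sat ⌜ G ⌝ [] c χ → ∃ (⟦ τ ⟧ ⌜ G ⌝)
  succeeds G c q =
    let ℂ , K = copied G (lookup c)
        𝔹 , I = interpreted ℂ
    in 𝔹 , colour p ⌜ G ⌝ (lookup c) , (lookup c , refl) , ℂ , K , ℂ ,
       (refl , from (Sat-χ G (lookup c) K) (subst (λ c → Sat ⌜ G ⌝ [] c χ) (sym (tabulate∘lookup c)) q)) ,
       𝔹 , I , refl

-- Laminar families of sets

⊆⇒≡⊎⊂ : ∀ {n} {X Y : Subset n} → X ⊆ Y → X ≡ Y ⊎ X ⊂ Y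
⊆⇒≡⊎⊂ {X = X} {Y} X⊆Y with any? (λ x → (x ∈? Y) ×-dec ¬? (x ∈? X))
... | yes p = inj₂ (X⊆Y , p)
... | no ¬p = inj₁ (⊆-antisym X⊆Y λ {x} x∈Y → Dec.decidable-stable (x ∈? X) λ x∉X → ¬p (x , x∈Y , x∉X))

minimal : ∀ {n} {P : Subset n → Set} → (∀ X → Dec (P X)) → ∀ {X} → P X →
          ∃[ Y ] (P Y × Y ⊆ X × (∀ Z → P Z → ¬ Z ⊂ Y))
minimal {P = P} P? {X} p = go (⊂-wellFounded X) p
  where
  go : ∀ {X} → Acc _⊂_ X → P X → ∃[ Y ] (P Y × Y ⊆ X × (∀ Z → P Z → ¬ Z ⊂ Y))
  go {X} (acc rec) p with anySubset? (λ Z → P? Z ×-dec (Z ⊂? X))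
  ... | yes (Z , q , Z⊂X) = let Y , r , Y⊆Z , min = go (rec Z⊂X) q in Y , r , (λ x∈ → proj₁ Z⊂X (Y⊆Z x∈)) , min
  ... | no ¬q = X , p , id , λ Z q Z⊂X → ¬q (Z , q , Z⊂X)

maximal : ∀ {n} {P : Subset n → Set} → (∀ X → Dec (P X)) → ∀ {X} → P X →
          ∃[ Y ] (P Y × X ⊆ Y × (∀ Z → P Z → ¬ Y ⊂ Z))
maximal {P = P} P? {X} p = go (⊃-wellFounded X) p
  where
  go : ∀ {X} → Acc (flip _⊂_) X → P X → ∃[ Y ] (P Y × X ⊆ Y × (∀ Z → P Z → ¬ Y ⊂ Z))
  go {X} (acc rec) p with anySubset? (λ Z → P? Z ×-dec (X ⊂? Z))
  ... | yes (Z , q , X⊂Z) = let Y , r , Z⊆Y , max = go (rec X⊂Z) q in Y , r , (λ x∈ → Z⊆Y (proj₁ X⊂Z x∈)) , max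
  ... | no ¬q = X , p , id , λ Z q X⊂Z → ¬q (Z , q , X⊂Z)

-- Singletons are a separate assumption of `Singletons`, since the family of node sets of a tree of
-- bipartitions may lack the singleton of the root vertex.
record IsLaminar {n} (𝓛 : Subset n → Set) : Set where
  field
    𝓛?         : ∀ X → Dec (𝓛 X)
    top        : 𝓛 ⊤
    inhabited   : ∀ {X} → 𝓛 X → Nonempty X
    comparable : ∀ {X Y x} → 𝓛 X → 𝓛 Y → x ∈ X → x ∈ Y → X ⊆ Y ⊎ Y ⊆ X

Big : ∀ {n} → Subset n → Set
Big X = ∃[ x ] ∃[ y ] (x ∈ X × y ∈ X × x ≢ y)

Big? : ∀ {n} (X : Subset n) → Dec (Big X)
Big? X = any? λ x → any? λ y → (x ∈? X) ×-dec (y ∈? X) ×-dec ¬? (x ≟ᶠ y)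

small : ∀ {n} {X : Subset n} {x} → ¬ Big X → x ∈ X → X ≡ ⁅ x ⁆
small {X = X} {x} ¬big x∈X = ⊆-antisym
  (λ {y} y∈X → case x ≟ᶠ y of λ where
    (yes refl) → x∈⁅x⁆ x
    (no x≢y)   → contradiction (x , y , x∈X , y∈X , x≢y) ¬big)
  (λ y∈ → subst (_∈ X) (sym (x∈⁅y⁆⇒x≡y x y∈)) x∈X)

⁅⁆-small : ∀ {n} {x : Fin n} → ¬ Big ⁅ x ⁆
⁅⁆-small {x = x} (y , z , y∈ , z∈ , y≢z) = y≢z (trans (x∈⁅y⁆⇒x≡y x y∈) (sym (x∈⁅y⁆⇒x≡y x z∈)))

module Family {n} (𝓛 : Subset n → Set) where

  Inner : Subset n → Set
  Inner X = 𝓛 X × Big X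

  Child : Subset n → Subset n → Set
  Child X Y = 𝓛 X × 𝓛 Y × X ⊂ Y × (∀ Z → 𝓛 Z → ¬ (X ⊂ Z × Z ⊂ Y))

module Laminar {n} {𝓛 : Subset n → Set} (isLaminar : IsLaminar 𝓛) where
  open IsLaminar isLaminar
  open Family 𝓛

  Inner? : ∀ X → Dec (Inner X)
  Inner? X = 𝓛? X ×-dec Big? X

  child⇒inner : ∀ {X Y} → Child X Y → Inner Y
  child⇒inner (p , q , (X⊆Y , y , y∈Y , y∉X) , _) = let x , x∈X = inhabited p in
    q , x , y , X⊆Y x∈X , y∈Y , λ { refl → y∉X x∈X }

  parent : ∀ {X} → 𝓛 X → X ≢ ⊤ → ∃ (Child X)
  parent {X} p X≢⊤ =
    let Y , (q , X⊂Y) , _ , min = minimal (λ Z → 𝓛? Z ×-dec (X ⊂? Z)) (top , X⊂⊤)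
    in Y , p , q , X⊂Y , λ Z r (X⊂Z , Z⊂Y) → min Z (r , X⊂Z) Z⊂Y
    where
    X⊂⊤ : X ⊂ ⊤
    X⊂⊤ with ⊆⇒≡⊎⊂ (λ {x} (_ : x ∈ X) → ∈⊤)
    ... | inj₁ eq = contradiction eq X≢⊤
    ... | inj₂ lt = lt

  parent-⊆ : ∀ {X Y Z} → Child X Y → 𝓛 Z → X ⊂ Z → Y ⊆ Z
  parent-⊆ (p , q , X⊂Y , btw) r X⊂Z with x , x∈X ← inhabited p
    with comparable q r (proj₁ X⊂Y x∈X) (proj₁ X⊂Z x∈X)
  ... | inj₁ Y⊆Z = Y⊆Z
  ... | inj₂ Z⊆Y with ⊆⇒≡⊎⊂ Z⊆Y
  ...   | inj₁ refl = id
  ...   | inj₂ Z⊂Y  = contradiction (X⊂Z , Z⊂Y) (btw _ r)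

  parent-unique : ∀ {X Y Y′} → Child X Y → Child X Y′ → Y ≡ Y′
  parent-unique c@(_ , q , X⊂Y , _) c′@(_ , q′ , X⊂Y′ , _) =
    ⊆-antisym (parent-⊆ c q′ X⊂Y′) (parent-⊆ c′ q X⊂Y)

  childAbove : ∀ {X Y} → 𝓛 X → 𝓛 Y → X ⊂ Y → ∃[ Z ] (Child Z Y × X ⊆ Z)
  childAbove {X} {Y} p q X⊂Y =
    let Z , (r , Z⊂Y) , X⊆Z , max = maximal (λ Z → 𝓛? Z ×-dec (Z ⊂? Y)) (p , X⊂Y)
    in Z , (r , q , Z⊂Y , λ W s (Z⊂W , W⊂Y) → max W (s , W⊂Y) Z⊂W) , X⊆Z

  child-⊇ : ∀ {X Y Z x} → Child X Y → 𝓛 Z → Z ⊂ Y → x ∈ X → x ∈ Z → Z ⊆ X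
  child-⊇ (p , q , X⊂Y , btw) r Z⊂Y x∈X x∈Z with comparable r p x∈Z x∈X
  ... | inj₁ Z⊆X = Z⊆X
  ... | inj₂ X⊆Z with ⊆⇒≡⊎⊂ X⊆Z
  ...   | inj₁ refl = id
  ...   | inj₂ X⊂Z  = contradiction (X⊂Z , Z⊂Y) (btw _ r)

  child-unique : ∀ {X X′ Y x} → Child X Y → Child X′ Y → x ∈ X → x ∈ X′ → X ≡ X′
  child-unique c@(p , _ , lt , _) c′@(p′ , _ , lt′ , _) x∈X x∈X′ =
    ⊆-antisym (child-⊇ c′ p lt x∈X′ x∈X) (child-⊇ c p′ lt′ x∈X x∈X′)

  fromRoot : (P : Subset n → Set) → P ⊤ → (∀ {X Y} → Child X Y → P Y → P X) → ∀ {X} → 𝓛 X → P X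
  fromRoot P root step {X} p = go (⊃-wellFounded X) p
    where
    go : ∀ {X} → Acc (flip _⊂_) X → 𝓛 X → P X
    go {X} (acc rec) p with Dec.map ⊆×⊇⇔≡ ((X ⊆? ⊤) ×-dec (⊤ ⊆? X))
    ... | yes refl = root
    ... | no X≢⊤ = let Y , c@(_ , q , X⊂Y , _) = parent p X≢⊤ in step c (go (rec X⊂Y) q)

  module Singletons (singleton : ∀ x → 𝓛 ⁅ x ⁆) where

    childAt : ∀ {X x} → Inner X → x ∈ X → ∃[ Y ] (Child Y X × x ∈ Y)
    childAt {X} {x} (p , big) x∈X =
      let Y , c , x⊆Y = childAbove (singleton x) p x⊂X in Y , c , x⊆Y (x∈⁅x⁆ x)
      where
      x⊂X : ⁅ x ⁆ ⊂ X
      x⊂X with ⊆⇒≡⊎⊂ {X = ⁅ x ⁆} {X} (λ y∈ → subst (_∈ X) (sym (x∈⁅y⁆⇒x≡y x y∈)) x∈X)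
      ... | inj₁ refl = contradiction big ⁅⁆-small
      ... | inj₂ lt   = lt

    anotherChild : ∀ {X Y} → Child Y X → ∃[ Z ] (Child Z X × Z ≢ Y)
    anotherChild c@(_ , _ , (_ , x , x∈X , x∉Y) , _) =
      let Z , c′ , x∈Z = childAt (child⇒inner c) x∈X in Z , c′ , λ Z≡Y → x∉Y (subst (x ∈_) Z≡Y x∈Z)

    -- The children chosen by `step` form a path to a leaf, and by `child-⊇` every member below `X`
    -- that contains this leaf lies on the path.
    descend : (P : Subset n → Set) → (∀ {X} → Inner X → P X → ∃[ Y ] (Child Y X × P Y)) →
              ∀ {X} → 𝓛 X → P X → ∃[ x ] (x ∈ X × (∀ Y → 𝓛 Y → x ∈ Y → Y ⊆ X → P Y))
    descend P step {X} p pX = go (⊂-wellFounded X) p pX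
      where
      go : ∀ {X} → Acc _⊂_ X → 𝓛 X → P X → ∃[ x ] (x ∈ X × (∀ Y → 𝓛 Y → x ∈ Y → Y ⊆ X → P Y))
      go {X} (acc rec) p pX with Big? X
      ... | yes big = let Y , c@(q , _ , Y⊂X , _) , pY = step (p , big) pX
                          x , x∈Y , below = go (rec Y⊂X) q pY
        in x , proj₁ Y⊂X x∈Y , λ Z r x∈Z Z⊆X → case ⊆⇒≡⊎⊂ Z⊆X of λ where
          (inj₁ refl) → pX
          (inj₂ Z⊂X)  → below Z r x∈Z (child-⊇ c r Z⊂X x∈Y x∈Z)
      ... | no ¬big = let x , x∈X = inhabited p in
        x , x∈X , λ Y q x∈Y Y⊆X → subst P (⊆-antisym
          (subst (_⊆ Y) (sym (small ¬big x∈X)) λ y∈ → subst (_∈ Y) (sym (x∈⁅y⁆⇒x≡y x y∈)) x∈Y) Y⊆X) pX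

-- Coding the inner members of a laminar family by elements

module Coding {n} (𝓛 : Subset n → Set) where
  open Family 𝓛

  -- For x ∈ X ∈ 𝓛: X is the least member that contains x and some z ∈ Z.
  Marked : Fin n → Subset n → Subset n → Set
  Marked x Z X = ∃[ z ] (z ∈ Z × z ∈ X × (∀ Y → 𝓛 Y → x ∈ Y → z ∈ Y → X ⊆ Y))

  -- X has even depth: since the sets X ∖ Y, for the members Y ⊂ X containing
  -- x, are disjoint, every set of ancestors of x is coded by some Z.
  Even : Subset n → Set
  Even X = ∃[ x ] (x ∈ X × ∃[ Z ] (Marked x Z X
    × (∀ Y → 𝓛 Y → (∀ y → y ∈ Y) → Marked x Z Y)
    × (∀ Y Y′ → Child Y Y′ → x ∈ Y → Big Y → Marked x Z Y ⇔ (¬ Marked x Z Y′))))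

  Meets : Subset n → Subset n → Set
  Meets Z X = ∃[ z ] (z ∈ Z × z ∈ X)

  -- Truth of the alternating formula whose circuit is the tree below X, with
  -- conjunctions at even depth and disjunctions at odd depth, and with the
  -- leaves in C set to true; Z is a winning strategy of the verifier.
  Value : Subset n → Subset n → Set
  Value C X = ∃[ Z ] ((∀ z → z ∈ Z → z ∈ C × z ∈ X) × Meets Z X
    -- Only even nodes need a condition: an odd inner node that meets `Z` has a child that meets
    -- `Z`, as a disjunction requires.
    × (∀ Y → Inner Y → Y ⊆ X → Even Y → Meets Z Y →
       ∀ y → y ∈ Y → ∃[ Y′ ] (Child Y′ Y × y ∈ Y′ × Meets Z Y′)))

  Is : Bool → Set → Set
  Is true  A = A
  Is false A = ¬ A

  module _ (C₁ C₂ : Subset n) (b₁ b₂ : Bool) where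

    Label : Subset n → Set
    Label X = Is b₁ (Value C₁ X) × Is b₂ (Value C₂ X)

    -- Several elements may determine `X` by minimality; `x ∈ L` selects the one that is to
    -- represent it.
    Names : Subset n → Fin n → Subset n → Set
    Names L x X = x ∈ L × x ∈ X × Inner X × Label X × (∀ Y → Inner Y → Label Y → x ∈ Y → X ⊆ Y)

-- The state of a node is passed from the root to the leaves: the first child
-- and the other children of a node are in different states.
data State : Set where
  α β γ : State

first rest : State → State
first α = α
first β = β
first γ = α
rest α = γ
rest β = γ
rest γ = β

-- The value of the j-th alternating formula at a node of the given depth
-- parity and state.
value-at : (j even : Bool) → State → Bool
value-at j even α = j
value-at j even β = not j
value-at j even γ = not even

-- Existence of suitable colours and names

module Colours {n} {𝓛 : Subset n → Set} (isLaminar : IsLaminar 𝓛) (singleton : ∀ x → 𝓛 ⁅ x ⁆) where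
  open IsLaminar isLaminar
  open Laminar isLaminar
  open Singletons singleton
  open Family 𝓛
  open Coding 𝓛

  -- The element of `Y` that `nonempty?` computes singles out one child of `Y`.
  First : Subset n → Subset n → Set
  First X Y with nonempty? Y
  ... | yes (y , _) = y ∈ X
  ... | no _        = Data.Empty.⊥

  First? : ∀ X Y → Dec (First X Y)
  First? X Y with nonempty? Y
  ... | yes (y , _) = y ∈? X
  ... | no _        = no id

  firstChild : ∀ {X} → Inner X → ∃[ Y ] (Child Y X × First Y X)
  firstChild {X} p with nonempty? X
  ... | yes (x , x∈X) = childAt p x∈X
  ... | no ¬ne = contradiction (inhabited (proj₁ p)) ¬ne

  first-unique : ∀ {X Y Y′} → Child Y X → Child Y′ X → First Y X → First Y′ X → Y ≡ Y′
  first-unique {X} c c′ f f′ with nonempty? X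
  ... | yes _ = child-unique c c′ f f′

  -- The well-founded recursion that assigns parity and state does not unfold along children; a
  -- relation with `run-unique` yields the equations `even-child`, `state-first` and `state-rest`
  -- instead.
  data Run : Subset n → Bool → State → Set where
    root    : Run ⊤ true α
    toFirst : ∀ {X Y b s} → Child X Y → First X Y → Run Y b s → Run X (not b) (first s)
    toRest  : ∀ {X Y b s} → Child X Y → ¬ First X Y → Run Y b s → Run X (not b) (rest s)

  run : ∀ {X} → 𝓛 X → ∃[ b ] ∃[ s ] Run X b s
  run = fromRoot (λ X → ∃[ b ] ∃[ s ] Run X b s) (true , α , root) λ {X} {Y} c (b , s , r) →
    case First? X Y of λ where
      (yes f) → not b , first s , toFirst c f r
      (no ¬f) → not b , rest s , toRest c ¬f r

  ⊤-orphan : ∀ {X} → ¬ Child ⊤ X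
  ⊤-orphan (_ , _ , (_ , _ , _ , x∉⊤) , _) = x∉⊤ ∈⊤

  run-unique : ∀ {X b b′ s s′} → Run X b s → Run X b′ s′ → b ≡ b′ × s ≡ s′
  run-unique root root = refl , refl
  run-unique root (toFirst c _ _) = contradiction c ⊤-orphan
  run-unique root (toRest c _ _) = contradiction c ⊤-orphan
  run-unique (toFirst c _ _) root = contradiction c ⊤-orphan
  run-unique (toRest c _ _) root = contradiction c ⊤-orphan
  run-unique (toFirst c f r) (toFirst c′ f′ r′) with refl ← parent-unique c c′
    with refl , refl ← run-unique r r′ = refl , refl
  run-unique (toRest c f r) (toRest c′ f′ r′) with refl ← parent-unique c c′
    with refl , refl ← run-unique r r′ = refl , refl
  run-unique (toFirst c f r) (toRest c′ ¬f r′) with refl ← parent-unique c c′ = contradiction f ¬f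
  run-unique (toRest c ¬f r) (toFirst c′ f r′) with refl ← parent-unique c c′ = contradiction f ¬f

  even : Subset n → Bool
  even X with 𝓛? X
  ... | yes p = proj₁ (run p)
  ... | no _  = true

  state : Subset n → State
  state X with 𝓛? X
  ... | yes p = proj₁ (proj₂ (run p))
  ... | no _  = α

  runs : ∀ {X} → 𝓛 X → Run X (even X) (state X)
  runs {X} p with 𝓛? X
  ... | yes p = proj₂ (proj₂ (run p))
  ... | no ¬p = contradiction p ¬p

  even-⊤ : even ⊤ ≡ true
  even-⊤ = proj₁ (run-unique (runs top) root)

  even-child : ∀ {X Y} → Child X Y → even X ≡ not (even Y)
  even-child {X} {Y} c@(p , q , _) with First? X Y
  ... | yes f = proj₁ (run-unique (runs p) (toFirst c f (runs q)))
  ... | no ¬f = proj₁ (run-unique (runs p) (toRest c ¬f (runs q)))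

  state-first : ∀ {X Y} → Child X Y → First X Y → state X ≡ first (state Y)
  state-first c@(p , q , _) f = proj₂ (run-unique (runs p) (toFirst c f (runs q)))

  state-rest : ∀ {X Y} → Child X Y → ¬ First X Y → state X ≡ rest (state Y)
  state-rest c@(p , q , _) ¬f = proj₂ (run-unique (runs p) (toRest c ¬f (runs q)))

  val : Bool → Subset n → Bool
  val j X = value-at j (even X) (state X)

  val-first : ∀ {X Y} j → Child X Y → First X Y → val j X ≡ value-at j (not (even Y)) (first (state Y))
  val-first j c f = cong₂ (value-at j) (even-child c) (state-first c f)

  val-rest : ∀ {X Y} j → Child X Y → ¬ First X Y → val j X ≡ value-at j (not (even Y)) (rest (state Y))
  val-rest j c ¬f = cong₂ (value-at j) (even-child c) (state-rest c ¬f)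

  -- The value of a node is absorbing if it is true at odd depth or false at
  -- even depth: it is then the value of some child, and otherwise that of all.
  some-child : ∀ j X → Inner X → val j X ≡ not (even X) → ∃[ Y ] (Child Y X × val j Y ≡ not (even X))
  some-child j X p eq
    with Y , c , f ← firstChild p
    with Y′ , c′ , Y′≢Y ← anotherChild c
    with vf ← val-first j c f
    with vr ← val-rest j c′ (λ f′ → Y′≢Y (first-unique c′ c f′ f))
    with state X | even X | j
  ... | α | _     | _     = Y , c , trans vf eq
  ... | β | _     | _     = Y , c , trans vf eq
  -- Below a `γ` node the first child has value `j` and the others `not j`, so the absorbing value
  -- is found on one of the two.
  ... | γ | true  | true  = Y′ , c′ , vr
  ... | γ | true  | false = Y , c , vf
  ... | γ | false | true  = Y , c , vf
  ... | γ | false | false = Y′ , c′ , vr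

  all-children : ∀ j X {Y} → Child Y X → val j X ≡ even X → val j Y ≡ even X
  all-children j X {Y} c eq with First? Y X
  ... | yes f with vf ← val-first j c f with state X | even X
  ...   | α | _     = trans vf eq
  ...   | β | _     = trans vf eq
  ...   | γ | true  = contradiction eq λ ()
  ...   | γ | false = contradiction eq λ ()
  all-children j X {Y} c eq | no ¬f with vr ← val-rest j c ¬f with state X | even X
  -- The other children of an `α` or `β` node are in state `γ`, whose value, computed at the
  -- opposite parity, is `even X`.
  ... | α | true  = vr
  ... | α | false = vr
  ... | β | true  = vr
  ... | β | false = vr
  ... | γ | true  = contradiction eq λ ()
  ... | γ | false = contradiction eq λ ()

  label : Subset n → Bool × Bool
  label X = val true X , val false X

  -- The first child and any other child have different labels, so at most one of them has label
  -- `a`.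
  child-avoiding : ∀ a {X} → Inner X → ∃[ Y ] (Child Y X × label Y ≢ a)
  child-avoiding (a₁ , a₂) {X} p
    with Y , c , f ← firstChild p
    with Y′ , c′ , Y′≢Y ← anotherChild c
    with ¬f′ ← (λ f′ → Y′≢Y (first-unique c′ c f′ f))
    with ≡-dec _≟ᵇ_ _≟ᵇ_ (label Y) (a₁ , a₂)
  ... | no ≢a = Y , c , ≢a
  ... | yes ≡a = Y′ , c′ , λ ≡a′ → distinct {state X} {not (even X)}
    (trans (sym (cong₂ _,_ (val-first true c f) (val-first false c f)))
      (trans ≡a (trans (sym ≡a′) (cong₂ _,_ (val-rest true c′ ¬f′) (val-rest false c′ ¬f′)))))
    where
    -- The bits are unequal in the states `α` and `β` and equal in `γ`, and `α` and `β` are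
    -- opposite.
    distinct : ∀ {s b} → (value-at true b (first s) , value-at false b (first s)) ≢
               (value-at true b (rest s) , value-at false b (rest s))
    distinct {α} {true}  ()
    distinct {α} {false} ()
    distinct {β} {true}  ()
    distinct {β} {false} ()
    distinct {γ} {true}  ()
    distinct {γ} {false} ()

  colour-of : Bool → Subset n
  colour-of j = ⟪ (λ x → (val j ⁅ x ⁆) ≟ᵇ true) ⟫

  ∈colour-of : ∀ {j x} → x ∈ colour-of j ⇔ val j ⁅ x ⁆ ≡ true
  ∈colour-of {j} = ∈⟪⟫ (λ x → (val j ⁅ x ⁆) ≟ᵇ true)

  big-⊇ : ∀ {X Y : Subset n} → X ⊆ Y → Big X → Big Y
  big-⊇ X⊆Y (x , y , x∈ , y∈ , x≢y) = x , y , X⊆Y x∈ , X⊆Y y∈ , x≢y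

  true⇔¬not : ∀ {b} → b ≡ true ⇔ (¬ (not b ≡ true))
  true⇔¬not {true}  = mk⇔ (λ _ ()) (λ _ → refl)
  true⇔¬not {false} = mk⇔ (λ ()) (λ ¬p → contradiction refl ¬p)

  ¬true⇔not : ∀ {b} → (¬ (b ≡ true)) ⇔ not b ≡ true
  ¬true⇔not {true}  = mk⇔ (λ ¬p → contradiction refl ¬p) (λ ())
  ¬true⇔not {false} = mk⇔ (λ _ → refl) (λ _ ())

  -- `sound`: the marks on the branch of `x` are prescribed at the top and alternate below it, so
  -- they are forced to be the even depths. `adequate`: for one chosen `x`, `Z` collects the
  -- elements whose least common member with `x` is even.
  Even⇔even : ∀ {X} → Inner X → Even X ⇔ even X ≡ true
  Even⇔even {X} (p , big) = mk⇔ sound adequate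
    where
    sound : Even X → even X ≡ true
    sound (x , x∈X , Z , marked , atTop , alternate) = to (agree p x∈X big) marked
      where
      agree : ∀ {Y} → 𝓛 Y → x ∈ Y → Big Y → Marked x Z Y ⇔ even Y ≡ true
      agree = fromRoot (λ Y → x ∈ Y → Big Y → Marked x Z Y ⇔ even Y ≡ true)
        (λ _ _ → mk⇔ (λ _ → even-⊤) (λ _ → atTop ⊤ top (λ _ → ∈⊤)))
        (λ {Y} {Y′} c@(_ , _ , (Y⊆Y′ , _) , _) ih x∈Y bigY → ⇔.trans (alternate Y Y′ c x∈Y bigY)
          (⇔.trans (let e = ih (Y⊆Y′ x∈Y) (big-⊇ Y⊆Y′ bigY) in mk⇔ (_∘ from e) (_∘ to e))
            (subst (λ b → (¬ (even Y′ ≡ true)) ⇔ b ≡ true) (sym (even-child c))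
              (¬true⇔not {even Y′}))))

    adequate : even X ≡ true → Even X
    adequate ev with x , x∈X ← inhabited p =
      x , x∈X , Z , from (agree (p , big) x∈X) ev ,
      (λ Y q all → case ⊆-antisym {i = Y} {⊤} (λ _ → ∈⊤) (λ {y} _ → all y) of λ where
        refl → from (agree (top , big-⊇ (λ _ → ∈⊤) big) ∈⊤) even-⊤) ,
      (λ Y Y′ c@(q , q′ , (Y⊆Y′ , _) , _) x∈Y bigY → ⇔.trans (agree (q , bigY) x∈Y)
        (subst (λ b → b ≡ true ⇔ (¬ Marked x Z Y′)) (sym (even-child c))
          (let e = agree (q′ , big-⊇ Y⊆Y′ bigY) (Y⊆Y′ x∈Y) in mk⇔
            (λ ne m → to (true⇔¬not {even Y′}) (to e m) ne)
            (λ ¬m → to (¬true⇔not {even Y′}) (λ e′ → ¬m (from e e′))))))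
      where
      Meet : Fin n → Subset n → Set
      Meet z Y = even Y ≡ true × 𝓛 Y × x ∈ Y × z ∈ Y × (∀ W → 𝓛 W → x ∈ W → z ∈ W → Y ⊆ W)

      Meet? : ∀ z → Dec (∃ (Meet z))
      Meet? z = anySubset? λ Y → (even Y ≟ᵇ true) ×-dec 𝓛? Y ×-dec (x ∈? Y) ×-dec (z ∈? Y) ×-dec
        allSubset? (λ W → 𝓛? W Dec.→-dec (x ∈? W) Dec.→-dec (z ∈? W) Dec.→-dec (Y ⊆? W))

      Z : Subset n
      Z = ⟪ Meet? ⟫

      agree : ∀ {Y} → Inner Y → x ∈ Y → Marked x Z Y ⇔ even Y ≡ true
      agree {Y} (q , bigY) x∈Y = mk⇔
        (λ (z , z∈Z , z∈Y , least) → let Y′ , ev , q′ , x∈Y′ , z∈Y′ , least′ = to (∈⟪⟫ Meet?) z∈Z in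
          subst (λ Y → even Y ≡ true) (⊆-antisym (least′ Y q x∈Y z∈Y) (least Y′ q′ x∈Y′ z∈Y′)) ev)
        -- `W` is the child of `Y` on the branch of `x`; an element of `Y` outside `W` has `Y` as
        -- its least common member with `x`.
        (λ ev → let W , c@(_ , _ , (W⊆Y , z , z∈Y , z∉W) , _) , x∈W = childAt (q , bigY) x∈Y
                    least : ∀ U → 𝓛 U → x ∈ U → z ∈ U → Y ⊆ U
                    least U r x∈U z∈U = case comparable q r x∈Y x∈U of λ where
                      (inj₁ Y⊆U) → Y⊆U
                      (inj₂ U⊆Y) → case ⊆⇒≡⊎⊂ U⊆Y of λ where
                        (inj₁ refl) → id
                        (inj₂ U⊂Y)  → contradiction (child-⊇ c r U⊂Y x∈W x∈U z∈U) z∉W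
                in z , from (∈⟪⟫ Meet?) (Y , ev , q , x∈Y , z∈Y , least) , z∈Y , least)

  Value⇔val : ∀ j {X} → 𝓛 X → Value (colour-of j) X ⇔ val j X ≡ true
  Value⇔val j p = mk⇔ (sound p (⊂-wellFounded _)) (adequate p)
    where
    sound : ∀ {X} → 𝓛 X → Acc _⊂_ X → Value (colour-of j) X → val j X ≡ true
    sound {X} p (acc rec) (Z , Z⊆ , (z , z∈Z , z∈X) , strategy) with Big? X
    ... | no ¬big = subst (λ X → val j X ≡ true) (sym (small ¬big z∈X)) (to ∈colour-of (proj₁ (Z⊆ z z∈Z)))
    ... | yes big = Dec.decidable-stable ((val j X) ≟ᵇ true) λ ≢true → by-parity (≢true , refl)
      where
      below : ∀ {Y} → Child Y X → Meets Z Y → val j Y ≡ true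
      below {Y} (q , _ , Y⊂X , _) (y , y∈Z , y∈Y) = sound q (rec Y⊂X)
        (Z ∩ Y ,
         (λ z z∈ → let z∈Z , z∈Y = x∈p∩q⁻ Z Y z∈ in proj₁ (Z⊆ z z∈Z) , z∈Y) ,
         (y , x∈p∩q⁺ (y∈Z , y∈Y) , y∈Y) ,
         λ W inner W⊆Y ev (w , w∈ , w∈W) u u∈W →
           let W′ , c@(_ , _ , (W′⊆W , _) , _) , u∈W′ , w′ , w′∈Z , w′∈W′ =
                 strategy W inner (λ v∈ → proj₁ Y⊂X (W⊆Y v∈)) ev (w , proj₁ (x∈p∩q⁻ Z Y w∈) , w∈W) u u∈W
           in W′ , c , u∈W′ , w′ , x∈p∩q⁺ (w′∈Z , W⊆Y (W′⊆W w′∈W′)) , w′∈W′)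
      -- If `X` is false, then at even depth some child is false although all children meet the
      -- strategy; at odd depth all children are false, including the one that contains `z`. Both
      -- contradict `below`.
      by-parity : ∀ {b} → ¬ (val j X ≡ true) × even X ≡ b → Data.Empty.⊥
      by-parity {true} (≢true , ev) =
        let Y , c@(q , _) , eq = some-child j X (p , big) (trans (¬-not ≢true) (cong not (sym ev)))
            y , y∈Y = inhabited q
            Y′ , c′ , y∈Y′ , meets = strategy X (p , big) id (from (Even⇔even (p , big)) ev) (z , z∈Z , z∈X)
                                      y (proj₁ (proj₁ (proj₂ (proj₂ c))) y∈Y)
        in contradiction (trans (sym (below c (subst (Meets Z) (child-unique c′ c y∈Y′ y∈Y) meets)))
                                (trans eq (cong not ev))) λ ()
      by-parity {false} (≢true , ev) =
        let Y , c , z∈Y = childAt (p , big) z∈X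
        in contradiction (trans (sym (below c (z , z∈Z , z∈Y)))
                                (trans (all-children j X c (trans (¬-not ≢true) (sym ev))) ev)) λ ()

    step : ∀ {X} → Inner X → val j X ≡ true → ∃[ Y ] (Child Y X × val j Y ≡ true)
    step {X} inner eq = by-parity refl
      where
      by-parity : ∀ {b} → even X ≡ b → ∃[ Y ] (Child Y X × val j Y ≡ true)
      by-parity {true} ev = let Y , c , _ = firstChild inner in
        Y , c , trans (all-children j X c (trans eq (sym ev))) ev
      by-parity {false} ev = let Y , c , eq′ = some-child j X inner (trans eq (cong not (sym ev))) in
        Y , c , trans eq′ (cong not ev)

    adequate : ∀ {X} → 𝓛 X → val j X ≡ true → Value (colour-of j) X
    -- The strategy consists of the elements whose members up to `X` are all true; in particular
    -- their singletons are, so they have the colour.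
    adequate {X} p eq = ⟪ All? ⟫ ,
      (λ z z∈ → let z∈X , all = to (∈⟪⟫ All?) z∈ in
        from ∈colour-of (all ⁅ z ⁆ (singleton z) (x∈⁅x⁆ z) (λ y∈ → subst (_∈ X) (sym (x∈⁅y⁆⇒x≡y z y∈)) z∈X)) , z∈X) ,
      (let x , x∈X , all = descend (λ Y → val j Y ≡ true) step p eq
       in x , from (∈⟪⟫ All?) (x∈X , all) , x∈X) ,
      λ Y inner Y⊆X ev (z , z∈ , z∈Y) y y∈Y →
        let z∈X , above = to (∈⟪⟫ All?) z∈
            ev′ = to (Even⇔even inner) ev
            Y′ , c@(q , _ , Y′⊂Y , _) , y∈Y′ = childAt inner y∈Y
            eq′ = trans (all-children j Y c (trans (above Y (proj₁ inner) z∈Y Y⊆X) (sym ev′))) ev′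
            x , x∈Y′ , below = descend (λ Y → val j Y ≡ true) step q eq′
            x∈Y = proj₁ Y′⊂Y x∈Y′
        -- A member containing `x` lies inside `Y′`, where `below` applies, or contains `Y` and
        -- hence `z`, where `above` applies.
        in Y′ , c , y∈Y′ , x , from (∈⟪⟫ All?) (Y⊆X x∈Y , λ W r x∈W W⊆X →
             case comparable r q x∈W x∈Y′ of λ where
               (inj₁ W⊆Y′) → below W r x∈W W⊆Y′
               (inj₂ Y′⊆W) → case ⊆⇒≡⊎⊂ Y′⊆W of λ where
                 (inj₁ refl) → eq′
                 (inj₂ Y′⊂W) → above W r (parent-⊆ c r Y′⊂W z∈Y) W⊆X) , x∈Y′
      where
      All? : ∀ x → Dec (x ∈ X × (∀ Y → 𝓛 Y → x ∈ Y → Y ⊆ X → val j Y ≡ true))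
      All? x = (x ∈? X) ×-dec allSubset? λ Y →
        𝓛? Y Dec.→-dec (x ∈? Y) Dec.→-dec (Y ⊆? X) Dec.→-dec ((val j Y) ≟ᵇ true)

  Is⇔ : ∀ {b b′ A} → A ⇔ b ≡ true → Is b′ A ⇔ b ≡ b′
  Is⇔ {true}  {true}  e = e
  Is⇔ {true}  {false} e = mk⇔ (λ ¬a → contradiction (from e refl) ¬a) (λ ())
  Is⇔ {false} {true}  e = e
  Is⇔ {false} {false} e = mk⇔ (λ _ → refl) (λ _ a → case to e a of λ ())

  Label⇔label : ∀ {b₁ b₂ X} → 𝓛 X → Label (colour-of true) (colour-of false) b₁ b₂ X ⇔ label X ≡ (b₁ , b₂)
  Label⇔label p = ⇔.trans (Is⇔ (Value⇔val true p) ×-⇔ Is⇔ (Value⇔val false p))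
    (mk⇔ (λ (p , q) → cong₂ _,_ p q) λ { refl → refl , refl })

  avoiding : ∀ a {X} → Inner X → ∃[ x ] (x ∈ X × (∀ Y → 𝓛 Y → x ∈ Y → Y ⊂ X → label Y ≢ a))
  avoiding a inner =
    let Y , c@(p , _ , Y⊂X , _) , ≢a = child-avoiding a inner
        x , x∈Y , below = descend (λ Y → label Y ≢ a) (λ inner _ → child-avoiding a inner) p ≢a
    in x , proj₁ Y⊂X x∈Y , λ Z r x∈Z Z⊂X → below Z r x∈Z (child-⊇ c r Z⊂X x∈Y x∈Z)

  Name : Subset n → Fin n → Set
  Name X x with Inner? X
  ... | yes inner = proj₁ (avoiding (label X) inner) ≡ x
  ... | no _      = Data.Empty.⊥

  Name? : ∀ X x → Dec (Name X x)
  Name? X x with Inner? X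
  ... | yes inner = proj₁ (avoiding (label X) inner) ≟ᶠ x
  ... | no _      = no id

  hasName : ∀ {X} → Inner X → ∃ (Name X)
  hasName {X} inner with Inner? X
  ... | yes inner = _ , refl
  ... | no ¬inner = contradiction inner ¬inner

  name-unique : ∀ {X x y} → Name X x → Name X y → x ≡ y
  name-unique {X} p q with Inner? X
  ... | yes inner = trans (sym p) q

  name-avoids : ∀ {X x} → Name X x → Inner X × x ∈ X × (∀ Y → 𝓛 Y → x ∈ Y → Y ⊂ X → label Y ≢ label X)
  name-avoids {X} p with Inner? X
  ... | yes inner = inner , subst (λ x → x ∈ X × (∀ Y → 𝓛 Y → x ∈ Y → Y ⊂ X → label Y ≢ label X)) p
                              (proj₂ (avoiding (label X) inner))

  Named? : ∀ a x → Dec (∃[ X ] (label X ≡ a × Name X x))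
  Named? a x = anySubset? λ X →
    (≡-dec _≟ᵇ_ _≟ᵇ_ (label X) a) ×-dec Name? X x

  named : Bool → Bool → Subset n
  named b₁ b₂ = ⟪ Named? (b₁ , b₂) ⟫

  -- `Y` contains `x` and is thus comparable with `X`; below `X` the name avoids the label.
  named-least : ∀ {X x} → Name X x → ∀ {Y} → Inner Y → label Y ≡ label X → x ∈ Y → X ⊆ Y
  named-least name (q , _) eq x∈Y with (p , _) , x∈X , avoids ← name-avoids name
    with comparable p q x∈X x∈Y
  ... | inj₁ X⊆Y = X⊆Y
  ... | inj₂ Y⊆X with ⊆⇒≡⊎⊂ Y⊆X
  ...   | inj₁ refl = id
  ...   | inj₂ Y⊂X  = contradiction eq (avoids _ q x∈Y Y⊂X)

  represented : ∃[ C₁ ] ∃[ C₂ ] Σ[ L ∈ (Bool → Bool → Subset n) ] ∀ b₁ b₂ X → Inner X → Label C₁ C₂ b₁ b₂ X →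
    (∃[ x ] Names C₁ C₂ b₁ b₂ (L b₁ b₂) x X) ×
    (∀ x y → Names C₁ C₂ b₁ b₂ (L b₁ b₂) x X → Names C₁ C₂ b₁ b₂ (L b₁ b₂) y X → x ≡ y)
  represented = colour-of true , colour-of false , named , λ b₁ b₂ X inner lab →
    let eq = to (Label⇔label (proj₁ inner)) lab
        x , name = hasName inner
        names : ∀ {y} → Names _ _ b₁ b₂ (named b₁ b₂) y X → Name X y
        names (y∈L , y∈X , _ , _ , least) =
          -- `y` was put into the set as the chosen name of some `Y` with this label; `X` and `Y`
          -- are both least among such members containing `y`.
          let Y , eqY , nameY = to (∈⟪⟫ (Named? _)) y∈L
              innerY , y∈Y , _ = name-avoids nameY
          in subst (λ Z → Name Z _) (⊆-antisym
               (named-least nameY inner (trans eq (sym eqY)) y∈X)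
               (least Y innerY (from (Label⇔label (proj₁ innerY)) eqY) y∈Y)) nameY
    in (x , from (∈⟪⟫ (Named? _)) (X , eq , name) , proj₁ (proj₂ (name-avoids name)) , inner , lab ,
         λ Y innerY labY x∈Y → named-least name innerY (trans (to (Label⇔label (proj₁ innerY)) labY) (sym eq)) x∈Y) ,
       λ y z p q → name-unique (names p) (names q)

-- Definability of the coding

-- The first vertex set is a parameter of the family; for bipartitions it carries the guessed root.
record DefinableFamily : Set₁ where
  field
    member  : ∀ G → Vertices G → Vertices G → Set
    memberᵈ : ∀ {e s} (R X : Fin s) →
              Definable {e} {s} (λ G ρ σ → member G (lookup σ R) (lookup σ X))

bigᵈ : ∀ {e s} (X : Fin s) → Definable {e} {s} (λ G ρ σ → Big (lookup σ X))
bigᵈ X = ∃ᵈ (∃ᵈ ((1F ∊ᵈ X) ×ᵈ (0F ∊ᵈ X) ×ᵈ ¬ᵈ (1F ≐ᵈ 0F)))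


module FamilyDefinability (𝓕 : DefinableFamily) where
  open DefinableFamily 𝓕

  module _ {e s : ℕ} where
   abstract

      innerᵈ : (R X : Fin s) → Definable {e} (λ G ρ σ → Family.Inner (member G (lookup σ R)) (lookup σ X))
      innerᵈ R X = memberᵈ R X ×ᵈ bigᵈ X

      childᵈ : (R X Y : Fin s) →
               Definable {e} (λ G ρ σ → Family.Child (member G (lookup σ R)) (lookup σ X) (lookup σ Y))
      childᵈ R X Y = memberᵈ R X ×ᵈ memberᵈ R Y ×ᵈ (X ⊂ᵈ Y) ×ᵈ
        ∀ˢ (memberᵈ (suc R) 0F →ᵈ ¬ᵈ ((suc X ⊂ᵈ 0F) ×ᵈ (0F ⊂ᵈ suc Y)))

      markedᵈ : (R : Fin s) (x : Fin e) (Z X : Fin s) → Definable (λ G ρ σ →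
        Coding.Marked (member G (lookup σ R)) (lookup ρ x) (lookup σ Z) (lookup σ X))
      markedᵈ R x Z X = ∃ᵈ ((0F ∊ᵈ Z) ×ᵈ (0F ∊ᵈ X) ×ᵈ ∀ˢ (memberᵈ (suc R) 0F →ᵈ
        (suc x ∊ᵈ 0F) →ᵈ (0F ∊ᵈ 0F) →ᵈ (suc X ⊆ᵈ 0F)))

      meetsᵈ : (R Z X : Fin s) → Definable {e} (λ G ρ σ →
        Coding.Meets (member G (lookup σ R)) (lookup σ Z) (lookup σ X))
      meetsᵈ R Z X = ∃ᵈ ((0F ∊ᵈ Z) ×ᵈ (0F ∊ᵈ X))

  module _ {e s : ℕ} where
   abstract

      evenᵈ : (R X : Fin s) → Definable {e} (λ G ρ σ → Coding.Even (member G (lookup σ R)) (lookup σ X))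
      evenᵈ R X = ∃ᵈ ((0F ∊ᵈ X) ×ᵈ ∃ˢ (markedᵈ (suc R) 0F 0F (suc X)
        ×ᵈ ∀ˢ (memberᵈ (suc (suc R)) 0F →ᵈ ∀ᵈ (0F ∊ᵈ 0F) →ᵈ markedᵈ (suc (suc R)) 0F 1F 0F)
        ×ᵈ ∀ˢ (∀ˢ (childᵈ (suc (suc (suc R))) 1F 0F →ᵈ (0F ∊ᵈ 1F) →ᵈ bigᵈ 1F →ᵈ
             (markedᵈ (suc (suc (suc R))) 0F 2F 1F ⇔ᵈ ¬ᵈ markedᵈ (suc (suc (suc R))) 0F 2F 0F)))))

  module _ {e s : ℕ} where
   abstract

      valueᵈ : (R C X : Fin s) → Definable {e} (λ G ρ σ →
        Coding.Value (member G (lookup σ R)) (lookup σ C) (lookup σ X))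
      valueᵈ R C X = ∃ˢ (∀ᵈ ((0F ∊ᵈ 0F) →ᵈ (0F ∊ᵈ suc C) ×ᵈ (0F ∊ᵈ suc X)) ×ᵈ meetsᵈ (suc R) 0F (suc X)
        ×ᵈ ∀ˢ (innerᵈ (suc (suc R)) 0F →ᵈ (0F ⊆ᵈ suc (suc X)) →ᵈ evenᵈ (suc (suc R)) 0F →ᵈ
               meetsᵈ (suc (suc R)) 1F 0F →ᵈ ∀ᵈ ((0F ∊ᵈ 0F) →ᵈ
               ∃ˢ (childᵈ (suc (suc (suc R))) 0F 1F ×ᵈ (0F ∊ᵈ 0F) ×ᵈ meetsᵈ (suc (suc (suc R))) 2F 0F))))

  module _ {e s : ℕ} where
   abstract

      isᵈ : ∀ {P : Pred e s} (R : Fin s) b → Definable P →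
            Definable (λ G ρ σ → Coding.Is (member G (lookup σ R)) b (P G ρ σ))
      isᵈ R true  p = p
      isᵈ R false p = ¬ᵈ p

      labelᵈ : (R C₁ C₂ : Fin s) (b₁ b₂ : Bool) (X : Fin s) → Definable {e} (λ G ρ σ →
        Coding.Label (member G (lookup σ R)) (lookup σ C₁) (lookup σ C₂) b₁ b₂ (lookup σ X))
      labelᵈ R C₁ C₂ b₁ b₂ X = isᵈ R b₁ (valueᵈ R C₁ X) ×ᵈ isᵈ R b₂ (valueᵈ R C₂ X)

  module _ {e s : ℕ} where
   abstract

      namesᵈ : (R C₁ C₂ : Fin s) (b₁ b₂ : Bool) (L : Fin s) (x : Fin e) (X : Fin s) → Definable (λ G ρ σ →
        Coding.Names (member G (lookup σ R)) (lookup σ C₁) (lookup σ C₂) b₁ b₂ (lookup σ L) (lookup ρ x) (lookup σ X))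
      namesᵈ R C₁ C₂ b₁ b₂ L x X = (x ∊ᵈ L) ×ᵈ (x ∊ᵈ X) ×ᵈ innerᵈ R X ×ᵈ labelᵈ R C₁ C₂ b₁ b₂ X ×ᵈ
        ∀ˢ (innerᵈ (suc R) 0F →ᵈ labelᵈ (suc R) (suc C₁) (suc C₂) b₁ b₂ 0F →ᵈ (x ∊ᵈ 0F) →ᵈ (suc X ⊆ᵈ 0F))

-- Transducing a definable laminar family

-- The output consists of pairs of a role and a member of the family.
record Specification : Set₁ where
  field
    {Sym}       : Set
    syms        : List Sym
    comp        : ∀ Q → Q ∈ˡ syms
    arities     : Sym → ℕ
    roles       : ℕ
    family      : DefinableFamily
    admissible  : ∀ G → Vertices G → Set
    admissibleᵈ : ∀ {e s} (R : Fin s) → Definable {e} {s} (λ G ρ σ → admissible G (lookup σ R))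
    keeps       : Fin (suc roles) → ∀ G → Vertices G → Vertices G → Set
    keepsᵈ      : ∀ {e s} i (R X : Fin s) → Definable {e} {s} (λ G ρ σ → keeps i G (lookup σ R) (lookup σ X))
    relates     : ∀ Q → Vec (Fin (suc roles)) (arities Q) → ∀ G → Vertices G → Vec (Vertices G) (arities Q) → Set
    relatesᵈ    : ∀ {e s} Q is (R : Fin s) (Xs : Vec (Fin s) (arities Q)) →
                  Definable {e} {s} (λ G ρ σ → relates Q is G (lookup σ R) (Vec.map (lookup σ) Xs))

  vocabulary : Vocabulary
  vocabulary = record
    { Symbol = Sym ; symbols = syms ; complete = comp ; sort = λ _ → element ; arity = arities }

  open DefinableFamily family public

  -- The interface to the concrete decompositions: elements correspond bijectively to the kept pairs
  -- of a role and a member, and the vertices that encode them are forgotten.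
  record Realises (G : Graph) (𝔹 : Structure vocabulary) : Set where
    field
      root    : Vertices G
      root-ok : admissible G root
      role    : Universe 𝔹 → Fin (suc roles)
      set-of  : Universe 𝔹 → Vertices G
      unique  : ∀ {y z} → role y ≡ role z → set-of y ≡ set-of z → y ≡ z
      valid   : ∀ y → member G root (set-of y) × keeps (role y) G root (set-of y)
      covers  : ∀ {i X} → member G root X → keeps i G root X → ∃[ y ] role y ≡ i × set-of y ≡ X
      rels    : ∀ Q ys → T (rel 𝔹 Q ys) ⇔ relates Q (Vec.map role ys) G root (Vec.map set-of ys)

-- The ways to represent a member: as a singleton, or by a name for one of the four labels. Bi-joins
-- reuse these five codes as roles.
Kind : Set
Kind = Fin 5

bits : Kind → Data.Unit.⊤ ⊎ Bool × Bool
bits 0F = inj₁ _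
bits 1F = inj₂ (false , false)
bits 2F = inj₂ (false , true)
bits 3F = inj₂ (true , false)
bits 4F = inj₂ (true , true)

kind : Data.Unit.⊤ ⊎ Bool × Bool → Kind
kind (inj₁ _)               = 0F
kind (inj₂ (false , false)) = 1F
kind (inj₂ (false , true))  = 2F
kind (inj₂ (true , false))  = 3F
kind (inj₂ (true , true))   = 4F

kind-bits : ∀ κ → kind (bits κ) ≡ κ
kind-bits 0F = refl
kind-bits 1F = refl
kind-bits 2F = refl
kind-bits 3F = refl
kind-bits 4F = refl

bits-kind : ∀ b → bits (kind b) ≡ b
bits-kind (inj₁ _)               = refl
bits-kind (inj₂ (false , false)) = refl
bits-kind (inj₂ (false , true))  = refl
bits-kind (inj₂ (true , false))  = refl
bits-kind (inj₂ (true , true))   = refl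

module TreeTransduction (spec : Specification) where
  open Specification spec
  open FamilyDefinability family

  -- The root parameter, two colours of leaves, and one set of names for each of the four labels.
  p : ℕ
  p = 7

  slot : Bool → Bool → Fin p
  slot false false = 3F
  slot false true  = 4F
  slot true  false = 5F
  slot true  true  = 6F

  module _ (G : Graph) (c : Vec (Vertices G) p) where
    open Family (member G (lookup c 0F))
    open Coding (member G (lookup c 0F))

    Label′ : Bool → Bool → Vertices G → Set
    Label′ = Label (lookup c 1F) (lookup c 2F)

    Names′ : Bool → Bool → V G → Vertices G → Set
    Names′ b₁ b₂ = Names (lookup c 1F) (lookup c 2F) b₁ b₂ (lookup c (slot b₁ b₂))

    -- A member is represented by its element if it is a singleton, and by its
    -- name with respect to its label otherwise.
    RepresentsAs : Data.Unit.⊤ ⊎ Bool × Bool → V G → Vertices G → Set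
    RepresentsAs (inj₁ _)         x X = ∀ y → y ∈ X ⇔ y ≡ x
    RepresentsAs (inj₂ (b₁ , b₂)) x X = Names′ b₁ b₂ x X

    -- Together with the minimality in `Names`, this makes the representation of inner members total
    -- and injective for arbitrary colours, not only for those constructed in `Colours`.
    WellNamed : Set
    WellNamed = ∀ b₁ b₂ X → Inner X → Label′ b₁ b₂ X →
      (∃[ x ] Names′ b₁ b₂ x X) × (∀ x y → Names′ b₁ b₂ x X → Names′ b₁ b₂ y X → x ≡ y)

  abstract
    wellNamedᵈ : Definable {0} {p} (λ G ρ σ → WellNamed G σ)
    wellNamedᵈ = ∀ᵇ λ b₁ → ∀ᵇ λ b₂ → ∀ˢ (innerᵈ 1F 0F →ᵈ labelᵈ 1F 2F 3F b₁ b₂ 0F →ᵈ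
      ∃ᵈ (namesᵈ 1F 2F 3F b₁ b₂ (suc (slot b₁ b₂)) 0F 0F) ×ᵈ
      ∀ᵈ (∀ᵈ (namesᵈ 1F 2F 3F b₁ b₂ (suc (slot b₁ b₂)) 1F 0F →ᵈ
              namesᵈ 1F 2F 3F b₁ b₂ (suc (slot b₁ b₂)) 0F 0F →ᵈ (1F ≐ᵈ 0F))))

  abstract
    guessᵈ : Definable {0} {p} (λ G ρ σ → admissible G (lookup σ 0F) × WellNamed G σ)
    guessᵈ = admissibleᵈ 0F ×ᵈ wellNamedᵈ

  abstract
    representsAsᵈ : ∀ b → Definable {1} {suc p} (λ G ρ σ → RepresentsAs G (Vec.tail σ) b (Vec.head ρ) (Vec.head σ))
    representsAsᵈ (inj₁ _) = mapᵈ (∀ᵈ ((0F ∊ᵈ 0F) ⇔ᵈ (0F ≐ᵈ 1F))) λ { G (x ∷ []) (X ∷ c) → ⇔.refl }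
    representsAsᵈ (inj₂ (b₁ , b₂)) = mapᵈ (namesᵈ 1F 2F 3F b₁ b₂ (suc (slot b₁ b₂)) 0F 0F)
      λ { G (x ∷ []) (X ∷ c@(_ ∷ _ ∷ _ ∷ _)) → ⇔.refl }

  role-of : Fin (suc roles * 5) → Fin (suc roles)
  role-of i = proj₁ (remQuot {suc roles} 5 i)

  kind-of : Fin (suc roles * 5) → Kind
  kind-of i = proj₂ (remQuot {suc roles} 5 i)

  abstract
    representsᵈ : ∀ i → Definable {1} {suc p} (λ G ρ σ → (member G (lookup (Vec.tail σ) 0F) (Vec.head σ)
      × keeps (role-of i) G (lookup (Vec.tail σ) 0F) (Vec.head σ))
      × RepresentsAs G (Vec.tail σ) (bits (kind-of i)) (Vec.head ρ) (Vec.head σ))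
    representsᵈ i = mapᵈ (memberᵈ 1F 0F ×ᵈ keepsᵈ (role-of i) 1F 0F) (λ { G ρ (X ∷ R ∷ c) → ⇔.refl })
      ×ᵈ representsAsᵈ (bits (kind-of i))

  abstract
    relationᵈ : ∀ Q is → Definable {0} {arities Q + p} (λ G ρ σ →
      relates Q (Vec.map role-of is) G (lookup σ (arities Q ↑ʳ 0F)) (Vec.map (lookup σ) (tabulate (_↑ˡ p))))
    relationᵈ Q is = relatesᵈ Q (Vec.map role-of is) (arities Q ↑ʳ 0F) (tabulate (_↑ˡ p))

  -- `suc (4 + roles * 5)` computes to `suc roles * 5`: one copy for each pair of a role and a kind.
  open Guess syms comp arities p (4 + roles * 5) (formula guessᵈ)
    (λ i → formula (representsᵈ i)) (λ Q is → formula (relationᵈ Q is)) public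
    using (τ; Output; outputs; succeeds)

  module _ (G : Graph)
           (laminar : ∀ R → admissible G R → IsLaminar (member G R))
           (singletons : ∀ R → admissible G R → ∀ x → member G R ⁅ x ⁆) where

    realises : ∀ {𝔹} → ⟦ τ ⟧ ⌜ G ⌝ 𝔹 → Realises G 𝔹
    realises {𝔹} t with c , q , o ← outputs t with adm , wellNamed ← to (defines guessᵈ G [] c) q = record
      { root    = R
      ; root-ok = adm
      ; role    = role
      ; set-of  = set-of
      ; unique  = λ {y} {z} eq eq′ →
          let eq₁ , eq₂ = injective {set-of y} (proj₂ (is-rep y)) (subst (RepresentsAs G c _ _) (sym eq′) (proj₂ (is-rep z)))
          in unique (index-injective eq (trans (sym (kind-bits _)) (trans (cong kind eq₁) (kind-bits _)))) eq₂
      ; valid   = λ y → proj₁ (is-rep y)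
      ; covers  = covers′
      ; rels    = λ Q ys → ⇔.trans (rels Q ys) (mk⇔
          (λ (Xs , v , w) → subst₂ (λ is Xs → relates Q is G R Xs) (sym (map-∘ role-of index ys))
            (trans (sets Xs) (lookup-extensional λ j → trans (functional {lookup Xs j} {_}
              (proj₂ (to (defines (representsᵈ (index (lookup ys j))) G _ (lookup Xs j ∷ c)) (v j))) (proj₂ (is-rep (lookup ys j))))
              (sym (lookup-map j set-of ys))))
            (subst (λ R′ → relates Q (Vec.map role-of (Vec.map index ys)) G R′ (Vec.map (lookup (Xs ++ c)) (tabulate (_↑ˡ p)))) (lookup-++ʳ Xs c 0F) (to (defines (relationᵈ Q (Vec.map index ys)) G [] (Xs ++ c)) w)))
          (λ w → Vec.map set-of ys ,
            (λ j → subst (λ X → Represents (lookup ys j) X) (sym (lookup-map j set-of ys)) (proj₂ (valid (lookup ys j)))) ,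
            from (defines (relationᵈ Q (Vec.map index ys)) G [] (Vec.map set-of ys ++ c))
              (subst (λ R′ → relates Q (Vec.map role-of (Vec.map index ys)) G R′ (Vec.map (lookup (Vec.map set-of ys ++ c)) (tabulate (_↑ˡ p)))) (sym (lookup-++ʳ (Vec.map set-of ys) c 0F))
                (subst₂ (λ is Xs → relates Q is G R Xs) (map-∘ role-of index ys) (sym (sets (Vec.map set-of ys))) w))))
      }
      where
      open Output o
      R : Vertices G
      R = lookup c 0F
      isLaminar : IsLaminar (member G R)
      isLaminar = laminar R adm
      open Family (member G R)
      open Coding (member G R)
      open Laminar isLaminar

      role : Universe 𝔹 → Fin (suc roles)
      role y = role-of (index y)

      set-of : Universe 𝔹 → Vertices G
      set-of y = proj₁ (valid y)

      is-rep : ∀ y → (member G R (set-of y) × keeps (role y) G R (set-of y))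
               × RepresentsAs G c (bits (kind-of (index y))) (vertex y) (set-of y)
      is-rep y = to (defines (representsᵈ (index y)) G (vertex y ∷ []) (set-of y ∷ c)) (proj₂ (valid y))

      sets : ∀ {a} (Xs : Vec (Vertices G) a) → Vec.map (lookup (Xs ++ c)) (tabulate (_↑ˡ p)) ≡ Xs
      sets Xs = lookup-extensional λ j → trans (lookup-map j (lookup (Xs ++ c)) (tabulate (_↑ˡ p)))
        (trans (cong (lookup (Xs ++ c)) (lookup∘tabulate (_↑ˡ p) j)) (lookup-++ˡ Xs c j))

      index-injective : ∀ {i j} → role-of i ≡ role-of j → kind-of i ≡ kind-of j → i ≡ j
      index-injective {i} {j} eq eq′ = trans (sym (combine-remQuot {suc roles} 5 i))
        (trans (cong₂ combine eq eq′) (combine-remQuot {suc roles} 5 j))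

      functional : ∀ {X Y b x} → RepresentsAs G c b x X → RepresentsAs G c b x Y → X ≡ Y
      functional {b = inj₁ _} f g = ⊆-antisym (λ {y} y∈ → from (g y) (to (f y) y∈)) (λ {y} y∈ → from (f y) (to (g y) y∈))
      functional {b = inj₂ _} (_ , x∈X , innerX , labX , leastX) (_ , x∈Y , innerY , labY , leastY) =
        ⊆-antisym (leastX _ innerY labY x∈Y) (leastY _ innerX labX x∈X)

      leaf-small : ∀ {X x} → (∀ y → y ∈ X ⇔ y ≡ x) → ¬ Big X
      leaf-small f (y , z , y∈ , z∈ , y≢z) = y≢z (trans (to (f y) y∈) (sym (to (f z) z∈)))

      Is-unique : ∀ {b b′ A} → Is b A → Is b′ A → b ≡ b′
      Is-unique {true}  {true}  _ _ = refl
      Is-unique {true}  {false} p q = contradiction p q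
      Is-unique {false} {true}  p q = contradiction q p
      Is-unique {false} {false} _ _ = refl

      injective : ∀ {X b b′ x y} → RepresentsAs G c b x X → RepresentsAs G c b′ y X → b ≡ b′ × x ≡ y
      injective {b = inj₁ _} {inj₁ _} f g = refl , to (g _) (from (f _) refl)
      injective {b = inj₁ _} {inj₂ _} f (_ , _ , (_ , big) , _) = contradiction big (leaf-small f)
      injective {b = inj₂ _} {inj₁ _} (_ , _ , (_ , big) , _) f = contradiction big (leaf-small f)
      injective {b = inj₂ (b₁ , b₂)} {inj₂ (b₁′ , b₂′)} f@(_ , _ , inner , lab , _) g@(_ , _ , _ , lab′ , _)
        with Is-unique {b₁} {b₁′} (proj₁ lab) (proj₁ lab′) | Is-unique {b₂} {b₂′} (proj₂ lab) (proj₂ lab′)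
      ... | refl | refl = refl , proj₂ (wellNamed _ _ _ inner lab) _ _ f g

      -- A member that is not a singleton gets its label by deciding both values, and `wellNamed`
      -- provides the name for that label.
      represented : ∀ {X} → member G R X → ∃[ b ] ∃[ x ] RepresentsAs G c b x X
      represented {X} m with Big? X
      ... | no ¬big with x , x∈X ← IsLaminar.inhabited isLaminar m = inj₁ _ , x , λ y → mk⇔
        (λ y∈X → x∈⁅y⁆⇒x≡y x (subst (y ∈_) (small ¬big x∈X) y∈X)) (λ { refl → x∈X })
      ... | yes big with decided (lookup c 1F) | decided (lookup c 2F)
        where
        decided : ∀ C → ∃[ b ] Is b (Value C X)
        decided C with decide (valueᵈ 0F 1F 2F) G [] (R ∷ C ∷ X ∷ [])
        ... | yes v = true , v
        ... | no ¬v = false , ¬v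
      ... | b₁ , v₁ | b₂ , v₂ = inj₂ (b₁ , b₂) , proj₁ (wellNamed b₁ b₂ X (m , big) (v₁ , v₂))

      covers′ : ∀ {i X} → member G R X → keeps i G R X → ∃[ y ] role y ≡ i × set-of y ≡ X
      covers′ {i} {X} m k =
        let b , x , r = represented m
            j = combine i (kind b)
            eqʳ : role-of j ≡ i
            eqʳ = cong proj₁ (remQuot-combine i (kind b))
            eqᵏ : bits (kind-of j) ≡ b
            eqᵏ = trans (cong (bits ∘ proj₂) (remQuot-combine i (kind b))) (bits-kind b)
            y , eq₁ , eq₂ = covers {j} {x} {X} (from (defines (representsᵈ j) G (x ∷ []) (X ∷ c))
              ((m , subst (λ i → keeps i G R X) (sym eqʳ) k) , subst (λ b → RepresentsAs G c b x X) (sym eqᵏ) r))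
        in y , trans (cong role-of eq₁) eqʳ ,
           functional {b = b} {x} (subst₂ (λ b x → RepresentsAs G c b x (set-of y)) (trans (cong (bits ∘ kind-of) eq₁) eqᵏ) eq₂ (proj₂ (is-rep y))) r

    nonempty-output : ∃ (admissible G) → ∃ (⟦ τ ⟧ ⌜ G ⌝)
    nonempty-output (R , adm) =
      let C₁ , C₂ , L , named = Colours.represented (laminar R adm) (singletons R adm)
          c = R ∷ C₁ ∷ C₂ ∷ L false false ∷ L false true ∷ L true false ∷ L true true ∷ []
      in succeeds G c (from (defines guessᵈ G [] c) (adm , λ where
           false false → named false false
           false true  → named false true
           true  false → named true false
           true  true  → named true true))

    outputs-good : ∀ {Good} → ∃ (admissible G) → (∀ 𝔹 → Realises G 𝔹 → Good 𝔹) → Outputs τ ⌜ G ⌝ Good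
    outputs-good adm good = nonempty-output adm , λ 𝔹 t → good 𝔹 (realises t)

-- Modular decompositions and cotrees

module _ {e s : ℕ} where

  nonemptyᵈ : (X : Fin s) → Definable {e} (λ G ρ σ → Nonempty (lookup σ X))
  nonemptyᵈ X = ∃ᵈ (0F ∊ᵈ X)

  isModuleᵈ : (M : Fin s) → Definable {e} (λ G ρ σ → IsModule G (lookup σ M))
  isModuleᵈ M = nonemptyᵈ M ×ᵈ mapᵈ (∀ᵈ (∀ᵈ (∀ᵈ (¬ᵈ (2F ∊ᵈ M) →ᵈ (1F ∊ᵈ M) →ᵈ (0F ∊ᵈ M) →ᵈ
    (edgeᵈ 2F 1F ⇔ᵈ edgeᵈ 2F 0F) ×ᵈ (edgeᵈ 1F 2F ⇔ᵈ edgeᵈ 0F 2F)))))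
    λ _ _ _ → mk⇔ (λ f {v} {u} {u′} → f v u u′) (λ f v u u′ → f {v} {u} {u′})

  crossᵈ : (M N : Fin s) → Definable {e} (λ G ρ σ → Cross G (lookup σ M) (lookup σ N))
  crossᵈ M N = mapᵈ (∃ᵈ ((0F ∊ᵈ M) ×ᵈ (0F ∊ᵈ N)))
    (λ _ _ σ → mk⇔ (λ (x , p) → x , x∈p∩q⁺ p) (λ (x , p) → x , x∈p∩q⁻ (lookup σ M) _ p))
    ×ᵈ ¬ᵈ (M ⊆ᵈ N) ×ᵈ ¬ᵈ (N ⊆ᵈ M)

module _ {e s : ℕ} where

  isStrongModuleᵈ : (M : Fin s) → Definable {e} (λ G ρ σ → IsStrongModule G (lookup σ M))
  isStrongModuleᵈ M = isModuleᵈ M ×ᵈ ∀ˢ (isModuleᵈ 0F →ᵈ ¬ᵈ crossᵈ (suc M) 0F)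

⁅⁆⊆ : ∀ {n} {x : Fin n} {X : Subset n} → x ∈ X → ⁅ x ⁆ ⊆ X
⁅⁆⊆ {x = x} {X} x∈X y∈ = subst (_∈ X) (sym (x∈⁅y⁆⇒x≡y x y∈)) x∈X

strongModules : DefinableFamily
strongModules = record
  { member  = λ G _ → IsStrongModule G
  ; memberᵈ = λ _ → isStrongModuleᵈ
  }

strongModules-laminar : ∀ G → IsLaminar (IsStrongModule G)
strongModules-laminar G = record
  { 𝓛?         = λ M → decide (isStrongModuleᵈ 0F) G [] (M ∷ [])
  ; top        = ((vertex (nonempty G) , ∈⊤) , λ v∉ _ _ → contradiction ∈⊤ v∉) ,
                 λ N _ (_ , _ , N⊈⊤) → N⊈⊤ (λ _ → ∈⊤)
  ; inhabited  = λ ((ne , _) , _) → ne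
  ; comparable = λ p q x∈M x∈N → nested p q x∈M x∈N
  }
  where
  vertex : ∀ {n} → NonZero n → Fin n
  vertex {suc n} _ = zero
  nested : ∀ {M N x} → IsStrongModule G M → IsStrongModule G N → x ∈ M → x ∈ N → M ⊆ N ⊎ N ⊆ M
  nested {M} {N} {x} (_ , strong) (moduleN , _) x∈M x∈N with M ⊆? N | N ⊆? M
  ... | yes M⊆N | _       = inj₁ M⊆N
  ... | no _    | yes N⊆M = inj₂ N⊆M
  ... | no M⊈N  | no N⊈M  = contradiction ((x , x∈p∩q⁺ (x∈M , x∈N)) , M⊈N , N⊈M) (strong N moduleN)

strongModules-singletons : ∀ G x → IsStrongModule G ⁅ x ⁆
strongModules-singletons G x = ((x , x∈⁅x⁆ x) ,
    λ {v} {u} {u′} _ u∈ u′∈ → case trans (x∈⁅y⁆⇒x≡y x u∈) (sym (x∈⁅y⁆⇒x≡y x u′∈)) of λ { refl → ⇔.refl , ⇔.refl }) ,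
  λ N _ ((y , y∈) , ⊈N , _) → let y∈x , y∈N = x∈p∩q⁻ ⁅ x ⁆ N y∈ in
    ⊈N (⁅⁆⊆ (subst (_∈ N) (x∈⁅y⁆⇒x≡y x y∈x) y∈N))

module SetTree (G : Graph) where
  open Family (IsStrongModule G) public

  SetF : Vertices G → Vertices G → Set
  SetF X Y = (X ≢ Y × ∃[ Z ] (Child X Z × Child Y Z)) × ∃[ u ] ∃[ v ] (u ∈ X × v ∈ Y × Edge G u v)

  SetParallel SetSeries SetOrder : Vertices G → Set
  SetParallel Z = ∃ (λ X → Child X Z) × (∀ X Y → Child X Z → Child Y Z → ¬ SetF X Y)
  SetSeries Z   = ∃ (λ X → Child X Z) × (∀ X Y → Child X Z → Child Y Z → X ≢ Y → SetF X Y)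
  SetOrder Z    = ∃ (λ X → Child X Z)
    × (∀ X Y → Child X Z → Child Y Z → X ≢ Y → SetF X Y ⊎ SetF Y X)
    × (∀ X Y → Child X Z → Child Y Z → SetF X Y → ¬ SetF Y X)
    × (∀ X Y W → Child X Z → Child Y Z → Child W Z → SetF X Y → SetF Y W → SetF X W)

  SetPrecedes : Vertices G → Vertices G → Set
  SetPrecedes X Y = ∃[ Z ] (SetOrder Z × Child X Z × Child Y Z × SetF X Y)

module _ {e s : ℕ} where

  smChildᵈ : (X Y : Fin s) → Definable {e} (λ G ρ σ → SetTree.Child G (lookup σ X) (lookup σ Y))
  smChildᵈ X Y = FamilyDefinability.childᵈ strongModules X X Y

module _ {e s : ℕ} where

  setFᵈ : (X Y : Fin s) → Definable {e} (λ G ρ σ → SetTree.SetF G (lookup σ X) (lookup σ Y))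
  setFᵈ X Y = (¬ᵈ (X ≡ᵈ Y) ×ᵈ ∃ˢ (smChildᵈ (suc X) 0F ×ᵈ smChildᵈ (suc Y) 0F))
    ×ᵈ ∃ᵈ (∃ᵈ ((1F ∊ᵈ X) ×ᵈ (0F ∊ᵈ Y) ×ᵈ edgeᵈ 1F 0F))

module _ {e s : ℕ} where

  setParallelᵈ : (Z : Fin s) → Definable {e} (λ G ρ σ → SetTree.SetParallel G (lookup σ Z))
  setParallelᵈ Z = ∃ˢ (smChildᵈ 0F (suc Z)) ×ᵈ
    ∀ˢ (∀ˢ (smChildᵈ 1F (suc (suc Z)) →ᵈ smChildᵈ 0F (suc (suc Z)) →ᵈ ¬ᵈ setFᵈ 1F 0F))

  setSeriesᵈ : (Z : Fin s) → Definable {e} (λ G ρ σ → SetTree.SetSeries G (lookup σ Z))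
  setSeriesᵈ Z = ∃ˢ (smChildᵈ 0F (suc Z)) ×ᵈ
    ∀ˢ (∀ˢ (smChildᵈ 1F (suc (suc Z)) →ᵈ smChildᵈ 0F (suc (suc Z)) →ᵈ ¬ᵈ (1F ≡ᵈ 0F) →ᵈ setFᵈ 1F 0F))

  setOrderᵈ : (Z : Fin s) → Definable {e} (λ G ρ σ → SetTree.SetOrder G (lookup σ Z))
  setOrderᵈ Z = ∃ˢ (smChildᵈ 0F (suc Z))
    ×ᵈ ∀ˢ (∀ˢ (smChildᵈ 1F (suc (suc Z)) →ᵈ smChildᵈ 0F (suc (suc Z)) →ᵈ ¬ᵈ (1F ≡ᵈ 0F) →ᵈ
         (setFᵈ 1F 0F ⊎ᵈ setFᵈ 0F 1F)))
    ×ᵈ ∀ˢ (∀ˢ (smChildᵈ 1F (suc (suc Z)) →ᵈ smChildᵈ 0F (suc (suc Z)) →ᵈ setFᵈ 1F 0F →ᵈ ¬ᵈ setFᵈ 0F 1F))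
    ×ᵈ ∀ˢ (∀ˢ (∀ˢ (smChildᵈ 2F (suc (suc (suc Z))) →ᵈ smChildᵈ 1F (suc (suc (suc Z))) →ᵈ
         smChildᵈ 0F (suc (suc (suc Z))) →ᵈ setFᵈ 2F 1F →ᵈ setFᵈ 1F 0F →ᵈ setFᵈ 2F 0F)))

module _ {e s : ℕ} where

  setPrecedesᵈ : (X Y : Fin s) → Definable {e} (λ G ρ σ → SetTree.SetPrecedes G (lookup σ X) (lookup σ Y))
  setPrecedesᵈ X Y = ∃ˢ (setOrderᵈ 0F ×ᵈ smChildᵈ (suc X) 0F ×ᵈ smChildᵈ (suc Y) 0F ×ᵈ setFᵈ (suc X) (suc Y))

modularSpec : Specification
modularSpec = record
  { syms        = symbols ModularVocabulary
  ; comp        = complete ModularVocabulary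
  ; arities     = arity ModularVocabulary
  ; roles       = 0
  ; family      = strongModules
  ; admissible  = λ _ _ → Data.Unit.⊤
  ; admissibleᵈ = λ _ → trueᵈ
  ; keeps       = λ _ _ _ _ → Data.Unit.⊤
  ; keepsᵈ      = λ _ _ _ → trueᵈ
  ; relates     = λ where
      descˢ _ G _ (X ∷ Y ∷ []) → X ⊆ Y
      Fˢ    _ G _ (X ∷ Y ∷ []) → SetTree.SetF G X Y
  ; relatesᵈ    = λ where
      descˢ _ _ (X ∷ Y ∷ []) → X ⊆ᵈ Y
      Fˢ    _ _ (X ∷ Y ∷ []) → setFᵈ X Y
  }

cotreeSpec : Specification
cotreeSpec = record
  { syms        = symbols CotreeVocabulary
  ; comp        = complete CotreeVocabulary
  ; arities     = arity CotreeVocabulary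
  ; roles       = 0
  ; family      = strongModules
  ; admissible  = λ _ _ → Data.Unit.⊤
  ; admissibleᵈ = λ _ → trueᵈ
  ; keeps       = λ _ _ _ _ → Data.Unit.⊤
  ; keepsᵈ      = λ _ _ _ → trueᵈ
  ; relates     = λ where
      descˢ     _ G _ (X ∷ Y ∷ []) → X ⊆ Y
      parallelˢ _ G _ (X ∷ [])     → SetTree.SetParallel G X
      seriesˢ   _ G _ (X ∷ [])     → SetTree.SetSeries G X
      orderˢ    _ G _ (X ∷ [])     → SetTree.SetOrder G X
      precedesˢ _ G _ (X ∷ Y ∷ []) → SetTree.SetPrecedes G X Y
  ; relatesᵈ    = λ where
      descˢ     _ _ (X ∷ Y ∷ []) → X ⊆ᵈ Y
      parallelˢ _ _ (X ∷ [])     → setParallelᵈ X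
      seriesˢ   _ _ (X ∷ [])     → setSeriesᵈ X
      orderˢ    _ _ (X ∷ [])     → setOrderᵈ X
      precedesˢ _ _ (X ∷ Y ∷ []) → setPrecedesᵈ X Y
  }

-- Decompositions quantify over indices of nodes, the formulas over sets; quantifiers transfer
-- because every strong module is the module of a node.
module TreeOfSets {G m} (tree : ModularTree G m) where
  open SetTree G hiding (Child; Inner)
  module S = SetTree G
  open ModularTree tree
  open CotreeLabels tree

  ≢⇔ : ∀ {s t} → s ≢ t ⇔ module-of s ≢ module-of t
  ≢⇔ = mk⇔ (λ s≢t eq → s≢t (injective eq)) (λ ne eq → ne (cong module-of eq))

  child⇔ : ∀ {s t} → Child s t ⇔ S.Child (module-of s) (module-of t)
  child⇔ {s} {t} = mk⇔
    (λ (lt , btw) → strong s , strong t , lt , λ Z p → let r , eq = surjective Z p in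
      subst (λ Z → ¬ (module-of s ⊂ Z × Z ⊂ module-of t)) eq (btw r))
    (λ (_ , _ , lt , btw) → lt , λ r → btw (module-of r) (strong r))

  F⇔ : ∀ {s t} → F s t ⇔ SetF (module-of s) (module-of t)
  F⇔ {s} {t} = (to′ ×-⇔ ⇔.refl)
    where
    to′ : Siblings s t ⇔ (module-of s ≢ module-of t × ∃[ Z ] (S.Child (module-of s) Z × S.Child (module-of t) Z))
    to′ = ≢⇔ {s} {t} ×-⇔ mk⇔ (λ (r , c , c′) → module-of r , to child⇔ c , to child⇔ c′) back
      where
      back : ∃[ Z ] (S.Child (module-of s) Z × S.Child (module-of t) Z) → ∃[ r ] (Child s r × Child t r)
      back (Z , c , c′) with r , refl ← surjective Z (proj₁ (proj₂ c)) = r , from child⇔ c , from child⇔ c′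

  node-of : ∀ {X Z} → S.Child X Z → ∃[ s ] module-of s ≡ X
  node-of c = surjective _ (proj₁ c)

  inner⇔ : ∀ {t} → Inner t ⇔ ∃ (λ X → S.Child X (module-of t))
  inner⇔ {t} = mk⇔ (λ (s , c) → module-of s , to child⇔ c) back
    where
    back : ∃ (λ X → S.Child X (module-of t)) → Inner t
    back (X , c) with s , refl ← node-of c = s , from child⇔ c

  pairs⇔ : ∀ {t} {P : Fin m → Fin m → Set} {Q : Vertices G → Vertices G → Set} →
           (∀ s s′ → P s s′ ⇔ Q (module-of s) (module-of s′)) →
           (∀ s s′ → Child s t → Child s′ t → P s s′) ⇔
           (∀ X Y → S.Child X (module-of t) → S.Child Y (module-of t) → Q X Y)
  pairs⇔ {t} {P} {Q} e = mk⇔ there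
    (λ f s s′ c c′ → from (e s s′) (f (module-of s) (module-of s′) (to child⇔ c) (to child⇔ c′)))
    where
    there : (∀ s s′ → Child s t → Child s′ t → P s s′) →
            ∀ X Y → S.Child X (module-of t) → S.Child Y (module-of t) → Q X Y
    there f X Y c c′ with s , refl ← node-of c with s′ , refl ← node-of c′ =
      to (e s s′) (f s s′ (from child⇔ c) (from child⇔ c′))

  infixr 3 _→-⇔_
  _→-⇔_ : ∀ {A B C D : Set} → A ⇔ B → C ⇔ D → (A → C) ⇔ (B → D)
  e →-⇔ e′ = mk⇔ (λ f b → to e′ (f (from e b))) (λ f a → from e′ (f (to e a)))

  ¬-⇔ : ∀ {A B : Set} → A ⇔ B → (¬ A) ⇔ (¬ B)
  ¬-⇔ e = e →-⇔ ⇔.refl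

  parallel⇔ : ∀ {t} → IsParallel t ⇔ SetParallel (module-of t)
  parallel⇔ = inner⇔ ×-⇔ pairs⇔ (λ _ _ → ¬-⇔ F⇔)

  series⇔ : ∀ {t} → IsSeries t ⇔ SetSeries (module-of t)
  series⇔ = inner⇔ ×-⇔ pairs⇔ (λ s s′ → ≢⇔ {s} {s′} →-⇔ F⇔)

  order⇔ : ∀ {t} → IsOrder t ⇔ SetOrder (module-of t)
  order⇔ {t} = inner⇔ ×-⇔ pairs⇔ (λ s s′ → ≢⇔ {s} {s′} →-⇔ (F⇔ ⊎-⇔ F⇔))
    ×-⇔ pairs⇔ (λ _ _ → F⇔ →-⇔ ¬-⇔ F⇔)
    ×-⇔ mk⇔ there (λ f s s′ s″ c c′ c″ p q → from F⇔
          (f _ _ _ (to child⇔ c) (to child⇔ c′) (to child⇔ c″) (to F⇔ p) (to F⇔ q)))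
    where
    there : (∀ s s′ s″ → Child s t → Child s′ t → Child s″ t → F s s′ → F s′ s″ → F s s″) →
            ∀ X Y W → S.Child X (module-of t) → S.Child Y (module-of t) → S.Child W (module-of t) →
            SetF X Y → SetF Y W → SetF X W
    there f X Y W c c′ c″ p q
      with s , refl ← node-of c with s′ , refl ← node-of c′ with s″ , refl ← node-of c″ =
      to F⇔ (f s s′ s″ (from child⇔ c) (from child⇔ c′) (from child⇔ c″) (from F⇔ p) (from F⇔ q))

  precedes⇔ : ∀ {s s′} → Precedes s s′ ⇔ SetPrecedes (module-of s) (module-of s′)
  precedes⇔ {s} {s′} = mk⇔
    (λ (t , o , c , c′ , f) → module-of t , to order⇔ o , to child⇔ c , to child⇔ c′ , to F⇔ f) back
    where
    back : SetPrecedes (module-of s) (module-of s′) → Precedes s s′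
    back (Z , o , c , c′ , f) with t , refl ← surjective Z (proj₁ (proj₂ c)) =
      t , from order⇔ o , from child⇔ c , from child⇔ c′ , from F⇔ f

Fin1-unique : (i j : Fin 1) → i ≡ j
Fin1-unique 0F 0F = refl

modular-outputs : ∀ G → Outputs (TreeTransduction.τ modularSpec) ⌜ G ⌝ (IsModularDecomposition G)
modular-outputs G = TreeTransduction.outputs-good modularSpec G
  (λ _ _ → strongModules-laminar G) (λ _ _ → strongModules-singletons G) (⊤ , _) good
  where
  good : ∀ 𝔹 → Specification.Realises modularSpec G 𝔹 → IsModularDecomposition G 𝔹
  good 𝔹 r = record
    { tree     = tree
    ; rel-desc = λ s t → rels descˢ (s ∷ t ∷ [])
    ; rel-F    = λ s t → ⇔.trans (rels Fˢ (s ∷ t ∷ [])) (⇔.sym (TreeOfSets.F⇔ tree))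
    }
    where
    open Specification.Realises r
    tree : ModularTree G (size 𝔹)
    tree = record
      { module-of  = set-of
      ; strong     = λ t → proj₁ (valid t)
      ; injective  = λ eq → unique (Fin1-unique _ _) eq
      ; surjective = λ M p → let y , _ , eq = covers {0F} p _ in y , eq
      }

cotree-outputs : ∀ G → Outputs (TreeTransduction.τ cotreeSpec) ⌜ G ⌝ (IsCotree G)
cotree-outputs G = TreeTransduction.outputs-good cotreeSpec G
  (λ _ _ → strongModules-laminar G) (λ _ _ → strongModules-singletons G) (⊤ , _) good
  where
  good : ∀ 𝔹 → Specification.Realises cotreeSpec G 𝔹 → IsCotree G 𝔹
  good 𝔹 r = record
    { tree         = tree
    ; rel-desc     = λ s t → rels descˢ (s ∷ t ∷ [])
    ; rel-parallel = λ t → ⇔.trans (rels parallelˢ (t ∷ [])) (⇔.sym parallel⇔)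
    ; rel-series   = λ t → ⇔.trans (rels seriesˢ (t ∷ [])) (⇔.sym series⇔)
    ; rel-order    = λ t → ⇔.trans (rels orderˢ (t ∷ [])) (⇔.sym order⇔)
    ; rel-precedes = λ s t → ⇔.trans (rels precedesˢ (s ∷ t ∷ [])) (⇔.sym precedes⇔)
    }
    where
    open Specification.Realises r
    tree : ModularTree G (size 𝔹)
    tree = record
      { module-of  = set-of
      ; strong     = λ t → proj₁ (valid t)
      ; injective  = λ eq → unique (Fin1-unique _ _) eq
      ; surjective = λ M p → let y , _ , eq = covers {0F} p _ in y , eq
      }
    open TreeOfSets tree

-- Trees of bipartitions, rooted at a leaf

record IsBipartitionFamily {n} (𝓑 : Family n) : Set where
  field
    bipartition : ∀ {X Y} → 𝓑 X Y → IsBipartition X Y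
    swap        : ∀ {X Y} → 𝓑 X Y → 𝓑 Y X
    trivial     : ∀ {x y} → x ≢ y → 𝓑 ⁅ x ⁆ (∁ ⁅ x ⁆)

complementary : ∀ {n} {X Y : Subset n} → IsBipartition X Y → ∀ x → x ∈ Y ⇔ x ∉ X
complementary {X = X} {Y} (_ , _ , ∪≡⊤ , ∩≡⊥) x = mk⇔
  (λ x∈Y x∈X → ∉⊥ (subst (x ∈_) ∩≡⊥ (x∈p∩q⁺ (x∈X , x∈Y))))
  (λ x∉X → [ (λ x∈X → contradiction x∈X x∉X) , id ]′ (x∈p∪q⁻ X Y (subst (x ∈_) (sym ∪≡⊤) ∈⊤)))

-- With the parameter R = {r}, a bipartition is represented by its side that
-- avoids r, and the whole vertex set stands for the leaf r.
StrongSide : ∀ {n} → Family n → Subset n → Subset n → Set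
StrongSide 𝓑 R X = (∀ x → x ∈ R → x ∉ X) × ∃ (Strong 𝓑 X)

NodeSet : ∀ {n} → Family n → Subset n → Subset n → Set
NodeSet 𝓑 R X = (∀ x → x ∈ X) ⊎ StrongSide 𝓑 R X

-- The coding needs every singleton as a leaf, so `R` is added; the specifications discard it again
-- through `keeps`.
RootedFamily : ∀ {n} → Family n → Subset n → Subset n → Set
RootedFamily 𝓑 R X = NodeSet 𝓑 R X ⊎ X ≡ R

module Rooted {n} {𝓑 : Family n} (isFamily : IsBipartitionFamily 𝓑) {R : Subset n} {r : Fin n}
              (R≡r : ∀ x → x ∈ R ⇔ x ≡ r) where
  open IsBipartitionFamily isFamily

  r∈R : r ∈ R
  r∈R = from (R≡r r) refl

  strong-swap : ∀ {X Y} → Strong 𝓑 X Y → Strong 𝓑 Y X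
  strong-swap (b , nc) = swap b , λ X′ Y′ b′ (p , q , p′ , q′) → nc X′ Y′ b′ (p′ , q′ , p , q)

  -- A crossing bipartition would have `x` on both of its sides.
  singleton-strong : ∀ {x y} → x ≢ y → Strong 𝓑 ⁅ x ⁆ (∁ ⁅ x ⁆)
  singleton-strong {x} x≢y = trivial x≢y , λ X′ Y′ b ((z , z∈) , (w , w∈) , _) →
    let z≡x , z∈X′ = x∈p∩q⁻ ⁅ x ⁆ X′ z∈
        w≡x , w∈Y′ = x∈p∩q⁻ ⁅ x ⁆ Y′ w∈
        z≡w = trans (x∈⁅y⁆⇒x≡y x z≡x) (sym (x∈⁅y⁆⇒x≡y x w≡x))
    in to (complementary (bipartition b) w) w∈Y′ (subst (_∈ X′) z≡w z∈X′)

  singleton-side : ∀ {x} → x ≢ r → StrongSide 𝓑 R ⁅ x ⁆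
  singleton-side {x} x≢r =
    (λ y y∈R y∈x → x≢r (trans (sym (x∈⁅y⁆⇒x≡y x y∈x)) (to (R≡r y) y∈R))) , _ , singleton-strong x≢r

  -- `r` lies in the intersection of the two complements, so two overlapping sides that are not
  -- nested would cross.
  side-comparable : ∀ {X Y x} → StrongSide 𝓑 R X → StrongSide 𝓑 R Y → x ∈ X → x ∈ Y → X ⊆ Y ⊎ Y ⊆ X
  side-comparable {X} {Y} {x} (avoidX , X′ , bX , nc) (avoidY , Y′ , bY , _) x∈X x∈Y
    with X ⊆? Y | Y ⊆? X
  ... | yes X⊆Y | _       = inj₁ X⊆Y
  ... | no _    | yes Y⊆X = inj₂ Y⊆X
  ... | no X⊈Y  | no Y⊈X  = contradiction
    ((x , x∈p∩q⁺ (x∈X , x∈Y)) , outside X⊈Y bY ,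
     (let z , z∈ = outside Y⊈X bX in z , x∈p∩q⁺ (proj₂ (x∈p∩q⁻ Y X′ z∈) , proj₁ (x∈p∩q⁻ Y X′ z∈))) ,
     r , x∈p∩q⁺ (from (complementary (bipartition bX) r) (avoidX r r∈R) ,
                 from (complementary (bipartition bY) r) (avoidY r r∈R)))
    (nc Y Y′ bY)
    where
    outside : ∀ {A B B′} → ¬ A ⊆ B → 𝓑 B B′ → Nonempty (A ∩ B′)
    outside {A} {B} A⊈B b with any? (λ z → (z ∈? A) ×-dec ¬? (z ∈? B))
    ... | yes (z , z∈A , z∉B) = z , x∈p∩q⁺ (z∈A , from (complementary (bipartition b) z) z∉B)
    ... | no ¬p = contradiction (λ {z} z∈A → Dec.decidable-stable (z ∈? B) (λ z∉B → ¬p (z , z∈A , z∉B))) A⊈B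

  node-comparable : ∀ {X Y x} → NodeSet 𝓑 R X → NodeSet 𝓑 R Y → x ∈ X → x ∈ Y → X ⊆ Y ⊎ Y ⊆ X
  node-comparable (inj₁ all) _ _ _ = inj₂ (λ {x} _ → all x)
  node-comparable (inj₂ _) (inj₁ all) _ _ = inj₁ (λ {x} _ → all x)
  node-comparable (inj₂ p) (inj₂ q) = side-comparable p q

  node-inhabited : ∀ {X} → NodeSet 𝓑 R X → Nonempty X
  node-inhabited (inj₁ all) = r , all r
  node-inhabited (inj₂ (_ , _ , b , _)) = proj₁ (bipartition b)

  R⊆ : ∀ {X x} → NodeSet 𝓑 R X → x ∈ X → x ∈ R → R ⊆ X
  R⊆ (inj₁ all) _ _ {y} _ = all y
  R⊆ (inj₂ (avoids , _)) x∈X x∈R = contradiction x∈X (avoids _ x∈R)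

  module _ (Node? : ∀ X → Dec (NodeSet 𝓑 R X)) where

    node-laminar : IsLaminar (NodeSet 𝓑 R)
    node-laminar = record
      { 𝓛?         = Node?
      ; top        = inj₁ (λ _ → ∈⊤)
      ; inhabited  = node-inhabited
      ; comparable = node-comparable
      }

    rooted-laminar : IsLaminar (RootedFamily 𝓑 R)
    rooted-laminar = record
      { 𝓛?         = λ X → Node? X ⊎-dec Dec.map ⊆×⊇⇔≡ ((X ⊆? R) ×-dec (R ⊆? X))
      ; top        = inj₁ (inj₁ (λ _ → ∈⊤))
      ; inhabited  = λ { (inj₁ p) → node-inhabited p ; (inj₂ refl) → r , r∈R }
      ; comparable = comparable′
      }
      where
      comparable′ : ∀ {X Y x} → RootedFamily 𝓑 R X → RootedFamily 𝓑 R Y → x ∈ X → x ∈ Y → X ⊆ Y ⊎ Y ⊆ X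
      comparable′ (inj₁ p)    (inj₁ q)    x∈X x∈Y = node-comparable p q x∈X x∈Y
      comparable′ (inj₁ p)    (inj₂ refl) x∈X x∈Y = inj₂ (R⊆ p x∈X x∈Y)
      comparable′ (inj₂ refl) (inj₁ q)    x∈X x∈Y = inj₁ (R⊆ q x∈Y x∈X)
      comparable′ (inj₂ refl) (inj₂ refl) x∈X x∈Y = inj₁ id

  rooted-singletons : ∀ x → RootedFamily 𝓑 R ⁅ x ⁆
  rooted-singletons x with x ≟ᶠ r
  ... | yes refl = inj₂ (⊆-antisym (⁅⁆⊆ r∈R) (λ {y} y∈R → subst (_∈ ⁅ r ⁆) (sym (to (R≡r y) y∈R)) (x∈⁅x⁆ r)))
  ... | no x≢r   = inj₁ (inj₂ (singleton-side x≢r))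

inject₁²≢suc² : ∀ {n} (i : Fin n) → inject₁ (inject₁ i) ≢ suc (suc i)
inject₁²≢suc² (suc i) eq = inject₁²≢suc² i (suc-injective eq)

last-or-inject₁ : ∀ {n} (i : Fin (suc n)) → i ≡ fromℕ n ⊎ (∃[ j ] i ≡ inject₁ j)
last-or-inject₁ {zero}  zero    = inj₁ refl
last-or-inject₁ {suc n} zero    = inj₂ (zero , refl)
last-or-inject₁ {suc n} (suc i) with last-or-inject₁ i
... | inj₁ refl       = inj₁ refl
... | inj₂ (j , refl) = inj₂ (suc j , refl)

cycle-neighbours : ∀ {G} → Undirected G → (c : Cycle G) → ∀ i →
  ∃[ j ] ∃[ j′ ] (j ≢ j′ × Edge G (Cycle.vertex c i) (Cycle.vertex c j)
                         × Edge G (Cycle.vertex c i) (Cycle.vertex c j′))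
cycle-neighbours undirected c zero =
  suc zero , fromℕ _ , (λ ()) , Cycle.step c zero , undirected _ _ (Cycle.close c)
cycle-neighbours undirected c (suc i) with last-or-inject₁ i
... | inj₁ refl       = inject₁ i , zero , (λ ()) , undirected _ _ (Cycle.step c i) , Cycle.close c
... | inj₂ (j , refl) = inject₁ i , suc (suc j) , inject₁²≢suc² j , undirected _ _ (Cycle.step c i) , Cycle.step c (suc j)

3≤∣p∣ : ∀ {n} {p : Subset n} {x y z} → x ∈ p → y ∈ p → z ∈ p → y ≢ x → z ≢ x → z ≢ y → 3 ≤ ∣ p ∣
3≤∣p∣ x∈p y∈p z∈p y≢x z≢x z≢y =
  ℕₚ.≤-trans (s≤s (ℕₚ.≤-trans (s≤s (ℕₚ.≤-trans (s≤s z≤n)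
    (x∈p⇒∣p-x∣<∣p∣ (x∈p∧x≢y⇒x∈p-y (x∈p∧x≢y⇒x∈p-y z∈p z≢x) z≢y))))
    (x∈p⇒∣p-x∣<∣p∣ (x∈p∧x≢y⇒x∈p-y y∈p y≢x))))
    (x∈p⇒∣p-x∣<∣p∣ x∈p)

∣p∣≤1 : ∀ {n} {p : Subset n} → Fin n → (∀ {x y} → x ∈ p → y ∈ p → x ≡ y) → ∣ p ∣ ≤ 1
∣p∣≤1 {p = p} x₀ eq with nonempty? p
... | yes (x , x∈p) = subst (∣ p ∣ ≤_) (∣⁅x⁆∣≡1 x)
  (p⊆q⇒∣p∣≤∣q∣ {q = ⁅ x ⁆} λ {y} y∈p → subst (y ∈_) (cong ⁅_⁆ (eq y∈p x∈p)) (x∈⁅x⁆ y))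
... | no empty = subst (∣ p ∣ ≤_) (∣⁅x⁆∣≡1 x₀) (p⊆q⇒∣p∣≤∣q∣ {q = ⁅ x₀ ⁆} λ {y} y∈p → contradiction (y , y∈p) empty)

-- As the whole vertex set is the leaf `r` and not an additional root, the pairs of parent and child
-- are the edges of the unrooted tree as they stand.
module StrongTree {n} {𝓑 : Family n} (isFamily : IsBipartitionFamily 𝓑) {R : Subset n} {r : Fin n}
  (R≡r : ∀ x → x ∈ R ⇔ x ≡ r) (Node? : ∀ X → Dec (NodeSet 𝓑 R X))
  {m : ℕ} (node : Fin m → Subset n) (node-injective : Injective _≡_ _≡_ node)
  (valid : ∀ t → NodeSet 𝓑 R (node t)) (covers : ∀ {X} → NodeSet 𝓑 R X → ∃[ t ] node t ≡ X) where

  open IsBipartitionFamily isFamily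
  open Rooted isFamily R≡r
  open Family (NodeSet 𝓑 R) hiding (Inner)
  open Laminar (node-laminar Node?)

  Up : Fin m → Fin m → Set
  Up s t = Child (node s) (node t)

  abstract
    Child? : ∀ X Y → Dec (Child X Y)
    Child? X Y = Node? X ×-dec Node? Y ×-dec (X ⊂? Y) ×-dec
      allSubset? (λ Z → Node? Z Dec.→-dec ¬? ((X ⊂? Z) ×-dec (Z ⊂? Y)))

    Adjacent? : ∀ s t → Dec (Up s t ⊎ Up t s)
    Adjacent? s t = Child? (node s) (node t) ⊎-dec Child? (node t) (node s)

  up-irreflexive : ∀ {s} → ¬ Up s s
  up-irreflexive (_ , _ , lt , _) = ⊂-irref refl lt

  tree : Graph
  tree = record
    { order    = m
    ; nonempty = fin-nonZero (proj₁ (covers (inj₁ (λ x → ∈⊤ {x = x}))))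
    ; edge     = λ s t → does (Adjacent? s t)
    ; loopless = λ s e → [ up-irreflexive , up-irreflexive ]′ (to (T-does (Adjacent? s s)) e)
    }
    where
    fin-nonZero : ∀ {k} → Fin k → NonZero k
    fin-nonZero {suc k} _ = _

  edge⇔ : ∀ {s t} → Edge tree s t ⇔ (Up s t ⊎ Up t s)
  edge⇔ {s} {t} = T-does (Adjacent? s t)

  undirected : Undirected tree
  undirected s t e = from edge⇔ ([ inj₂ , inj₁ ]′ (to edge⇔ e))

  up-unique : ∀ {s t t′} → Up s t → Up s t′ → t ≡ t′
  up-unique c c′ = node-injective (parent-unique c c′)

  up-asymmetric : ∀ {s t} → Up s t → ¬ Up t s
  up-asymmetric (_ , _ , lt , _) (_ , _ , lt′ , _) = ⊂-asymmetric lt lt′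

  below-top : ∀ {X Y : Subset n} → X ⊂ Y → X ≢ ⊤
  below-top (_ , _ , _ , x∉X) refl = x∉X ∈⊤

  up : ∀ {s} → node s ≢ ⊤ → ∃ (Up s)
  up {s} ≢⊤ with Y , c ← parent (valid s) ≢⊤ with t , refl ← covers (proj₁ (proj₂ c)) = t , c

  -- `E` is left open so that the walk to an ancestor serves both in the tree and after the deletion
  -- of an edge.
  climb : ∀ {E : Fin m → Fin m → Set} {u a} → node u ⊆ node a →
          (∀ {x y} → Up x y → node u ⊆ node x → node y ⊆ node a → E x y) → Star E u a
  climb {E} {u} {a} u⊆a step = go (⊃-wellFounded (node u)) id u⊆a
    where
    go : ∀ {x} → Acc (flip _⊂_) (node x) → node u ⊆ node x → node x ⊆ node a → Star E x a
    go {x} (acc rec) u⊆x x⊆a with ⊆⇒≡⊎⊂ x⊆a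
    ... | inj₁ eq with refl ← node-injective eq = ε
    ... | inj₂ lt with y , c@(_ , _ , x⊂y , _) ← up (below-top lt) =
      let y⊆a = parent-⊆ c (valid a) lt
      in step c u⊆x y⊆a ◅ go (rec x⊂y) (λ z∈ → proj₁ x⊂y (u⊆x z∈)) y⊆a

  root : Fin m
  root = proj₁ (covers (inj₁ (λ x → ∈⊤ {x = x})))

  node-root : node root ≡ ⊤
  node-root = proj₂ (covers (inj₁ (λ x → ∈⊤ {x = x})))

  ⊆root : ∀ {s} → node s ⊆ node root
  ⊆root {x = x} _ = subst (x ∈_) (sym node-root) ∈⊤

  isTree : IsTree tree
  isTree = record
    { undirected = undirected
    ; connected  = λ s t → toRoot s ◅◅ reverse (undirected _ _) (toRoot t)
    ; acyclic    = λ c → descent c zero (⊂-wellFounded _)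
    }
    where
    toRoot : ∀ s → Star (Edge tree) s root
    toRoot s = climb (⊆root {s}) (λ c _ _ → from edge⇔ (inj₁ c))
    -- Every vertex of a cycle has a neighbour on the cycle that is its child.
    descent : (c : Cycle tree) → ∀ i → ¬ Acc _⊂_ (node (Cycle.vertex c i))
    descent c i (acc rec) with j , j′ , j≢j′ , e , e′ ← cycle-neighbours undirected c i
      with to edge⇔ e | to edge⇔ e′
    ... | inj₂ d | _       = descent c j (rec (proj₁ (proj₂ (proj₂ d))))
    ... | inj₁ _ | inj₂ d′ = descent c j′ (rec (proj₁ (proj₂ (proj₂ d′))))
    ... | inj₁ d | inj₁ d′ = j≢j′ (Cycle.injective c (up-unique d d′))

  LeafSet : Fin n → Set
  LeafSet v = ∃[ t ] ((v ≡ r × node t ≡ ⊤) ⊎ (v ≢ r × node t ≡ ⁅ v ⁆))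

  abstract
    leafSet : ∀ v → LeafSet v
    leafSet v with v ≟ᶠ r
    ... | yes v≡r = root , inj₁ (v≡r , node-root)
    ... | no v≢r  = let t , eq = covers (inj₂ (singleton-side v≢r)) in t , inj₂ (v≢r , eq)

  leaf : Fin n → Fin m
  leaf v = proj₁ (leafSet v)

  leaf-r : node (leaf r) ≡ ⊤
  leaf-r with proj₂ (leafSet r)
  ... | inj₁ (_ , eq) = eq
  ... | inj₂ (ne , _) = contradiction refl ne

  leaf-≢ : ∀ {v} → v ≢ r → node (leaf v) ≡ ⁅ v ⁆
  leaf-≢ {v} v≢r with proj₂ (leafSet v)
  ... | inj₁ (eq , _) = contradiction eq v≢r
  ... | inj₂ (_ , eq) = eq

  ∈leaf : ∀ v → v ∈ node (leaf v)
  ∈leaf v with proj₂ (leafSet v)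
  ... | inj₁ (_ , eq) = subst (v ∈_) (sym eq) ∈⊤
  ... | inj₂ (_ , eq) = subst (v ∈_) (sym eq) (x∈⁅x⁆ v)

  avoids : ∀ {s t} → Up s t → StrongSide 𝓑 R (node s)
  avoids {s} (inj₁ all , _ , (_ , x , _ , x∉) , _) = contradiction (all x) x∉
  avoids (inj₂ p , _) = p

  r∉ : ∀ {s t} → Up s t → r ∉ node s
  r∉ c = proj₁ (avoids c) r r∈R

  leaf⊆ : ∀ {s t v} → Up s t → v ∈ node s → node (leaf v) ⊆ node s
  leaf⊆ {s} c v∈ = subst (_⊆ node s) (sym (leaf-≢ λ { refl → r∉ c v∈ })) (⁅⁆⊆ v∈)

  leaf-injective : Injective _≡_ _≡_ leaf
  leaf-injective {v} {w} eq with v ≟ᶠ r | w ≟ᶠ r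
  ... | yes refl | yes refl = refl
  ... | no v≢r   | _        = sym (x∈⁅y⁆⇒x≡y v (subst (w ∈_) (trans (cong node (sym eq)) (leaf-≢ v≢r)) (∈leaf w)))
  ... | yes _    | no w≢r   = x∈⁅y⁆⇒x≡y w (subst (v ∈_) (trans (cong node eq) (leaf-≢ w≢r)) (∈leaf v))

  Side : (s t : Fin m) → Fin n → Set
  Side s t v = Star (DeleteEdge tree s t) s (leaf v)

  deleted-undirected : ∀ {s t x y} → DeleteEdge tree s t x y → DeleteEdge tree s t y x
  deleted-undirected (e , p , q) = undirected _ _ e , (λ (y≡s , x≡t) → q (x≡t , y≡s)) , (λ (y≡t , x≡s) → p (x≡s , y≡t))

  -- The nodes contained in `node s` can be left only through the deleted edge. Conversely, the leaf
  -- of `v` climbs to `s` among them.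
  side-below : ∀ {s t v} → Up s t → Side s t v ⇔ v ∈ node s
  side-below {s} {t} {v} c = mk⇔ (λ path → stay path id (∈leaf v)) back
    where
    stay : ∀ {x y} → Star (DeleteEdge tree s t) x y → node x ⊆ node s → node y ⊆ node s
    stay ε x⊆s = x⊆s
    stay {x} (_◅_ {j = z} (e , ≢st , _) path) x⊆s with to edge⇔ e
    ... | inj₂ (_ , _ , (z⊆x , _) , _) = stay path (λ v∈ → x⊆s (z⊆x v∈))
    ... | inj₁ d with ⊆⇒≡⊎⊂ x⊆s
    ...   | inj₂ x⊂s = stay path (parent-⊆ d (valid s) x⊂s)
    ...   | inj₁ eq with refl ← node-injective eq = contradiction (refl , up-unique d c) ≢st
    back : v ∈ node s → Side s t v
    back v∈ = reverse deleted-undirected (climb (leaf⊆ c v∈) λ {x} {y} d _ y⊆s → from edge⇔ (inj₁ d) ,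
      (λ { (refl , _) → let _ , z , z∈y , z∉s = proj₁ (proj₂ (proj₂ d)) in z∉s (y⊆s z∈y) }) ,
      (λ { (refl , refl) → up-asymmetric c d }))

  -- The nodes not contained in `node s` can be left only by the deleted edge into `s`. Conversely,
  -- `t` and the leaf of `v` both climb to the root without visiting `s`.
  side-above : ∀ {s t v} → Up s t → Side t s v ⇔ v ∉ node s
  side-above {s} {t} {v} c@(_ , _ , (s⊆t , z , z∈t , z∉s) , _) = mk⇔
    (λ path v∈s → stay path (λ t⊆s → z∉s (t⊆s z∈t)) (leaf⊆ c v∈s)) back
    where
    stay : ∀ {x y} → Star (DeleteEdge tree t s) x y → ¬ node x ⊆ node s → ¬ node y ⊆ node s
    stay ε x⊈s = x⊈s
    stay {x} (_◅_ {j = w} (e , ≢ts , _) path) x⊈s with to edge⇔ e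
    ... | inj₁ (_ , _ , (x⊆w , _) , _) = stay path (λ w⊆s → x⊈s (λ v∈ → w⊆s (x⊆w v∈)))
    ... | inj₂ d = stay path λ w⊆s → case ⊆⇒≡⊎⊂ w⊆s of λ where
      (inj₂ w⊂s) → x⊈s (parent-⊆ d (valid s) w⊂s)
      (inj₁ eq)  → case node-injective eq of λ { refl → ≢ts (up-unique d c , refl) }
    toRoot : ∀ {u} → (∀ {x} → node u ⊆ node x → x ≢ s) → Star (DeleteEdge tree t s) u root
    toRoot {u} ≢s = climb (⊆root {u}) λ d u⊆x _ → from edge⇔ (inj₁ d) ,
      (λ { (refl , refl) → up-asymmetric c d }) , (λ { (refl , _) → ≢s u⊆x refl })
    back : v ∉ node s → Side t s v
    back v∉s = toRoot (λ { t⊆x refl → z∉s (t⊆x z∈t) }) ◅◅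
      reverse deleted-undirected (toRoot (λ { l⊆x refl → v∉s (l⊆x (∈leaf v)) }))

  Displays : (s t : Fin m) → Subset n → Subset n → Set
  Displays s t X Y = ∀ v → (v ∈ X ⇔ Side s t v) × (v ∈ Y ⇔ Side t s v)

  displays : ∀ {s t Y} → Up s t → Strong 𝓑 (node s) Y → Displays s t (node s) Y
  displays c (b , _) v = ⇔.sym (side-below c) ,
    ⇔.trans (complementary (bipartition b) v) (⇔.sym (side-above c))

  edge→member : ∀ {s t} → Edge tree s t → ∃[ X ] ∃[ Y ] (Strong 𝓑 X Y × Displays s t X Y)
  edge→member {s} {t} e with to edge⇔ e
  ... | inj₁ c = let _ , Y , strong = avoids c in node s , Y , strong , displays c strong
  ... | inj₂ c = let _ , Y , strong = avoids c in
    Y , node t , strong-swap strong , λ v → let p , q = displays c strong v in q , p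

  -- The side that avoids `r` is the lower end of the edge; which of `X` and `Y` it is decides the
  -- orientation.
  member→edge : ∀ {X Y} → Strong 𝓑 X Y → ∃[ s ] ∃[ t ] (Edge tree s t × Displays s t X Y)
  member→edge {X} {Y} strong with r ∈? X
  ... | no r∉X with s , refl ← covers (inj₂ ((λ x x∈R → subst (_∉ X) (sym (to (R≡r x) x∈R)) r∉X) , Y , strong))
    with t , c ← up {s} (λ eq → r∉X (subst (r ∈_) (sym eq) ∈⊤)) = s , t , from edge⇔ (inj₁ c) , displays c strong
  member→edge {X} {Y} strong | yes r∈X
    with r∉Y ← (λ r∈Y → to (complementary (bipartition (proj₁ strong)) r) r∈Y r∈X)
    with s , refl ← covers (inj₂ ((λ x x∈R → subst (_∉ Y) (sym (to (R≡r x) x∈R)) r∉Y) , X , strong-swap strong))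
    with t , c ← up {s} (λ eq → r∉Y (subst (r ∈_) (sym eq) ∈⊤)) =
    t , s , from edge⇔ (inj₂ c) , λ v → let p , q = displays c (strong-swap strong) v in q , p

  same-side : ∀ {s t s′ t′} {Z : Subset n} → Up s t → Up s′ t′ →
              (∀ v → v ∈ Z ⇔ Side s t v) → (∀ v → v ∈ Z ⇔ Side s′ t′ v) → s ≡ s′ × t ≡ t′
  same-side {s} {s′ = s′} c c′ d d′ with refl ← node-injective {s} {s′} (⊆-antisym
    (λ {v} v∈ → to (side-below c′) (to (d′ v) (from (d v) (from (side-below c) v∈))))
    (λ {v} v∈ → to (side-below c) (to (d v) (from (d′ v) (from (side-below c′) v∈))))) = refl , up-unique c c′

  -- `r` is on the upper side of every edge and on the lower side of none.
  opposite-sides : ∀ {s t s′ t′} {Z : Subset n} → Up s t → Up t′ s′ →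
                   (∀ v → v ∈ Z ⇔ Side s t v) → ¬ (∀ v → v ∈ Z ⇔ Side s′ t′ v)
  opposite-sides c c′ d d′ = r∉ c (to (side-below c) (to (d r) (from (d′ r) (from (side-above c′) (r∉ c′)))))

  edge-unique : ∀ {s t s′ t′ X Y} → Edge tree s t → Edge tree s′ t′ →
                Displays s t X Y → Displays s′ t′ X Y → s ≡ s′ × t ≡ t′
  edge-unique {s} {t} {s′} {t′} e e′ d d′ = unique (to edge⇔ e) (to edge⇔ e′)
    where
    unique : Up s t ⊎ Up t s → Up s′ t′ ⊎ Up t′ s′ → s ≡ s′ × t ≡ t′
    unique (inj₁ c) (inj₁ c′) = same-side c c′ (proj₁ ∘ d) (proj₁ ∘ d′)
    unique (inj₂ c) (inj₂ c′) = let p , q = same-side c c′ (proj₂ ∘ d) (proj₂ ∘ d′) in q , p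
    unique (inj₁ c) (inj₂ c′) = ⊥-elim (opposite-sides c c′ (proj₁ ∘ d) (proj₁ ∘ d′))
    unique (inj₂ c) (inj₁ c′) = ⊥-elim (opposite-sides c′ c (proj₁ ∘ d′) (proj₁ ∘ d))

  neighbour⇔ : ∀ {t s} → s ∈ tabulate (edge tree t) ⇔ Edge tree t s
  neighbour⇔ {t} {s} = ⇔.trans ∈⇔T (mk⇔ (subst T (lookup∘tabulate _ s)) (subst T (sym (lookup∘tabulate _ s))))

  Internal : Fin m → Set
  Internal t = 1 < degree tree t

  -- A singleton has no children, hence at most its parent as neighbour. The whole set has no
  -- parent, and its children avoid `r`, so the complement of `r`, itself a node, is the only
  -- possible one.
  leaf-not-internal : ∀ v → ¬ Internal (leaf v)
  leaf-not-internal v 1<d = ℕₚ.<⇒≱ 1<d (∣p∣≤1 root λ x∈ y∈ →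
    neighbour-unique (to edge⇔ (to neighbour⇔ x∈)) (to edge⇔ (to neighbour⇔ y∈)))
    where
    no-children : v ≢ r → ∀ {x} → ¬ Up x (leaf v)
    no-children v≢r {x} (p , _ , (x⊆ , z , z∈ , z∉) , _) with w , w∈ ← node-inhabited p =
      z∉ (subst (_∈ node x) (trans (only (x⊆ w∈)) (sym (only z∈))) w∈)
      where
      only : ∀ {u} → u ∈ node (leaf v) → u ≡ v
      only u∈ = x∈⁅y⁆⇒x≡y v (subst (_ ∈_) (leaf-≢ v≢r) u∈)
    child-of-top : v ≡ r → ∀ {x} → Up x (leaf v) → node x ≡ ∁ ⁅ r ⁆
    child-of-top refl {x} c@(p , _ , _ , btw) with w , w∈ ← node-inhabited p =
      [ id , (λ lt → contradiction (lt , subst (∁ ⁅ r ⁆ ⊂_) (sym leaf-r)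
        ((λ _ → ∈⊤) , r , ∈⊤ , λ r∈ → x∈∁p⇒x∉p r∈ (x∈⁅x⁆ r))) (btw _ node-∁r)) ]′ (⊆⇒≡⊎⊂ x⊆)
      where
      x⊆ : node x ⊆ ∁ ⁅ r ⁆
      x⊆ {z} z∈ = x∉p⇒x∈∁p λ z∈r → r∉ c (subst (_∈ node x) (x∈⁅y⁆⇒x≡y r z∈r) z∈)
      node-∁r : NodeSet 𝓑 R (∁ ⁅ r ⁆)
      node-∁r = inj₂ ((λ z z∈R z∈ → x∈∁p⇒x∉p z∈ (subst (_∈ ⁅ r ⁆) (sym (to (R≡r z) z∈R)) (x∈⁅x⁆ r))) ,
        _ , strong-swap (singleton-strong {r} {w} λ { refl → r∉ c w∈ }))
    neighbour-unique : ∀ {x y} → Up (leaf v) x ⊎ Up x (leaf v) → Up (leaf v) y ⊎ Up y (leaf v) → x ≡ y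
    neighbour-unique p q with v ≟ᶠ r
    neighbour-unique (inj₁ c) (inj₁ c′) | no _ = up-unique c c′
    neighbour-unique (inj₂ c) _ | no v≢r = contradiction c (no-children v≢r)
    neighbour-unique (inj₁ _) (inj₂ c) | no v≢r = contradiction c (no-children v≢r)
    neighbour-unique (inj₂ c) (inj₂ c′) | yes eq = node-injective (trans (child-of-top eq c) (sym (child-of-top eq c′)))
    neighbour-unique (inj₁ c) _ | yes refl = contradiction leaf-r (below-top (proj₁ (proj₂ (proj₂ c))))
    neighbour-unique _ (inj₁ c) | yes refl = contradiction leaf-r (below-top (proj₁ (proj₂ (proj₂ c))))

  childAt : ∀ {t x} → ¬ (∃[ v ] leaf v ≡ t) → StrongSide 𝓑 R (node t) → x ∈ node t →
            ∃[ Y ] (Child Y (node t) × x ∈ Y)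
  childAt {t} {x} ¬leaf (avoid , _) x∈ =
    let Y , c , x⊆Y = childAbove (inj₂ (singleton-side x≢r)) (valid t) x⊂t in Y , c , x⊆Y (x∈⁅x⁆ x)
    where
    x≢r : x ≢ r
    x≢r refl = avoid r r∈R x∈
    x⊂t : ⁅ x ⁆ ⊂ node t
    x⊂t with ⊆⇒≡⊎⊂ {X = ⁅ x ⁆} {node t} (⁅⁆⊆ x∈)
    ... | inj₁ eq = contradiction (x , node-injective (trans (leaf-≢ x≢r) eq)) ¬leaf
    ... | inj₂ lt = lt

  -- Any other node has a parent, a child around some element `x`, and a second child around an
  -- element `y` outside the first.
  leaf-or-3≤ : ∀ t → (∃[ v ] leaf v ≡ t) ⊎ 3 ≤ degree tree t
  leaf-or-3≤ t with any? (λ v → leaf v ≟ᶠ t)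
  ... | yes p = inj₁ p
  ... | no ¬leaf = inj₂ (three (valid t) refl)
    where
    ≢⊤ : node t ≢ ⊤
    ≢⊤ eq = ¬leaf (r , node-injective (trans leaf-r (sym eq)))
    three : ∀ {X} → NodeSet 𝓑 R X → node t ≡ X → 3 ≤ degree tree t
    three (inj₁ all) refl = contradiction (⊆-antisym (λ _ → ∈⊤) (λ {x} _ → all x)) ≢⊤
    three (inj₂ p) refl with x , x∈ ← node-inhabited (valid t)
      with c , childc , x∈c ← childAt ¬leaf p x∈
      with y , y∈ , y∉c ← proj₂ (proj₁ (proj₂ (proj₂ childc)))
      with c′ , childc′ , y∈c′ ← childAt ¬leaf p y∈
      with u , upu ← up ≢⊤
      with s , refl ← covers (proj₁ childc)
      with s′ , refl ← covers (proj₁ childc′) =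
      3≤∣p∣ (from neighbour⇔ (from edge⇔ (inj₁ upu))) (from neighbour⇔ (from edge⇔ (inj₂ childc)))
            (from neighbour⇔ (from edge⇔ (inj₂ childc′)))
            (λ { refl → up-asymmetric upu childc }) (λ { refl → up-asymmetric upu childc′ })
            (λ { refl → y∉c y∈c′ })

  internal⇒¬leaf : ∀ {t} → Internal t → ¬ (∃[ v ] leaf v ≡ t)
  internal⇒¬leaf i (v , refl) = leaf-not-internal v i

  strongTree : TreeOfStrongMembers 𝓑
  strongTree = record
    { tree           = tree
    ; isTree         = isTree
    ; leaf           = leaf
    ; leaf-injective = leaf-injective
    ; leaf-image     = λ t → mk⇔
        (λ ¬i → [ id , (λ 3≤ → contradiction (ℕₚ.≤-trans (s≤s (s≤s z≤n)) 3≤) ¬i) ]′ (leaf-or-3≤ t))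
        (λ l i → internal⇒¬leaf i l)
    ; inner-degree   = λ t i → [ (λ l → contradiction l (internal⇒¬leaf i)) , id ]′ (leaf-or-3≤ t)
    ; edge→member    = edge→member
    ; member→edge    = member→edge
    ; edge-unique    = edge-unique
    }

-- Definability of the tree of strong bipartitions

record DefinableBipartitions : Set₁ where
  field
    bip  : ∀ G → Family (order G)
    bipᵈ : ∀ {e s} (X Y : Fin s) → Definable {e} {s} (λ G ρ σ → bip G (lookup σ X) (lookup σ Y))

IsRoot : ∀ G → Vertices G → Set
IsRoot G R = ∃[ r ] (∀ x → x ∈ R ⇔ x ≡ r)

isRootᵈ : ∀ {e s} (R : Fin s) → Definable {e} {s} (λ G ρ σ → IsRoot G (lookup σ R))
isRootᵈ R = ∃ᵈ (∀ᵈ ((0F ∊ᵈ R) ⇔ᵈ (0F ≐ᵈ 1F)))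

someRoot : ∀ G → ∃ (IsRoot G)
someRoot G = let v , _ = IsLaminar.inhabited (strongModules-laminar G) (IsLaminar.top (strongModules-laminar G))
  in ⁅ v ⁆ , v , λ x → mk⇔ (x∈⁅y⁆⇒x≡y v) (λ { refl → x∈⁅x⁆ v })

-- For conditions on tags, which are settled before any graph is given.
constᵈ : ∀ {e s} {A : Set} → Dec A → Definable {e} {s} (λ _ _ _ → A)
constᵈ (yes a) = mapᵈ trueᵈ (λ _ _ _ → mk⇔ (λ _ → a) _)
constᵈ (no ¬a) = mapᵈ (¬ᵈ trueᵈ) (λ _ _ _ → mk⇔ (λ f → contradiction _ f) (λ a _ → ¬a a))

module TreeOf {n} (𝓝 : Subset n → Set) (R : Subset n) where
  open Family 𝓝 public hiding (Inner)

  Adjacent : Subset n → Subset n → Set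
  Adjacent X Y = Child X Y ⊎ Child Y X

  -- The inner nodes: the whole vertex set is a leaf.
  Branching : Subset n → Set
  Branching X = Big X × (∀ x → x ∈ R → x ∉ X)

  -- Replaces reachability after deleting an edge by membership in its lower end; `side⇔` justifies
  -- this.
  SideOf : Subset n → Subset n → Fin n → Set
  SideOf X Y v = (Child X Y × v ∈ X) ⊎ (Child Y X × v ∉ Y)

crossBipᵈ : ∀ {e s} (X Y X′ Y′ : Fin s) → Definable {e} {s} (λ G ρ σ →
  CrossBip (lookup σ X) (lookup σ Y) (lookup σ X′) (lookup σ Y′))
crossBipᵈ {e} {s} X Y X′ Y′ = meet X X′ ×ᵈ meet X Y′ ×ᵈ meet Y X′ ×ᵈ meet Y Y′
  where
  meet : (A B : Fin s) → Definable {e} (λ G ρ σ → Nonempty (lookup σ A ∩ lookup σ B))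
  meet A B = mapᵈ (∃ᵈ ((0F ∊ᵈ A) ×ᵈ (0F ∊ᵈ B)))
    (λ _ _ σ → mk⇔ (λ (x , p) → x , x∈p∩q⁺ p) (λ (x , p) → x , x∈p∩q⁻ (lookup σ A) _ p))

isBipartition : ∀ {n} {X Y : Subset n} → Nonempty X → Nonempty Y →
                (∀ v → v ∈ X ⊎ v ∈ Y) → (∀ v → ¬ (v ∈ X × v ∈ Y)) → IsBipartition X Y
isBipartition {X = X} {Y} neX neY cover disjoint = neX , neY ,
  ⊆-antisym (λ _ → ∈⊤) (λ {v} _ → x∈p∪q⁺ (cover v)) ,
  ⊆-antisym (λ {v} v∈ → contradiction (x∈p∩q⁻ X Y v∈) (disjoint v)) (λ v∈ → contradiction v∈ ∉⊥)

isBipartitionᵈ : ∀ {e s} (X Y : Fin s) → Definable {e} {s} (λ G ρ σ → IsBipartition (lookup σ X) (lookup σ Y))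
isBipartitionᵈ X Y = mapᵈ
  (nonemptyᵈ X ×ᵈ nonemptyᵈ Y ×ᵈ ∀ᵈ ((0F ∊ᵈ X) ⊎ᵈ (0F ∊ᵈ Y)) ×ᵈ ∀ᵈ (¬ᵈ ((0F ∊ᵈ X) ×ᵈ (0F ∊ᵈ Y))))
  (λ _ _ σ → mk⇔ (λ (p , q , c , d) → isBipartition p q c d)
    (λ b@(p , q , ∪≡⊤ , ∩≡⊥) → p , q , (λ v → x∈p∪q⁻ (lookup σ X) _ (subst (v ∈_) (sym ∪≡⊤) ∈⊤)) ,
      (λ v (v∈X , v∈Y) → to (complementary b v) v∈Y v∈X)))

bipartition-swap : ∀ {n} {X Y : Subset n} → IsBipartition X Y → IsBipartition Y X
bipartition-swap {X = X} {Y} b@(p , q , ∪≡⊤ , _) = isBipartition q p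
  (λ v → [ inj₂ , inj₁ ]′ (x∈p∪q⁻ X Y (subst (v ∈_) (sym ∪≡⊤) ∈⊤)))
  (λ v (v∈Y , v∈X) → to (complementary b v) v∈Y v∈X)

bipartition-trivial : ∀ {n} {x y : Fin n} → x ≢ y → IsBipartition ⁅ x ⁆ (∁ ⁅ x ⁆)
bipartition-trivial {x = x} {y} x≢y = isBipartition (x , x∈⁅x⁆ x)
  (y , x∉p⇒x∈∁p λ y∈ → x≢y (sym (x∈⁅y⁆⇒x≡y x y∈)))
  (λ v → case v ∈? ⁅ x ⁆ of λ where
    (yes v∈) → inj₁ v∈
    (no v∉)  → inj₂ (x∉p⇒x∈∁p v∉))
  (λ v (v∈ , v∈∁) → x∈∁p⇒x∉p v∈∁ v∈)

module BipartitionDefinability (𝓑 : DefinableBipartitions) where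
  open DefinableBipartitions 𝓑

  abstract
    strongSideᵈ : ∀ {e s} (R X : Fin s) →
                  Definable {e} {s} (λ G ρ σ → StrongSide (bip G) (lookup σ R) (lookup σ X))
    strongSideᵈ R X = ∀ᵈ ((0F ∊ᵈ R) →ᵈ ¬ᵈ (0F ∊ᵈ X)) ×ᵈ
      ∃ˢ (bipᵈ (suc X) 0F ×ᵈ ∀ˢ (∀ˢ (bipᵈ 1F 0F →ᵈ ¬ᵈ crossBipᵈ (suc (suc (suc X))) 2F 1F 0F)))

    nodeSetᵈ : ∀ {e s} (R X : Fin s) →
               Definable {e} {s} (λ G ρ σ → NodeSet (bip G) (lookup σ R) (lookup σ X))
    nodeSetᵈ R X = ∀ᵈ (0F ∊ᵈ X) ⊎ᵈ strongSideᵈ R X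

  nodeFamily rootedFamily : DefinableFamily
  nodeFamily   = record { member = λ G → NodeSet (bip G) ; memberᵈ = nodeSetᵈ }
  rootedFamily = record
    { member  = λ G → RootedFamily (bip G)
    ; memberᵈ = λ R X → nodeSetᵈ R X ⊎ᵈ (X ≡ᵈ R)
    }

  module OnSets (G : Graph) (R : Vertices G) = TreeOf (NodeSet (bip G) R) R

  module _ {e s : ℕ} where
    abstract

      nodeChildᵈ : (R X Y : Fin s) → Definable {e} (λ G ρ σ → OnSets.Child G (lookup σ R) (lookup σ X) (lookup σ Y))
      nodeChildᵈ = FamilyDefinability.childᵈ nodeFamily

      adjacentᵈ : (R X Y : Fin s) → Definable {e} (λ G ρ σ → OnSets.Adjacent G (lookup σ R) (lookup σ X) (lookup σ Y))
      adjacentᵈ R X Y = nodeChildᵈ R X Y ⊎ᵈ nodeChildᵈ R Y X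

      sideOfᵈ : (R X Y : Fin s) (v : Fin e) →
                Definable (λ G ρ σ → OnSets.SideOf G (lookup σ R) (lookup σ X) (lookup σ Y) (lookup ρ v))
      sideOfᵈ R X Y v = (nodeChildᵈ R X Y ×ᵈ (v ∊ᵈ X)) ⊎ᵈ (nodeChildᵈ R Y X ×ᵈ ¬ᵈ (v ∊ᵈ Y))

  module _ {e s : ℕ} where
    abstract

      branchingᵈ : (R X : Fin s) → Definable {e} (λ G ρ σ → OnSets.Branching G (lookup σ R) (lookup σ X))
      branchingᵈ R X = bigᵈ X ×ᵈ ∀ᵈ ((0F ∊ᵈ R) →ᵈ ¬ᵈ (0F ∊ᵈ X))

-- Split decompositions

isSplitᵈ : ∀ {e s} (X Y : Fin s) → Definable {e} {s} (λ G ρ σ → IsSplit G (lookup σ X) (lookup σ Y))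
isSplitᵈ X Y = isBipartitionᵈ X Y
  ×ᵈ ∃ˢ (∃ˢ ((1F ⊆ᵈ suc (suc X)) ×ᵈ (0F ⊆ᵈ suc (suc Y)) ×ᵈ mapᵈ (∀ᵈ (∀ᵈ
       ((1F ∊ᵈ suc (suc X)) →ᵈ (0F ∊ᵈ suc (suc Y)) →ᵈ (edgeᵈ 1F 0F ⇔ᵈ ((1F ∊ᵈ 1F) ×ᵈ (0F ∊ᵈ 0F))))))
       (λ _ _ _ → mk⇔ (λ f {x} {y} → f x y) (λ f x y → f {x} {y}))))
  ×ᵈ ∃ˢ (∃ˢ ((1F ⊆ᵈ suc (suc X)) ×ᵈ (0F ⊆ᵈ suc (suc Y)) ×ᵈ mapᵈ (∀ᵈ (∀ᵈ
       ((1F ∊ᵈ suc (suc X)) →ᵈ (0F ∊ᵈ suc (suc Y)) →ᵈ (edgeᵈ 0F 1F ⇔ᵈ ((0F ∊ᵈ 0F) ×ᵈ (1F ∊ᵈ 1F))))))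
       (λ _ _ _ → mk⇔ (λ f {x} {y} → f x y) (λ f x y → f {x} {y}))))

splits : DefinableBipartitions
splits = record { bip = IsSplit ; bipᵈ = isSplitᵈ }

splits-family : ∀ G → IsBipartitionFamily (IsSplit G)
splits-family G = record
  { bipartition = proj₁
  ; swap        = λ (b , (X₁ , Y₁ , X₁⊆ , Y₁⊆ , e₁) , (X₂ , Y₂ , X₂⊆ , Y₂⊆ , e₂)) → bipartition-swap b ,
      (Y₂ , X₂ , Y₂⊆ , X₂⊆ , λ y∈ x∈ → e₂ x∈ y∈) , (Y₁ , X₁ , Y₁⊆ , X₁⊆ , λ y∈ x∈ → e₁ x∈ y∈)
  ; trivial     = λ {x} {y} x≢y → bipartition-trivial x≢y ,
      (⁅ x ⁆ , ⟪ Out? x ⟫ , (λ x∈ → x∈) , (λ v∈ → proj₁ (to (∈⟪⟫ (Out? x)) v∈)) ,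
        λ {u} {v} u∈ v∈ → let u≡x = x∈⁅y⁆⇒x≡y x u∈ in mk⇔
          (λ e → u∈ , from (∈⟪⟫ (Out? x)) (v∈ , subst (λ u → Edge G u v) u≡x e))
          (λ (_ , v∈′) → subst (λ u → Edge G u v) (sym u≡x) (proj₂ (to (∈⟪⟫ (Out? x)) v∈′)))) ,
      (⁅ x ⁆ , ⟪ In? x ⟫ , (λ x∈ → x∈) , (λ v∈ → proj₁ (to (∈⟪⟫ (In? x)) v∈)) ,
        λ {u} {v} u∈ v∈ → let u≡x = x∈⁅y⁆⇒x≡y x u∈ in mk⇔
          (λ e → from (∈⟪⟫ (In? x)) (v∈ , subst (λ u → Edge G v u) u≡x e) , u∈)
          (λ (v∈′ , _) → subst (λ u → Edge G v u) (sym u≡x) (proj₂ (to (∈⟪⟫ (In? x)) v∈′))))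
  }
  where
  Out? : ∀ x v → Dec (v ∈ ∁ ⁅ x ⁆ × Edge G x v)
  Out? x v = (v ∈? ∁ ⁅ x ⁆) ×-dec T? (edge G x v)
  In? : ∀ x v → Dec (v ∈ ∁ ⁅ x ⁆ × Edge G v x)
  In? x v = (v ∈? ∁ ⁅ x ⁆) ×-dec T? (edge G v x)

module SplitSets (G : Graph) (R : Vertices G) where
  open TreeOf (NodeSet (IsSplit G) R) R public

  QuotientEdge : (Z X Y : Vertices G) → Set
  QuotientEdge Z X Y = Branching Z × Adjacent Z X × Adjacent Z Y × X ≢ Y ×
    ∃[ u ] ∃[ v ] (SideOf X Z u × SideOf Y Z v × Edge G u v)

open BipartitionDefinability splits using () renaming
  (nodeSetᵈ to splitNodeᵈ; adjacentᵈ to splitAdjacentᵈ; sideOfᵈ to splitSideᵈ; branchingᵈ to splitBranchingᵈ)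

quotientEdgeᵈ : ∀ {e s} (R Z X Y : Fin s) → Definable {e} {s} (λ G ρ σ →
  SplitSets.QuotientEdge G (lookup σ R) (lookup σ Z) (lookup σ X) (lookup σ Y))
quotientEdgeᵈ R Z X Y = splitBranchingᵈ R Z ×ᵈ splitAdjacentᵈ R Z X ×ᵈ splitAdjacentᵈ R Z Y ×ᵈ ¬ᵈ (X ≡ᵈ Y) ×ᵈ
  ∃ᵈ (∃ᵈ (splitSideᵈ R X Z 1F ×ᵈ splitSideᵈ R Y Z 0F ×ᵈ edgeᵈ 1F 0F))

splitSpec : Specification
splitSpec = record
  { syms        = symbols SplitVocabulary
  ; comp        = complete SplitVocabulary
  ; arities     = arity SplitVocabulary
  ; roles       = 0
  ; family      = BipartitionDefinability.rootedFamily splits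
  ; admissible  = IsRoot
  ; admissibleᵈ = isRootᵈ
  -- Discards the added singleton of the root unless it is a node set itself.
  ; keeps       = λ _ G → NodeSet (IsSplit G)
  ; keepsᵈ      = λ _ → splitNodeᵈ
  ; relates     = λ where
      edgeᵀˢ _ G R (X ∷ Y ∷ [])     → SplitSets.Adjacent G R X Y
      Fˢ     _ G R (Z ∷ X ∷ Y ∷ []) → SplitSets.QuotientEdge G R Z X Y
  ; relatesᵈ    = λ where
      edgeᵀˢ _ R (X ∷ Y ∷ [])     → splitAdjacentᵈ R X Y
      Fˢ     _ R (Z ∷ X ∷ Y ∷ []) → quotientEdgeᵈ R Z X Y
  }

-- The tree of strong bipartitions in terms of the vertex sets of its nodes

module SetsOfTree {n} {𝓑 : Family n} (isFamily : IsBipartitionFamily 𝓑) {R : Subset n} {r : Fin n}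
  (R≡r : ∀ x → x ∈ R ⇔ x ≡ r) (Node? : ∀ X → Dec (NodeSet 𝓑 R X))
  {m : ℕ} (node : Fin m → Subset n) (node-injective : Injective _≡_ _≡_ node)
  (valid : ∀ t → NodeSet 𝓑 R (node t)) (covers : ∀ {X} → NodeSet 𝓑 R X → ∃[ t ] node t ≡ X) where

  open StrongTree isFamily R≡r Node? node node-injective valid covers public
  open TreeOf (NodeSet 𝓑 R) R using (Adjacent; Branching; SideOf)
  open Rooted isFamily R≡r using (r∈R)

  side⇔ : ∀ {s t v} → Edge tree s t → Side s t v ⇔ SideOf (node s) (node t) v
  side⇔ {s} {t} {v} e = cases (to edge⇔ e)
    where
    cases : Up s t ⊎ Up t s → Side s t v ⇔ SideOf (node s) (node t) v
    cases (inj₁ c) = ⇔.trans (side-below c) (mk⇔ (λ v∈ → inj₁ (c , v∈))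
      [ proj₂ , (λ (c′ , _) → contradiction c′ (up-asymmetric c)) ]′)
    cases (inj₂ c) = ⇔.trans (side-above c) (mk⇔ (λ v∉ → inj₂ (c , v∉))
      [ (λ (c′ , _) → contradiction c′ (up-asymmetric c)) , proj₂ ]′)

  internal⇔ : ∀ {t} → Internal t ⇔ Branching (node t)
  internal⇔ {t} = mk⇔
    (λ i → big (λ l → internal⇒¬leaf i l) , λ x x∈R x∈ → avoid (internal⇒¬leaf i) (valid t) x x∈R x∈)
    (λ (b , av) → [ (λ l → contradiction b (leaf-small l av)) , ℕₚ.≤-trans (s≤s (s≤s z≤n)) ]′ (leaf-or-3≤ t))
    where
    avoid : ¬ (∃[ v ] leaf v ≡ t) → NodeSet 𝓑 R (node t) → ∀ x → x ∈ R → x ∉ node t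
    avoid ¬leaf (inj₁ all) = contradiction
      (r , node-injective (trans leaf-r (⊆-antisym (λ {x} _ → all x) (λ _ → ∈⊤)))) ¬leaf
    avoid _ (inj₂ (av , _)) = av
    big : ¬ (∃[ v ] leaf v ≡ t) → Big (node t)
    big ¬leaf = Dec.decidable-stable (Big? (node t)) λ ¬big →
      let x , x∈ = Rooted.node-inhabited isFamily R≡r (valid t)
      in ¬leaf (x , node-injective (trans (leaf-≢ (λ x≡r → avoid ¬leaf (valid t) r r∈R (subst (_∈ node t) x≡r x∈))) (sym (small ¬big x∈))))
    leaf-small : (∃[ v ] leaf v ≡ t) → (∀ x → x ∈ R → x ∉ node t) → ¬ Big (node t)
    leaf-small (v , refl) av b = ⁅⁆-small (subst Big (leaf-≢ (λ { refl → av r r∈R (∈leaf r) })) b)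

  ≢⇔ : ∀ {s t} → s ≢ t ⇔ node s ≢ node t
  ≢⇔ = mk⇔ (λ ne eq → ne (node-injective eq)) (λ ne eq → ne (cong node eq))

split-outputs : ∀ G → Outputs (TreeTransduction.τ splitSpec) ⌜ G ⌝ (IsSplitDecomposition G)
split-outputs G = TreeTransduction.outputs-good splitSpec G
  (λ { R (r , R≡r) → Rooted.rooted-laminar (splits-family G) R≡r (Node? R) })
  (λ { R (r , R≡r) → Rooted.rooted-singletons (splits-family G) R≡r })
  (someRoot G)
  good
  where
  Node? : ∀ R X → Dec (NodeSet (IsSplit G) R X)
  Node? R X = decide (splitNodeᵈ 0F 1F) G [] (R ∷ X ∷ [])
  good : ∀ 𝔹 → Specification.Realises splitSpec G 𝔹 → IsSplitDecomposition G 𝔹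
  good 𝔹 realises = record
    { splitTree   = strongTree
    ; isomorphism = mk↔ₛ′ id id (λ _ → refl) (λ _ → refl)
    ; rel-edge    = λ s t → ⇔.trans (rels edgeᵀˢ (s ∷ t ∷ [])) (⇔.sym edge⇔)
    ; rel-F       = λ t x y → ⇔.trans (rels Fˢ (t ∷ x ∷ y ∷ [])) (⇔.sym quotient⇔)
    }
    where
    open Specification.Realises realises
    set-covers : ∀ {X} → NodeSet (IsSplit G) root X → ∃[ t ] set-of t ≡ X
    set-covers p = let y , _ , eq = covers {0F} (inj₁ p) p in y , eq
    open SetsOfTree (splits-family G) (proj₂ root-ok) (Node? root)
      set-of (λ eq → unique (Fin1-unique _ _) eq) (λ t → proj₂ (valid t)) set-covers hiding (root)
    quotient⇔ : ∀ {t x y} →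
      (Internal t × Edge tree t x × Edge tree t y × x ≢ y × ∃[ u ] ∃[ v ] (Side x t u × Side y t v × Edge G u v)) ⇔
      SplitSets.QuotientEdge G root (set-of t) (set-of x) (set-of y)
    quotient⇔ {t} {x} {y} = mk⇔
      (λ (i , e , e′ , ne , u , v , p , q , uv) → to internal⇔ i , to edge⇔ e , to edge⇔ e′ , to (≢⇔ {x} {y}) ne ,
        u , v , to (side⇔ (undirected _ _ e)) p , to (side⇔ (undirected _ _ e′)) q , uv)
      (λ (i , e , e′ , ne , u , v , p , q , uv) → from internal⇔ i , from edge⇔ e , from edge⇔ e′ , from (≢⇔ {x} {y}) ne ,
        u , v , from (side⇔ (undirected _ _ (from edge⇔ e))) p , from (side⇔ (undirected _ _ (from edge⇔ e′))) q , uv)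

-- Bi-join decompositions

∉─ : ∀ {n} {x : Fin n} {p q} → x ∈ q → x ∉ p ─ q
∉─ {p = _ ∷ _} Vec.here        ()
∉─ {p = _ ∷ _} (Vec.there x∈q) (Vec.there x∈) = ∉─ x∈q x∈

-- For vertices of `X` and `Y` the set differences reduce to non-membership, which a formula states
-- directly.
Matches : (G : Graph) (X Y X′ Y′ : Vertices G) → Set
Matches G X Y X′ Y′ = X′ ⊆ X × Y′ ⊆ Y ×
  (∀ x y → x ∈ X → y ∈ Y → Edge G x y ⇔ ((x ∈ X′ × y ∈ Y′) ⊎ (x ∉ X′ × y ∉ Y′)))

halves⇔ : ∀ {G X Y X′ Y′} → BiJoinHalves G X Y X′ Y′ ⇔ Matches G X Y X′ Y′
halves⇔ {G} {X} {Y} {X′} {Y′} = mk⇔ there back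
  where
  outer : ∀ {x y} → x ∈ X → y ∈ Y →
          ((x ∈ X′ × y ∈ Y′) ⊎ (x ∈ X ─ X′ × y ∈ Y ─ Y′)) ⇔ ((x ∈ X′ × y ∈ Y′) ⊎ (x ∉ X′ × y ∉ Y′))
  outer x∈ y∈ = ⇔.refl ⊎-⇔ (mk⇔ (λ p q → ∉─ q p) (x∈p∧x∉q⇒x∈p─q x∈) ×-⇔ mk⇔ (λ p q → ∉─ q p) (x∈p∧x∉q⇒x∈p─q y∈))
  there : BiJoinHalves G X Y X′ Y′ → Matches G X Y X′ Y′
  there h = X′⊆X , Y′⊆Y , λ x y x∈ y∈ → ⇔.trans (edges x∈ y∈) (outer x∈ y∈)
    where open BiJoinHalves h
  back : Matches G X Y X′ Y′ → BiJoinHalves G X Y X′ Y′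
  back (X′⊆X , Y′⊆Y , e) = record
    { X′⊆X  = X′⊆X
    ; Y′⊆Y  = Y′⊆Y
    ; edges = λ x∈ y∈ → ⇔.trans (e _ _ x∈ y∈) (⇔.sym (outer x∈ y∈))
    }

isBiJoinᵈ : ∀ {e s} (X Y : Fin s) → Definable {e} {s} (λ G ρ σ → IsBiJoin G (lookup σ X) (lookup σ Y))
isBiJoinᵈ X Y = isBipartitionᵈ X Y ×ᵈ ∃ˢ (∃ˢ (mapᵈ
  ((1F ⊆ᵈ suc (suc X)) ×ᵈ (0F ⊆ᵈ suc (suc Y)) ×ᵈ ∀ᵈ (∀ᵈ ((1F ∊ᵈ suc (suc X)) →ᵈ (0F ∊ᵈ suc (suc Y)) →ᵈ
    (edgeᵈ 1F 0F ⇔ᵈ (((1F ∊ᵈ 1F) ×ᵈ (0F ∊ᵈ 0F)) ⊎ᵈ (¬ᵈ (1F ∊ᵈ 1F) ×ᵈ ¬ᵈ (0F ∊ᵈ 0F)))))))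
  (λ G _ _ → ⇔.sym (halves⇔ {G}))))

biJoins : DefinableBipartitions
biJoins = record { bip = IsBiJoin ; bipᵈ = isBiJoinᵈ }

matches-swap : ∀ {G X Y X′ Y′} → Undirected G → Matches G X Y X′ Y′ → Matches G Y X Y′ X′
matches-swap und (X′⊆X , Y′⊆Y , e) = Y′⊆Y , X′⊆X , λ y x y∈ x∈ →
  ⇔.trans (mk⇔ (und y x) (und x y)) (⇔.trans (e x y x∈ y∈) (mk⇔ swapped swapped))
  where
  swapped : ∀ {A B C D : Set} → (A × B) ⊎ (C × D) → (B × A) ⊎ (D × C)
  swapped (inj₁ (a , b)) = inj₁ (b , a)
  swapped (inj₂ (a , b)) = inj₂ (b , a)

halves-swap : ∀ {G X Y X′ Y′} → Undirected G → BiJoinHalves G X Y X′ Y′ → BiJoinHalves G Y X Y′ X′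
halves-swap {G} und h = from (halves⇔ {G}) (matches-swap {G} und (to halves⇔ h))

biJoins-family : ∀ G → Undirected G → IsBipartitionFamily (IsBiJoin G)
biJoins-family G und = record
  { bipartition = proj₁
  ; swap        = λ (b , X′ , Y′ , h) → bipartition-swap b , Y′ , X′ , halves-swap und h
  ; trivial     = λ {x} x≢y → bipartition-trivial x≢y , ⁅ x ⁆ , ⟪ Out? x ⟫ , from halves⇔
      ((λ x∈ → x∈) , (λ v∈ → proj₁ (to (∈⟪⟫ (Out? x)) v∈)) , λ u v u∈ v∈ → mk⇔
        (λ e → inj₁ (u∈ , from (∈⟪⟫ (Out? x)) (v∈ , subst (λ u → Edge G u v) (x∈⁅y⁆⇒x≡y x u∈) e)))
        [ (λ (_ , v∈′) → subst (λ u → Edge G u v) (sym (x∈⁅y⁆⇒x≡y x u∈)) (proj₂ (to (∈⟪⟫ (Out? x)) v∈′))) ,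
          (λ (u∉ , _) → contradiction u∈ u∉) ]′)
  }
  where
  Out? : ∀ x v → Dec (v ∈ ∁ ⁅ x ⁆ × Edge G x v)
  Out? x v = (v ∈? ∁ ⁅ x ⁆) ×-dec T? (edge G x v)

-- Tags: a node of the tree, or an auxiliary vertex (d , b) of the edge from
-- the given node to its parent, on the side of the child if d is true, and of
-- the class b.
Tag : Set
Tag = Data.Unit.⊤ ⊎ Bool × Bool

module BiJoinSets (G : Graph) (R : Vertices G) where
  open TreeOf (NodeSet (IsBiJoin G) R) R public

  -- The root r lies in the half of its side, which determines both halves.
  Half : (S T : Vertices G) → V G → Set
  Half S T v = ∃[ r ] (r ∈ R × ((Child S T × v ∈ S × Edge G v r) ⊎
    (Child T S × v ∉ T × (∀ x → x ∈ T → Edge G x v ⇔ Edge G x r))))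

  ClassOf : Bool → (S T : Vertices G) → V G → Set
  ClassOf true  S T v = Half S T v
  ClassOf false S T v = SideOf S T v × ¬ Half S T v

  -- Decodes an auxiliary vertex stored at the member `X`: its edge joins `X` and the parent, it
  -- lies on the side of `S`, and `T` is the opposite end.
  Ends : Bool → (X S T : Vertices G) → Set
  Ends true  X S T = S ≡ X × Child S T
  Ends false X S T = T ≡ X × Child T S

  LeafOf : V G → Vertices G → Set
  LeafOf v S = (v ∈ R × (∀ x → x ∈ S)) ⊎ (v ∉ R × (∀ x → x ∈ S ⇔ x ≡ v))

  LeafClass : Bool → (S T : Vertices G) → Set
  LeafClass b S T = ∃[ v ] (LeafOf v S × (∀ u → ClassOf b S T u ⇔ u ≡ v))

  Complete : Bool → Bool → (S S′ T : Vertices G) → Set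
  Complete b b′ S S′ T = ∃ (ClassOf b S T) × ∃ (ClassOf b′ S′ T) ×
    (∀ u v → ClassOf b S T u → ClassOf b′ S′ T v → Edge G u v)

  TreeEdgeᵗ Fᵗ Incidentᵗ : Tag → Tag → (X Y : Vertices G) → Set
  TreeEdgeᵗ (inj₁ _) (inj₁ _) X Y = Adjacent X Y
  TreeEdgeᵗ (inj₁ _) (inj₂ _) X Y = Data.Empty.⊥
  TreeEdgeᵗ (inj₂ _) _        X Y = Data.Empty.⊥
  Fᵗ (inj₁ _) (inj₁ _) X Y = Data.Empty.⊥
  Fᵗ (inj₁ _) (inj₂ (d , b)) X Y = ∃[ S ] ∃[ T ] (Ends d Y S T × X ≡ S × LeafClass b S T)
  Fᵗ (inj₂ (d , b)) (inj₁ _) X Y = ∃[ S ] ∃[ T ] (Ends d X S T × Y ≡ S × LeafClass b S T)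
  Fᵗ (inj₂ (d , b)) (inj₂ (d′ , b′)) X Y = (X ≡ Y × d′ ≡ not d × b ≡ b′) ⊎
    (∃[ S ] ∃[ S′ ] ∃[ T ] (Ends d X S T × Ends d′ Y S′ T × S ≢ S′ × Branching T × Complete b b′ S S′ T))
  Incidentᵗ (inj₁ _) _ X Y = Data.Empty.⊥
  Incidentᵗ (inj₂ _) (inj₂ _) X Y = Data.Empty.⊥
  Incidentᵗ (inj₂ (d , b)) (inj₁ _) X Y = ∃[ S ] ∃[ T ] (Ends d X S T × Y ≡ S)

  -- The whole set has no parent, so auxiliary vertices belong to strong sides only.
  Keep : Tag → Vertices G → Set
  Keep (inj₁ _) X = NodeSet (IsBiJoin G) R X
  Keep (inj₂ _) X = StrongSide (IsBiJoin G) R X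

module BiJoinDefinability where
  open BipartitionDefinability biJoins

  module _ {e s : ℕ} where
    abstract

      halfᵈ : (R S T : Fin s) (v : Fin e) → Definable (λ G ρ σ →
        BiJoinSets.Half G (lookup σ R) (lookup σ S) (lookup σ T) (lookup ρ v))
      halfᵈ R S T v = ∃ᵈ ((0F ∊ᵈ R) ×ᵈ ((nodeChildᵈ R S T ×ᵈ (suc v ∊ᵈ S) ×ᵈ edgeᵈ (suc v) 0F) ⊎ᵈ
        (nodeChildᵈ R T S ×ᵈ ¬ᵈ (suc v ∊ᵈ T) ×ᵈ ∀ᵈ ((0F ∊ᵈ T) →ᵈ (edgeᵈ 0F (suc (suc v)) ⇔ᵈ edgeᵈ 0F 1F)))))

      endsᵈ : ∀ d (R X S T : Fin s) → Definable {e} (λ G ρ σ →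
        BiJoinSets.Ends G (lookup σ R) d (lookup σ X) (lookup σ S) (lookup σ T))
      endsᵈ true  R X S T = (S ≡ᵈ X) ×ᵈ nodeChildᵈ R S T
      endsᵈ false R X S T = (T ≡ᵈ X) ×ᵈ nodeChildᵈ R T S

      leafOfᵈ : (R : Fin s) (v : Fin e) (S : Fin s) → Definable (λ G ρ σ →
        BiJoinSets.LeafOf G (lookup σ R) (lookup ρ v) (lookup σ S))
      leafOfᵈ R v S = ((v ∊ᵈ R) ×ᵈ ∀ᵈ (0F ∊ᵈ S)) ⊎ᵈ (¬ᵈ (v ∊ᵈ R) ×ᵈ ∀ᵈ ((0F ∊ᵈ S) ⇔ᵈ (0F ≐ᵈ suc v)))

  module _ {e s : ℕ} where
    abstract

      classᵈ : ∀ b (R S T : Fin s) (v : Fin e) → Definable (λ G ρ σ →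
        BiJoinSets.ClassOf G (lookup σ R) b (lookup σ S) (lookup σ T) (lookup ρ v))
      classᵈ true  R S T v = halfᵈ R S T v
      classᵈ false R S T v = sideOfᵈ R S T v ×ᵈ ¬ᵈ halfᵈ R S T v

  module _ {e s : ℕ} where
    abstract

      leafClassᵈ : ∀ b (R S T : Fin s) → Definable {e} (λ G ρ σ →
        BiJoinSets.LeafClass G (lookup σ R) b (lookup σ S) (lookup σ T))
      leafClassᵈ b R S T = ∃ᵈ (leafOfᵈ R 0F S ×ᵈ ∀ᵈ (classᵈ b R S T 0F ⇔ᵈ (0F ≐ᵈ 1F)))

      completeᵈ : ∀ b b′ (R S S′ T : Fin s) → Definable {e} (λ G ρ σ →
        BiJoinSets.Complete G (lookup σ R) b b′ (lookup σ S) (lookup σ S′) (lookup σ T))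
      completeᵈ b b′ R S S′ T = ∃ᵈ (classᵈ b R S T 0F) ×ᵈ ∃ᵈ (classᵈ b′ R S′ T 0F) ×ᵈ
        ∀ᵈ (∀ᵈ (classᵈ b R S T 1F →ᵈ classᵈ b′ R S′ T 0F →ᵈ edgeᵈ 1F 0F))

  module _ {e s : ℕ} where
    abstract

      treeEdgeᵗᵈ : ∀ g h (R X Y : Fin s) → Definable {e} (λ G ρ σ →
        BiJoinSets.TreeEdgeᵗ G (lookup σ R) g h (lookup σ X) (lookup σ Y))
      treeEdgeᵗᵈ (inj₁ _) (inj₁ _) R X Y = adjacentᵈ R X Y
      treeEdgeᵗᵈ (inj₁ _) (inj₂ _) R X Y = constᵈ (no id)
      treeEdgeᵗᵈ (inj₂ _) _        R X Y = constᵈ (no id)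

      Fᵗᵈ : ∀ g h (R X Y : Fin s) → Definable {e} (λ G ρ σ →
        BiJoinSets.Fᵗ G (lookup σ R) g h (lookup σ X) (lookup σ Y))
      Fᵗᵈ (inj₁ _) (inj₁ _) R X Y = constᵈ (no id)
      Fᵗᵈ (inj₁ _) (inj₂ (d , b)) R X Y = ∃ˢ (∃ˢ (endsᵈ d (suc (suc R)) (suc (suc Y)) 1F 0F ×ᵈ
        (suc (suc X) ≡ᵈ 1F) ×ᵈ leafClassᵈ b (suc (suc R)) 1F 0F))
      Fᵗᵈ (inj₂ (d , b)) (inj₁ _) R X Y = ∃ˢ (∃ˢ (endsᵈ d (suc (suc R)) (suc (suc X)) 1F 0F ×ᵈ
        (suc (suc Y) ≡ᵈ 1F) ×ᵈ leafClassᵈ b (suc (suc R)) 1F 0F))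
      Fᵗᵈ (inj₂ (d , b)) (inj₂ (d′ , b′)) R X Y =
        ((X ≡ᵈ Y) ×ᵈ constᵈ (d′ ≟ᵇ not d) ×ᵈ constᵈ (b ≟ᵇ b′)) ⊎ᵈ
        ∃ˢ (∃ˢ (∃ˢ (endsᵈ d (suc (suc (suc R))) (suc (suc (suc X))) 2F 0F ×ᵈ
          endsᵈ d′ (suc (suc (suc R))) (suc (suc (suc Y))) 1F 0F ×ᵈ ¬ᵈ (2F ≡ᵈ 1F) ×ᵈ
          branchingᵈ (suc (suc (suc R))) 0F ×ᵈ completeᵈ b b′ (suc (suc (suc R))) 2F 1F 0F)))

      incidentᵗᵈ : ∀ g h (R X Y : Fin s) → Definable {e} (λ G ρ σ →
        BiJoinSets.Incidentᵗ G (lookup σ R) g h (lookup σ X) (lookup σ Y))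
      incidentᵗᵈ (inj₁ _) _ R X Y = constᵈ (no id)
      incidentᵗᵈ (inj₂ _) (inj₂ _) R X Y = constᵈ (no id)
      incidentᵗᵈ (inj₂ (d , b)) (inj₁ _) R X Y = ∃ˢ (∃ˢ (endsᵈ d (suc (suc R)) (suc (suc X)) 1F 0F ×ᵈ
        (suc (suc Y) ≡ᵈ 1F)))

      keepᵈ : ∀ g (R X : Fin s) → Definable {e} (λ G ρ σ → BiJoinSets.Keep G (lookup σ R) g (lookup σ X))
      keepᵈ (inj₁ _) R X = nodeSetᵈ R X
      keepᵈ (inj₂ _) R X = strongSideᵈ R X

open BiJoinDefinability

biJoinSpec : Specification
biJoinSpec = record
  { syms        = symbols BiJoinVocabulary
  ; comp        = complete BiJoinVocabulary
  ; arities     = arity BiJoinVocabulary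
  -- Index 0 is the node; the four further roles are the auxiliary vertices of its edge to the
  -- parent, decoded by `bits`.
  ; roles       = 4
  ; family      = BipartitionDefinability.rootedFamily biJoins
  ; admissible  = IsRoot
  ; admissibleᵈ = isRootᵈ
  ; keeps       = λ i G R → BiJoinSets.Keep G R (bits i)
  ; keepsᵈ      = λ i → keepᵈ (bits i)
  ; relates     = λ where
      edgeᵀˢ     (i ∷ j ∷ []) G R (X ∷ Y ∷ []) → BiJoinSets.TreeEdgeᵗ G R (bits i) (bits j) X Y
      Fˢ         (i ∷ j ∷ []) G R (X ∷ Y ∷ []) → BiJoinSets.Fᵗ G R (bits i) (bits j) X Y
      incidenceˢ (i ∷ j ∷ []) G R (X ∷ Y ∷ []) → BiJoinSets.Incidentᵗ G R (bits i) (bits j) X Y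
  ; relatesᵈ    = λ where
      edgeᵀˢ     (i ∷ j ∷ []) R (X ∷ Y ∷ []) → treeEdgeᵗᵈ (bits i) (bits j) R X Y
      Fˢ         (i ∷ j ∷ []) R (X ∷ Y ∷ []) → Fᵗᵈ (bits i) (bits j) R X Y
      incidenceˢ (i ∷ j ∷ []) R (X ∷ Y ∷ []) → incidentᵗᵈ (bits i) (bits j) R X Y
  }

module BiJoinTree (G : Graph) (und : Undirected G) {R : Vertices G} {r : V G} (R≡r : ∀ x → x ∈ R ⇔ x ≡ r)
  (Node? : ∀ X → Dec (NodeSet (IsBiJoin G) R X))
  {m : ℕ} (node : Fin m → Vertices G) (set-injective : Injective _≡_ _≡_ node)
  (valid : ∀ t → NodeSet (IsBiJoin G) R (node t)) (covers : ∀ {X} → NodeSet (IsBiJoin G) R X → ∃[ t ] node t ≡ X) where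

  open SetsOfTree (biJoins-family G und) R≡r Node? node set-injective valid covers
  open Rooted (biJoins-family G und) R≡r using (r∈R; node-inhabited)
  open BiJoinSets G R hiding (Child)

  abstract
    Half? : ∀ S T v → Dec (Half S T v)
    Half? S T v = decide (halfᵈ 0F 1F 2F 0F) G (v ∷ []) (R ∷ S ∷ T ∷ [])

  half : (s t : Fin m) → Vertices G
  half s t = ⟪ Half? (node s) (node t) ⟫

  half-below : ∀ {s t v} → Up s t → v ∈ half s t ⇔ (v ∈ node s × Edge G v r)
  half-below {s} {t} c = ⇔.trans (∈⟪⟫ (Half? (node s) (node t))) (mk⇔
    (λ { (ρ , ρ∈ , inj₁ (_ , v∈ , e)) → v∈ , subst (Edge G _) (to (R≡r ρ) ρ∈) e
       ; (_ , _ , inj₂ (c′ , _)) → contradiction c′ (up-asymmetric c) })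
    (λ (v∈ , e) → r , r∈R , inj₁ (c , v∈ , e)))

  half-above : ∀ {s t v} → Up s t → v ∈ half t s ⇔ (v ∉ node s × (∀ x → x ∈ node s → Edge G x v ⇔ Edge G x r))
  half-above {s} {t} {v} c = ⇔.trans (∈⟪⟫ (Half? (node t) (node s))) (mk⇔
    (λ { (_ , _ , inj₁ (c′ , _)) → contradiction c′ (up-asymmetric c)
       ; (ρ , ρ∈ , inj₂ (_ , v∉ , e)) → v∉ ,
           λ x x∈ → subst (λ ρ → Edge G x v ⇔ Edge G x ρ) (to (R≡r ρ) ρ∈) (e x x∈) })
    (λ (v∉ , e) → r , r∈R , inj₂ (c , v∉ , e)))

  -- Across a bi-join, vertices outside `node s` have one of two complementary neighbourhoods
  -- inside, according to the class `B`; so `y` has that of `r` or its complement.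
  agree-or-disagree : ∀ {s t} → Up s t → ∀ y → y ∉ node s →
    (∀ x → x ∈ node s → Edge G x y ⇔ Edge G x r) ⊎ (∀ x → x ∈ node s → Edge G x y ⇔ (¬ Edge G x r))
  agree-or-disagree {s} c y y∉ with _ , Y , (b , A , B , h) , _ ← avoids c
    with _ , _ , e ← to halves⇔ h = compare (y ∈? B) (r ∈? B)
    where
    y∈Y : y ∈ Y
    y∈Y = from (complementary b y) y∉
    r∈Y : r ∈ Y
    r∈Y = from (complementary b r) (r∉ c)
    inside′ : ∀ {x v} → x ∈ node s → v ∈ Y → v ∈ B → Edge G x v ⇔ x ∈ A
    inside′ x∈ v∈Y v∈B = ⇔.trans (e _ _ x∈ v∈Y)
      (mk⇔ [ proj₁ , (λ (_ , v∉B) → contradiction v∈B v∉B) ]′ (λ x∈A → inj₁ (x∈A , v∈B)))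
    outside′ : ∀ {x v} → x ∈ node s → v ∈ Y → v ∉ B → Edge G x v ⇔ x ∉ A
    outside′ x∈ v∈Y v∉B = ⇔.trans (e _ _ x∈ v∈Y)
      (mk⇔ [ (λ (_ , v∈B) → contradiction v∈B v∉B) , proj₁ ]′ (λ x∉A → inj₂ (x∉A , v∉B)))
    not⇔ : ∀ {P Q : Set} → P ⇔ Q → (¬ P) ⇔ (¬ Q)
    not⇔ f = mk⇔ (_∘ from f) (_∘ to f)
    compare : Dec (y ∈ B) → Dec (r ∈ B) →
      (∀ x → x ∈ node s → Edge G x y ⇔ Edge G x r) ⊎ (∀ x → x ∈ node s → Edge G x y ⇔ (¬ Edge G x r))
    compare (yes p) (yes q) = inj₁ λ x x∈ → ⇔.trans (inside′ x∈ y∈Y p) (⇔.sym (inside′ x∈ r∈Y q))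
    compare (no p)  (no q)  = inj₁ λ x x∈ → ⇔.trans (outside′ x∈ y∈Y p) (⇔.sym (outside′ x∈ r∈Y q))
    compare (no p)  (yes q) = inj₂ λ x x∈ → ⇔.trans (outside′ x∈ y∈Y p) (not⇔ (⇔.sym (inside′ x∈ r∈Y q)))
    compare (yes p) (no q)  = inj₂ λ x x∈ → ⇔.trans (inside′ x∈ y∈Y p) (⇔.trans
      (mk⇔ (λ a ¬a → ¬a a) (Dec.decidable-stable (x ∈? A))) (not⇔ (⇔.sym (outside′ x∈ r∈Y q))))

  -- `x` and `y` are adjacent exactly if "`x` is adjacent to `r`" and "`y` agrees with `r` on
  -- `node s`" are both true or both false.
  halves-up : ∀ {s t X Y} → Up s t → Displays s t X Y → BiJoinHalves G X Y (half s t) (half t s)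
  halves-up {s} {t} {X} {Y} c d = from halves⇔
    ((λ v∈ → from (X⇔ _) (proj₁ (to (half-below c) v∈))) ,
     (λ v∈ → from (Y⇔ _) (proj₁ (to (half-above c) v∈))) ,
     λ x y x∈X y∈Y → mk⇔ (there (to (X⇔ x) x∈X) (to (Y⇔ y) y∈Y)) (back (to (X⇔ x) x∈X) (to (Y⇔ y) y∈Y)))
    where
    X⇔ : ∀ v → v ∈ X ⇔ v ∈ node s
    X⇔ v = ⇔.trans (proj₁ (d v)) (side-below c)
    Y⇔ : ∀ v → v ∈ Y ⇔ v ∉ node s
    Y⇔ v = ⇔.trans (proj₂ (d v)) (side-above c)
    there : ∀ {x y} → x ∈ node s → y ∉ node s → Edge G x y →
            (x ∈ half s t × y ∈ half t s) ⊎ (x ∉ half s t × y ∉ half t s)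
    there {x} {y} x∈ y∉ e with agree-or-disagree c y y∉
    ... | inj₁ f = inj₁ (from (half-below c) (x∈ , to (f x x∈) e) , from (half-above c) (y∉ , f))
    ... | inj₂ f = inj₂ ((λ x∈h → to (f x x∈) e (proj₂ (to (half-below c) x∈h))) ,
                         (λ y∈h → to (f x x∈) e (to (proj₂ (to (half-above c) y∈h) x x∈) e)))
    back : ∀ {x y} → x ∈ node s → y ∉ node s →
           (x ∈ half s t × y ∈ half t s) ⊎ (x ∉ half s t × y ∉ half t s) → Edge G x y
    back {x} x∈ y∉ (inj₁ (x∈h , y∈h)) = from (proj₂ (to (half-above c) y∈h) x x∈) (proj₂ (to (half-below c) x∈h))
    back {x} {y} x∈ y∉ (inj₂ (x∉h , y∉h)) with agree-or-disagree c y y∉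
    ... | inj₁ f = contradiction (from (half-above c) (y∉ , f)) y∉h
    ... | inj₂ f = from (f x x∈) (λ e → x∉h (from (half-below c) (x∈ , e)))

  decomposition : BiJoinDecomposition G
  decomposition = record
    { biJoinTree = strongTree
    ; half       = half
    ; halves     = λ e d → [ (λ c → halves-up c d) ,
        (λ c → halves-swap und (halves-up c (λ v → proj₂ (d v) , proj₁ (d v)))) ]′ (to edge⇔ e)
    }

  module D = BiJoinDecomposition decomposition

  class⇔ : ∀ {s t v} b → Edge tree s t → D.Class s t b v ⇔ ClassOf b (node s) (node t) v
  class⇔ true  e = ∈⟪⟫ (Half? _ _)
  class⇔ false e = side⇔ e ×-⇔ (let f = ∈⟪⟫ (Half? _ _) in mk⇔ (_∘ from f) (_∘ to f))

  leafOf⇔ : ∀ {v s} → LeafOf v (node s) ⇔ leaf v ≡ s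
  leafOf⇔ {v} {s} = mk⇔ there λ { refl → here′ }
    where
    there : LeafOf v (node s) → leaf v ≡ s
    there (inj₁ (v∈R , all)) with refl ← to (R≡r v) v∈R =
      set-injective (trans leaf-r (⊆-antisym (λ {x} _ → all x) (λ _ → ∈⊤)))
    there (inj₂ (v∉R , f)) = set-injective (trans (leaf-≢ (λ { refl → v∉R r∈R }))
      (⊆-antisym (⁅⁆⊆ (from (f v) refl)) (λ {x} x∈ → subst (_∈ ⁅ v ⁆) (sym (to (f x) x∈)) (x∈⁅x⁆ v))))
    here′ : LeafOf v (node (leaf v))
    here′ with v ≟ᶠ r
    ... | yes refl = inj₁ (r∈R , λ x → subst (x ∈_) (sym leaf-r) ∈⊤)
    ... | no v≢r   = inj₂ ((λ v∈R → v≢r (to (R≡r v) v∈R)) , λ x → subst (λ X → x ∈ X ⇔ x ≡ v) (sym (leaf-≢ v≢r))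
                       (mk⇔ (x∈⁅y⁆⇒x≡y v) λ { refl → x∈⁅x⁆ v }))

  ends-unique : ∀ {X S T S′ T′} d → Ends d X S T → Ends d X S′ T′ → S ≡ S′ × T ≡ T′
  ends-unique true  (refl , c) (refl , c′) = refl , Laminar.parent-unique (Rooted.node-laminar (biJoins-family G und) R≡r Node?) c c′
  ends-unique false (refl , c) (refl , c′) = Laminar.parent-unique (Rooted.node-laminar (biJoins-family G und) R≡r Node?) c c′ , refl

  ends-same : ∀ {s t s′ t′ X} d → Ends d X (node s) (node t) → Ends d X (node s′) (node t′) → s ≡ s′ × t ≡ t′
  ends-same d p q = let eq , eq′ = ends-unique d p q in set-injective eq , set-injective eq′

  ends-flip : ∀ {X S T} d → Ends d X S T → Ends (not d) X T S
  ends-flip true  p = p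
  ends-flip false p = p

  ends-direction : ∀ {X Y s t} d d′ → Ends d X (node s) (node t) → Ends d′ Y (node s) (node t) → d ≡ d′ × X ≡ Y
  ends-direction true  true  (refl , _) (refl , _) = refl , refl
  ends-direction false false (refl , _) (refl , _) = refl , refl
  ends-direction true  false (_ , c) (_ , c′) = contradiction c′ (up-asymmetric c)
  ends-direction false true  (_ , c) (_ , c′) = contradiction c′ (up-asymmetric c)

  -- A relation instead of a function, so that the three relations of the output are compared by
  -- cases on how a vertex arises.
  data Codes : Tag → Vertices G → D.Vertex → Set where
    nodeᶜ : ∀ t → Codes (inj₁ _) (node t) (D.node t)
    auxᶜ  : ∀ {s t X} (p : Edge tree s t) d b → Ends d X (node s) (node t) → Codes (inj₂ (d , b)) X (D.aux s t p b)

  codes-unique : ∀ {g h X Y x} → Codes g X x → Codes h Y x → g ≡ h × X ≡ Y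
  codes-unique (nodeᶜ t) (nodeᶜ .t) = refl , refl
  codes-unique (auxᶜ p d b q) (auxᶜ .p d′ .b q′) with ends-direction d d′ q q′
  ... | refl , refl = refl , refl

  codes-functional : ∀ {g X Y x y} → X ≡ Y → Codes g X x → Codes g Y y → x ≡ y
  codes-functional eq (nodeᶜ t) (nodeᶜ t′) = cong D.node (set-injective eq)
  codes-functional refl (auxᶜ p d b q) (auxᶜ p′ .d .b q′) with ends-same d q q′
  -- Auxiliary vertices carry a proof of their edge, and such proofs are unique.
  ... | refl , refl = cong (λ p → D.aux _ _ p b) (T-irrelevant p p′)

  coded : ∀ g {X} → Keep g X → ∃ (Codes g X)
  coded (inj₁ _) p with t , refl ← covers p = D.node t , nodeᶜ t
  coded (inj₂ (d , b)) {X} p@(avoid , _) with s , refl ← covers (inj₂ p)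
    with t , c ← up {s} (λ eq → avoid r r∈R (subst (r ∈_) (sym eq) ∈⊤)) = vertex d
    where
    vertex : ∀ d → ∃ (Codes (inj₂ (d , b)) (node s))
    vertex true  = _ , auxᶜ (from edge⇔ (inj₁ c)) true b (refl , c)
    vertex false = _ , auxᶜ (from edge⇔ (inj₂ c)) false b (refl , c)

  code : ∀ x → ∃[ g ] ∃[ X ] (Keep g X × Codes g X x)
  code (D.node t) = _ , _ , valid t , nodeᶜ t
  code (D.aux s t p b) with to edge⇔ p
  ... | inj₁ c = _ , _ , avoids c , auxᶜ p true b (refl , c)
  ... | inj₂ c = _ , _ , avoids c , auxᶜ p false b (refl , c)

  treeEdge⇔ : ∀ {g h X Y x y} → Codes g X x → Codes h Y y → D.TreeEdge x y ⇔ TreeEdgeᵗ g h X Y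
  treeEdge⇔ (nodeᶜ s) (nodeᶜ t) = mk⇔ (λ { (D.treeEdge e) → to edge⇔ e }) (λ a → D.treeEdge (from edge⇔ a))
  treeEdge⇔ (nodeᶜ _) (auxᶜ _ _ _ _) = mk⇔ (λ ()) (λ ())
  treeEdge⇔ (auxᶜ _ _ _ _) _ = mk⇔ (λ ()) (λ ())

  incident⇔ : ∀ {g h X Y x y} → Codes g X x → Codes h Y y → D.Incident x y ⇔ Incidentᵗ g h X Y
  incident⇔ (nodeᶜ _) _ = mk⇔ (λ ()) (λ ())
  incident⇔ (auxᶜ _ _ _ _) (auxᶜ _ _ _ _) = mk⇔ (λ ()) (λ ())
  incident⇔ {Y = Y} (auxᶜ {s} {t} p d b q) (nodeᶜ u) = mk⇔ (λ { (D.incident _ _) → node s , node t , q , refl }) back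
    where
    back : ∃[ S ] ∃[ T ] (Ends d _ S T × node u ≡ S) → D.Incident (D.aux s t p b) (D.node u)
    back (S , T , q′ , eq) with refl ← set-injective {u} {s} (trans eq (proj₁ (ends-unique d q′ q))) = D.incident p b

  leafClass⇔ : ∀ {s t} b → Edge tree s t →
    LeafClass b (node s) (node t) ⇔ (∃[ v ] (leaf v ≡ s × (∀ u → D.Class s t b u ⇔ u ≡ v)))
  leafClass⇔ b e = mk⇔
    (λ (v , l , f) → v , to leafOf⇔ l , λ u → ⇔.trans (class⇔ b e) (f u))
    (λ (v , l , f) → v , from leafOf⇔ l , λ u → ⇔.trans (⇔.sym (class⇔ b e)) (f u))

  F⇔ : ∀ {g h X Y x y} → Codes g X x → Codes h Y y → D.F x y ⇔ Fᵗ g h X Y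
  F⇔ (nodeᶜ _) (nodeᶜ _) = mk⇔ (λ ()) (λ ())
  F⇔ (nodeᶜ u) (auxᶜ {s} {t} p d b q) = mk⇔
    (λ { (D.at-leaf {v} .p .b f) → node s , node t , q , refl , from (leafClass⇔ b p) (v , refl , f) }) back
    where
    back : ∃[ S ] ∃[ T ] (Ends d _ S T × node u ≡ S × LeafClass b S T) → D.F (D.node u) (D.aux s t p b)
    back (S , T , q′ , eq , l) with ends-unique d q′ q
    ... | refl , refl with refl ← set-injective {u} {s} eq | to (leafClass⇔ b p) l
    ...   | v , refl , f = D.at-leaf p b f
  F⇔ (auxᶜ {s} {t} p d b q) (nodeᶜ u) = mk⇔
    (λ { (D.leaf-at {v} .p .b f) → node s , node t , q , refl , from (leafClass⇔ b p) (v , refl , f) }) back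
    where
    back : ∃[ S ] ∃[ T ] (Ends d _ S T × node u ≡ S × LeafClass b S T) → D.F (D.aux s t p b) (D.node u)
    back (S , T , q′ , eq , l) with ends-unique d q′ q
    ... | refl , refl with refl ← set-injective {u} {s} eq | to (leafClass⇔ b p) l
    ...   | v , refl , f = D.leaf-at p b f
  F⇔ {X = X} {Y} (auxᶜ {s} {t} p d b q) (auxᶜ {s′} {t′} p′ d′ b′ q′) = mk⇔ there back
    where
    there : D.F (D.aux s t p b) (D.aux s′ t′ p′ b′) → Fᵗ (inj₂ (d , b)) (inj₂ (d′ , b′)) X Y
    there (D.across _ _ _) = let eq , eq′ = ends-direction (not d) d′ (ends-flip d q) q′ in
      inj₁ (eq′ , sym eq , refl)
    there (D.around _ _ _ _ i ne (u , cu) (v , cv) f) = inj₂ (node s , node s′ , node t , q , q′ ,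
      to (≢⇔ {s} {s′}) ne , to internal⇔ i , (u , to (class⇔ b p) cu) , (v , to (class⇔ b′ p′) cv) ,
      λ u v cu cv → f (from (class⇔ b p) cu) (from (class⇔ b′ p′) cv))
    back : Fᵗ (inj₂ (d , b)) (inj₂ (d′ , b′)) X Y → D.F (D.aux s t p b) (D.aux s′ t′ p′ b′)
    back (inj₁ (refl , refl , refl)) with ends-same (not d) (ends-flip d q) q′
    ... | refl , refl = D.across p p′ b
    back (inj₂ (S , S′ , T , w , w′ , ne , br , (u , cu) , (v , cv) , f))
      with refl , refl ← ends-unique d w q with eq , eq′ ← ends-unique d′ w′ q′
      with refl ← eq with refl ← set-injective {t} {t′} eq′ =
      D.around p p′ b b′ (from internal⇔ br) (from (≢⇔ {s} {s′}) ne)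
        (u , from (class⇔ b p) cu) (v , from (class⇔ b′ p′) cv)
        (λ {u} {v} cu cv → f u v (to (class⇔ b p) cu) (to (class⇔ b′ p′) cv))

-- The universe mixes nodes with auxiliary vertices, while the tree is a graph on the nodes alone;
-- these are first enumerated by an index set of their own.
module BiJoinOutput (G : Graph) (und : Undirected G) {R : Vertices G} {r : V G} (R≡r : ∀ x → x ∈ R ⇔ x ≡ r)
  (Node? : ∀ X → Dec (NodeSet (IsBiJoin G) R X))
  {u : ℕ} (tag : Fin u → Tag) (set-of : Fin u → Vertices G)
  (unique : ∀ {y z} → tag y ≡ tag z → set-of y ≡ set-of z → y ≡ z)
  (valid : ∀ y → BiJoinSets.Keep G R (tag y) (set-of y))
  (covers : ∀ g {X} → BiJoinSets.Keep G R g X → ∃[ y ] tag y ≡ g × set-of y ≡ X) where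

  open BiJoinSets G R using (Keep)

  IsNode : Tag → Set
  IsNode g = g ≡ inj₁ _

  isNode? : ∀ g → Dec (IsNode g)
  isNode? (inj₁ _) = yes refl
  isNode? (inj₂ _) = no λ ()

  abstract
    nodes : ∃[ m ] Σ[ ι ∈ (Fin m → Fin u) ]
            Injective _≡_ _≡_ ι × (∀ y → IsNode (tag y) ⇔ (∃[ t ] ι t ≡ y))
    nodes = enumerate (λ y → isNode? (tag y))

  m : ℕ
  m = proj₁ nodes

  ι : Fin m → Fin u
  ι = proj₁ (proj₂ nodes)

  ι-tag : ∀ t → tag (ι t) ≡ inj₁ _
  ι-tag t = from (proj₂ (proj₂ (proj₂ nodes)) (ι t)) (t , refl)

  node : Fin m → Vertices G
  node t = set-of (ι t)

  node-injective : Injective _≡_ _≡_ node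
  node-injective {s} {t} eq = proj₁ (proj₂ (proj₂ nodes)) (unique (trans (ι-tag s) (sym (ι-tag t))) eq)

  node-valid : ∀ t → NodeSet (IsBiJoin G) R (node t)
  node-valid t = subst (λ g → Keep g (node t)) (ι-tag t) (valid (ι t))

  node-covers : ∀ {X} → NodeSet (IsBiJoin G) R X → ∃[ t ] node t ≡ X
  node-covers p =
    let y , eq , eq′ = covers (inj₁ _) p
        t , eq″ = to (proj₂ (proj₂ (proj₂ nodes)) y) eq
    in t , trans (cong set-of eq″) eq′

  open BiJoinTree G und R≡r Node? node node-injective node-valid node-covers public
    using (module D; decomposition; Codes; coded; code; codes-functional; codes-unique; treeEdge⇔; F⇔; incident⇔)

  toVertex : Fin u → D.Vertex
  toVertex y = proj₁ (coded (tag y) (valid y))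

  codes : ∀ y → Codes (tag y) (set-of y) (toVertex y)
  codes y = proj₂ (coded (tag y) (valid y))

  preimage : ∀ x → ∃[ y ] toVertex y ≡ x
  preimage x =
    let g , X , keep , c = code x
        y , eq , eq′ = covers g keep
    in y , codes-functional eq′ (subst (λ g → Codes g (set-of y) (toVertex y)) eq (codes y)) c

  isomorphism : Fin u ↔ D.Vertex
  isomorphism = mk↔ₛ′ toVertex (λ x → proj₁ (preimage x)) (λ x → proj₂ (preimage x)) λ y →
    let x = toVertex y
        y′ , eq = preimage x
        eq₁ , eq₂ = codes-unique (subst (Codes (tag y′) (set-of y′)) eq (codes y′)) (codes y)
    in unique eq₁ eq₂

biJoin-outputs : ∀ G → Undirected G → Outputs (TreeTransduction.τ biJoinSpec) ⌜ G ⌝ (IsBiJoinDecomposition G)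
biJoin-outputs G und = TreeTransduction.outputs-good biJoinSpec G
  (λ { R (r , R≡r) → Rooted.rooted-laminar (biJoins-family G und) R≡r (Node? R) })
  (λ { R (r , R≡r) → Rooted.rooted-singletons (biJoins-family G und) R≡r })
  (someRoot G)
  good
  where
  Node? : ∀ R X → Dec (NodeSet (IsBiJoin G) R X)
  Node? R X = decide (BipartitionDefinability.nodeSetᵈ biJoins 0F 1F) G [] (R ∷ X ∷ [])
  good : ∀ 𝔹 → Specification.Realises biJoinSpec G 𝔹 → IsBiJoinDecomposition G 𝔹
  good 𝔹 realises = record
    { decomposition = decomposition
    ; isomorphism   = isomorphism
    ; rel-edge      = λ x y → ⇔.trans (rels edgeᵀˢ (x ∷ y ∷ [])) (⇔.sym (treeEdge⇔ (codes x) (codes y)))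
    ; rel-F         = λ x y → ⇔.trans (rels Fˢ (x ∷ y ∷ [])) (⇔.sym (F⇔ (codes x) (codes y)))
    ; rel-incidence = λ x y → ⇔.trans (rels incidenceˢ (x ∷ y ∷ [])) (⇔.sym (incident⇔ (codes x) (codes y)))
    }
    where
    open Specification.Realises realises
    bits-injective : ∀ {i j} → bits i ≡ bits j → i ≡ j
    bits-injective {i} {j} eq = trans (sym (kind-bits i)) (trans (cong kind eq) (kind-bits j))
    keep⇒member : ∀ g {X} → BiJoinSets.Keep G root g X → RootedFamily (IsBiJoin G) root X
    keep⇒member (inj₁ _) p = inj₁ p
    keep⇒member (inj₂ _) p = inj₁ (inj₂ p)
    covers′ : ∀ g {X} → BiJoinSets.Keep G root g X → ∃[ y ] bits (role y) ≡ g × set-of y ≡ X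
    covers′ g {X} keep =
      let y , eq , eq′ = covers {kind g} (keep⇒member g keep)
            (subst (λ g → BiJoinSets.Keep G root g X) (sym (bits-kind g)) keep)
      in y , trans (cong bits eq) (bits-kind g) , eq′
    open BiJoinOutput G und (proj₂ root-ok) (Node? root) (λ y → bits (role y)) set-of
      (λ {y} {z} eq → unique (bits-injective {role y} {role z} eq)) (λ y → proj₂ (valid y)) covers′

-- The four transductions

corollary7 : (Σ[ τ₁ ∈ MSOTransduction GraphVocabulary ModularVocabulary ]
    (∀ (G : Graph) → Outputs τ₁ ⌜ G ⌝ (IsModularDecomposition G)))
    × (Σ[ τ₂ ∈ MSOTransduction GraphVocabulary CotreeVocabulary ]
    (∀ (G : Graph) → IsCograph G → Outputs τ₂ ⌜ G ⌝ (IsCotree G)))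
    × (Σ[ τ₃ ∈ MSOTransduction GraphVocabulary SplitVocabulary ]
    (∀ (G : Graph) → Outputs τ₃ ⌜ G ⌝ (IsSplitDecomposition G)))
    × (Σ[ τ₄ ∈ MSOTransduction GraphVocabulary BiJoinVocabulary ]
    (∀ (G : Graph) → Undirected G → Outputs τ₄ ⌜ G ⌝ (IsBiJoinDecomposition G)))
corollary7 =
    (TreeTransduction.τ modularSpec , modular-outputs)
  , (TreeTransduction.τ cotreeSpec , λ G _ → cotree-outputs G)
  , (TreeTransduction.τ splitSpec , split-outputs)
  , (TreeTransduction.τ biJoinSpec , biJoin-outputs)
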